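{- Let $\mathcal{E}=\mathcal{A}_1\times\cdots\times\mathcal{A}_d$ be a subset in $\mathbb{F}_q^d$. Suppose that $$\left(\min_{1\le i\le d}|\mathcal{A}_i|\right)^{ -1}|\mathcal{E}|^{k+1}\gg q^{kd}.$$ Then, for $1\le k\le d$, the number of congruence classes of $k$-simplices determined by $\mathcal{E}$ is at least $c\,q^{\binom{k+1}{2}}$ for some positive constant $c$.
   Context: $\mathbb{F}_q$ is the finite field of order $q$, where $q=p^r$ for some prime $p$ and positive integer $r$; the sets $\mathcal{A}_1,\ldots,\mathcal{A}_d$ are subsets of $\mathbb{F}_q$. The notation $X\ll Y$ (equivalently $Y\gg X$) means that there exists a constant $C>0$ such that $X\le CY$, where $X,Y$ are viewed as functions in $q$. $O(d,\mathbb{F}_q)$ denotes the orthogonal group in $\mathbb{F}_q^d$, i.e. the group of linear maps of $\mathbb{F}_q^d$ preserving the standard form $x_1^2+\cdots+x_d^2$. A $k$-simplex in $\mathbb{F}_q^d$ is given by its vertices $(\mathbf{x}_1,\ldots,\mathbf{x}_{k+1})$ in $\mathbb{F}_q^d$. Two $k$-simplices with vertices $(\mathbf{x}_1,\ldots,\mathbf{x}_{k+1})$ and $(\mathbf{y}_1,\ldots,\mathbf{y}_{k+1})$ are in the same congruence class if there exist $\theta\in O(d,\mathbb{F}_q)$ and $\mathbf{z}\in\mathbb{F}_q^d$ with $\mathbf{z}+\theta(\mathbf{x}_i)=\mathbf{y}_i$ for all $i=1,\ldots,k+1$. The number of congruence classes of $k$-simplices determined by $\mathcal{E}$ is the number of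 congruence classes containing a $k$-simplex all of whose vertices lie in $\mathcal{E}$.
   Formalization: The prime p is assumed odd: for p = 2 the claim fails, e.g. for d = k = 2 and E all of F_q^2 the hypothesis holds, but the form is (x_1+x_2)^2 and there are only O(q^2) congruence classes of triangles, not c q^3. -}

module Defs where

open import Algebra.Structures using (IsCommutativeRing)
open import Data.Fin using (Fin)
open import Data.Fin.Properties using (inj⇒≟)
import Data.Fin.Properties as Fin
open import Data.Fin.Subset as Subset using (Subset; ∣_∣)
open import Data.Fin.Subset.Properties using (_∈?_)
open import Data.Integer using (+_)
open import Data.List as List
  using (List; []; _∷_; length; filter; deduplicate; cartesianProductWith)
open import Data.List.Extrema.Nat using (min)
open import Data.List.Membership.Propositional using (_∈_; lose)
open import Data.List.Membership.Propositional.Properties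
  using (∈-cartesianProductWith⁺; ∈-tabulate⁺)
import Data.List.Relation.Unary.All as All
open import Data.List.Relation.Unary.Any using (any?; here; satisfied)
open import Data.Nat using (ℕ; zero; suc)
open import Data.Product using (∃; ∃-syntax; _×_; _,_)
open import Data.Rational using (ℚ; _/_)
open import Data.Vec as Vec using (Vec; []; _∷_; lookup)
open import Data.Vec.Properties using (≡-dec)
open import Function using (_↔_; Inverse)
open import Function.Properties.Inverse using (Inverse⇒Injection)
open import Relation.Binary using (DecidableEquality)
open import Relation.Binary.PropositionalEquality
  using (_≡_; _≢_; refl; subst)
open import Relation.Nullary using (Dec)
open import Relation.Nullary.Decidable using (map′; _×-dec_)
open import Relation.Unary using (Decidable)

private
  variable
    A : Set

fromℕ : ℕ → ℚ
fromℕ n = + n / 1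

-- Exhaustive search: xs lists all elements of A.

∃? : (xs : List A) → (∀ x → x ∈ xs) → {P : A → Set} →
     (∀ x → Dec (P x)) → Dec (∃ P)
∃? xs complete P? =
  map′ satisfied (λ (x , px) → lose (complete x) px) (any? P? xs)

∀? : (xs : List A) → (∀ x → x ∈ xs) → {P : A → Set} →
     (∀ x → Dec (P x)) → Dec (∀ x → P x)
∀? xs complete P? =
  map′ (λ all x → All.lookup all (complete x))
       (λ f → All.tabulate (λ {x} _ → f x))
       (All.all? P? xs)

-- All vectors of length n with entries in xs; without repetition if xs is.

vectors : List A → (n : ℕ) → List (Vec A n)
vectors xs zero    = [] ∷ []
vectors xs (suc n) = cartesianProductWith _∷_ xs (vectors xs n)

vectors-complete : (xs : List A) → (∀ x → x ∈ xs) →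
                   ∀ {n} (v : Vec A n) → v ∈ vectors xs n
vectors-complete xs complete []      = here refl
vectors-complete xs complete (x ∷ v) =
  ∈-cartesianProductWith⁺ _∷_ (complete x) (vectors-complete xs complete v)

record FiniteField (q : ℕ) : Set₁ where
  infixl 6 _+_
  infixl 7 _*_
  field
    Carrier           : Set
    _+_ _*_           : Carrier → Carrier → Carrier
    -_                : Carrier → Carrier
    0# 1#             : Carrier
    isCommutativeRing : IsCommutativeRing _≡_ _+_ _*_ -_ 0# 1#
    0≢1               : 0# ≢ 1#
    inverse           : ∀ x → x ≢ 0# → ∃[ y ] x * y ≡ 1#
    enumeration       : Carrier ↔ Fin q

  index : Carrier → Fin q
  index = Inverse.to enumeration

  infix 4 _≟_
  _≟_ : DecidableEquality Carrier
  _≟_ = inj⇒≟ (Inverse⇒Injection enumeration)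

  elements : List Carrier
  elements = List.tabulate (Inverse.from enumeration)

  elements-complete : ∀ x → x ∈ elements
  elements-complete x =
    subst (_∈ elements) (Inverse.strictlyInverseʳ enumeration x)
          (∈-tabulate⁺ (index x))

module Geometry {q : ℕ} (F : FiniteField q) (d : ℕ) where
  open FiniteField F

  Point : Set
  Point = Vec Carrier d

  points : List Point
  points = vectors elements d

  points-complete : ∀ x → x ∈ points
  points-complete = vectors-complete elements elements-complete

  infix 4 _≟ᴾ_
  _≟ᴾ_ : DecidableEquality Point
  _≟ᴾ_ = ≡-dec _≟_

  infixl 6 _⊕_
  _⊕_ : Point → Point → Point
  _⊕_ = Vec.zipWith _+_

  _∙_ : Point → Point → Carrier
  x ∙ y = Vec.foldr′ _+_ 0# (Vec.zipWith _*_ x y)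

  -- The standard form x₁² + ⋯ + x_d².
  ‖_‖ : Point → Carrier
  ‖ x ‖ = x ∙ x

  -- A linear map of F^d, given by the rows of its matrix.
  LinearMap : Set
  LinearMap = Vec Point d

  _·_ : LinearMap → Point → Point
  θ · x = Vec.map (_∙ x) θ

  -- Membership in O(d, F). In odd characteristic the form is nondegenerate,
  -- so a linear map preserving it is automatically invertible.
  Orthogonal : LinearMap → Set
  Orthogonal θ = ∀ x → ‖ θ · x ‖ ≡ ‖ x ‖

  -- A k-simplex is an arbitrary (k+1)-tuple of vertices: neither distinctness
  -- nor affine independence is required.
  Simplex : ℕ → Set
  Simplex k = Vec Point (suc k)

  infix 4 _≅_ _≅?_
  _≅_ : ∀ {k} → Simplex k → Simplex k → Set
  x ≅ y = ∃[ θ ] (Orthogonal θ ×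
          ∃[ z ] (∀ i → z ⊕ θ · lookup x i ≡ lookup y i))

  _≅?_ : ∀ {k} (x y : Simplex k) → Dec (x ≅ y)
  x ≅? y =
    ∃? (vectors points d) (vectors-complete points points-complete) λ θ →
      ∀? points points-complete (λ v → ‖ θ · v ‖ ≟ ‖ v ‖)
      ×-dec
      ∃? points points-complete λ z →
        Fin.all? λ i → z ⊕ θ · lookup x i ≟ᴾ lookup y i

  module _ {E : Point → Set} (E? : Decidable E) where

    members : List Point
    members = filter E? points

    cardinality : ℕ
    cardinality = length members

    -- The number of congruence classes containing a k-simplex with all its
    -- vertices in E: one representative of each class is kept.
    congruenceClasses : ℕ → ℕ
    congruenceClasses k = length (deduplicate _≅?_ (vectors members (suc k)))

  -- A subset of F is given by the set of indices of its elements under the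
  -- enumeration of F; its cardinality is ∣_∣ from Data.Fin.Subset.
  module _ (A : Fin d → Subset q) where

    Product : Point → Set
    Product x = ∀ i → index (lookup x i) Subset.∈ A i

    product? : Decidable Product
    product? x = Fin.all? λ i → index (lookup x i) ∈? A i

    -- The default value q is an upper bound for every ∣ A i ∣, so for d ≥ 1
    -- this is the minimum of the ∣ A i ∣.
    minCardinality : ℕ
    minCardinality = min q (List.tabulate λ i → ∣ A i ∣)

{-# OPTIONS --safe #-}
-- Congruent simplices are counted through the rigid motions carrying one to the other. By Cauchy-Schwarz,
-- |E|^(2k+2) is at most the number of classes times the number of congruent pairs of simplices in E.
-- The pointwise stabilizer of k vectors has index at most 2^k q^((d-1)+⋯+(d-k)) in O(d), so the congruent
-- pairs are controlled by the moment ∑_θ ∑_z λ_θ(z)^(k+1), where λ_θ(z) = #{u ∈ E : z + θ u ∈ E}.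
--
-- The moment is bounded by its expected value plus |E|^(k-1) times the variance of the λ_θ. The variance is
-- a spectral quantity, but no characters are needed: averaging over all hyperplane directions ξ = θ η turns
-- it into a sum over pairs ξ, η of equal norm of the dispersion of ξ·v - η·u over (u , v) ∈ E × E (the
-- orbits of O(d) are large because there are many reflections). As ‖ξ‖ = ‖η‖ leaves at most two choices
-- for the coordinate ξ_i, and only the |A_i| values of v_i are affected by it, this sum gains the factor
-- |A_i| / q over the trivial bound; i is chosen with |A_i| minimal.
module Submission where

open import Defs

-- The hypothesis is the point where the two parts of the moment balance. Per rotation, values of
-- λ_θ of the order of their mean |E|²/q^d contribute about |E|^(2k+2)/q^(dk), and the variance part
-- is of order |A_i| |E|^(k+1); the assumption bounds the second by a constant times the first. All
-- powers of |E| then cancel, which leaves q to the exponent 1 + 2 + ⋯ + k.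
--
-- Simplices may be degenerate, so the stabilizer bound has to hold for every k-tuple of edge
-- vectors. A dependent edge leaves the stabilizer unchanged, and k ≤ d guarantees that the factor
-- allotted to it is at least 1. The complement W⊥ may also be totally isotropic; the lines used for
-- counting must then be directed away from the complement of the new vector.
--
-- All quantities stay in ℕ: denominators are cleared, a deviation from a mean is an absolute
-- difference scaled by q or q^d, and variance identities are additive, with the squared mean moved
-- to the other side. The constant 4^d takes care of q = 3, where the count of reflections is
-- vacuous.

module SimplexCounting where

  open import Algebra.Bundles using (CommutativeRing)
  open import Data.Empty using (⊥-elim)
  open import Data.Fin as Fin using (Fin; zero; suc)
  import Data.Fin.Properties as Fin
  open import Data.Fin.Subset as Subset using (Subset; inside; outside; ∣_∣)
  open import Data.Fin.Subset.Properties using (_∈?_; drop-there; ∣p∣≤n)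
  import Data.Integer as ℤ
  import Data.Integer.Properties as ℤ
  open import Data.List as List using (List; []; _∷_; _ʳ++_; length)
  open import Data.List.Extrema.Nat using (argmin-sel)
  open import Data.List.Membership.Propositional using (_∈_; find; lose)
  open import Data.List.Membership.Propositional.Properties using (∈-filter⁺; ∈-filter⁻; ∈-tabulate⁻)
  import Data.List.Properties as List
  open import Data.List.Relation.Unary.All as All using (All; []; _∷_)
  open import Data.List.Relation.Unary.AllPairs as AllPairs using (AllPairs; []; _∷_)
  open import Data.List.Relation.Unary.Any using (any?; here; satisfied; there)
  import Data.List.Relation.Unary.Any.Properties as Any
  import Data.List.Relation.Unary.Unique.DecSetoid.Properties as DecSetoid
  open import Data.List.Relation.Unary.Unique.Propositional using (Unique)
  import Data.List.Relation.Unary.Unique.Propositional.Properties as Unique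
  open import Data.Nat hiding (_≟_)
  open import Data.Nat.Combinatorics using (_C_; nC1≡n; nCk+nC[k+1]≡[n+1]C[k+1])
  open import Data.Nat.Divisibility using (_∣_; divides; ∣1⇒≡1)
  open import Data.Nat.Primality
    using (Prime; prime[2]; euclidsLemma; prime⇒irreducible; prime⇒nonTrivial; prime⇒nonZero)
  open import Data.Nat.Properties hiding (_≟_)
  open import Data.Nat.Tactic.RingSolver using (solve-∀)
  open import Data.Product using (∃-syntax; _×_; _,_; proj₁; proj₂)
  import Data.Rational as ℚ
  import Data.Rational.Properties as ℚ
  open import Data.Rational.Unnormalised as ℚᵘ using (mkℚᵘ)
  import Data.Rational.Unnormalised.Properties as ℚᵘ
  open import Data.Sum using (_⊎_; inj₁; inj₂)
  open import Data.Vec as Vec using (Vec; []; _∷_; lookup)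
  import Data.Vec.Membership.Propositional.Properties as VecMembership
  import Data.Vec.Properties as Vec
  open import Function using (_∘_; id; it; Inverse)
  open import Relation.Binary using (DecidableEquality; DecSetoid; IsEquivalence; tri<; tri≈; tri>)
  open import Relation.Binary.PropositionalEquality hiding (decSetoid)
  open import Relation.Nullary using (Dec; yes; no; ¬_)
  open import Relation.Nullary.Decidable using (_×-dec_; ¬?)

  private
    variable
      A B Ω : Set
      m n : ℕ
      Φ Ψ : Set

  -- Finite sums and counting by indicators

  ⟦_⟧ : Dec Φ → ℕ
  ⟦ yes _ ⟧ = 1
  ⟦ no  _ ⟧ = 0

  ⟦⟧≤1 : (P? : Dec Φ) → ⟦ P? ⟧ ≤ 1
  ⟦⟧≤1 (yes _) = ≤-refl
  ⟦⟧≤1 (no _)  = z≤n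

  ⟦⟧-yes : (P? : Dec Φ) → Φ → ⟦ P? ⟧ ≡ 1
  ⟦⟧-yes (yes _) p = refl
  ⟦⟧-yes (no ¬p) p = ⊥-elim (¬p p)

  ⟦⟧-no : (P? : Dec Φ) → ¬ Φ → ⟦ P? ⟧ ≡ 0
  ⟦⟧-no (yes p) ¬p = ⊥-elim (¬p p)
  ⟦⟧-no (no _)  ¬p = refl

  ⟦⟧-≤ : (P? : Dec Φ) {n : ℕ} → (Φ → 1 ≤ n) → ⟦ P? ⟧ ≤ n
  ⟦⟧-≤ (yes p) f = f p
  ⟦⟧-≤ (no _)  f = z≤n

  ⟦⟧-mono : (P? : Dec Φ) (R? : Dec Ψ) → (Φ → Ψ) → ⟦ P? ⟧ ≤ ⟦ R? ⟧
  ⟦⟧-mono P? R? f = ⟦⟧-≤ P? λ p → ≤-reflexive (sym (⟦⟧-yes R? (f p)))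

  ⟦⟧-cong : (P? : Dec Φ) (R? : Dec Ψ) → (Φ → Ψ) → (Ψ → Φ) → ⟦ P? ⟧ ≡ ⟦ R? ⟧
  ⟦⟧-cong P? R? f g = ≤-antisym (⟦⟧-mono P? R? f) (⟦⟧-mono R? P? g)

  ⟦⟧*-cong : (P? : Dec Φ) {m n : ℕ} → (Φ → m ≡ n) → ⟦ P? ⟧ * m ≡ ⟦ P? ⟧ * n
  ⟦⟧*-cong (yes p) f = cong (1 *_) (f p)
  ⟦⟧*-cong (no _)  f = refl

  ⟦⟧*≤ : (P? : Dec Φ) {m n : ℕ} → (Φ → m ≤ n) → ⟦ P? ⟧ * m ≤ n
  ⟦⟧*≤ (yes p) {m} f = ≤-trans (≤-reflexive (*-identityˡ m)) (f p)
  ⟦⟧*≤ (no _)  f = z≤n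

  ⟦⟧-×-dec : (P? : Dec Φ) (R? : Dec Ψ) → ⟦ P? ×-dec R? ⟧ ≡ ⟦ P? ⟧ * ⟦ R? ⟧
  ⟦⟧-×-dec (yes _) (yes _) = refl
  ⟦⟧-×-dec (yes _) (no _)  = refl
  ⟦⟧-×-dec (no _)  R?      = refl

  ∑ : List A → (A → ℕ) → ℕ
  ∑ []       f = 0
  ∑ (x ∷ xs) f = f x + ∑ xs f

  syntax ∑ xs (λ x → e) = ∑[ x ∈ xs ] e
  infix 5 ∑

  ∑-cong : (xs : List A) {f g : A → ℕ} → (∀ x → f x ≡ g x) → ∑ xs f ≡ ∑ xs g
  ∑-cong []       f≗g = refl
  ∑-cong (x ∷ xs) f≗g = cong₂ _+_ (f≗g x) (∑-cong xs f≗g)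

  ∑-mono-∈ : (xs : List A) {f g : A → ℕ} → (∀ x → x ∈ xs → f x ≤ g x) → ∑ xs f ≤ ∑ xs g
  ∑-mono-∈ []       f≤g = z≤n
  ∑-mono-∈ (x ∷ xs) f≤g = +-mono-≤ (f≤g x (here refl)) (∑-mono-∈ xs λ y y∈ → f≤g y (there y∈))

  ∑-mono : (xs : List A) {f g : A → ℕ} → (∀ x → f x ≤ g x) → ∑ xs f ≤ ∑ xs g
  ∑-mono xs f≤g = ∑-mono-∈ xs λ x _ → f≤g x

  ∑-+ : (xs : List A) (f g : A → ℕ) → ∑[ x ∈ xs ] (f x + g x) ≡ ∑ xs f + ∑ xs g
  ∑-+ []       f g = refl
  ∑-+ (x ∷ xs) f g rewrite ∑-+ xs f g = lemma (f x) (g x) (∑ xs f) (∑ xs g)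
    where
    lemma : ∀ a b c d → a + b + (c + d) ≡ a + c + (b + d)
    lemma = solve-∀

  ∑-*ˡ : (xs : List A) (c : ℕ) (f : A → ℕ) → ∑[ x ∈ xs ] (c * f x) ≡ c * ∑ xs f
  ∑-*ˡ []       c f = sym (*-zeroʳ c)
  ∑-*ˡ (x ∷ xs) c f rewrite ∑-*ˡ xs c f = sym (*-distribˡ-+ c (f x) (∑ xs f))

  ∑-*ʳ : (xs : List A) (f : A → ℕ) (c : ℕ) → ∑[ x ∈ xs ] (f x * c) ≡ ∑ xs f * c
  ∑-*ʳ xs f c = trans (∑-cong xs λ x → *-comm (f x) c) (trans (∑-*ˡ xs c f) (*-comm c (∑ xs f)))

  ∑-const : (xs : List A) (c : ℕ) → ∑[ _ ∈ xs ] c ≡ length xs * c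
  ∑-const []       c = refl
  ∑-const (x ∷ xs) c = cong (c +_) (∑-const xs c)

  ∑-1 : (xs : List A) → ∑[ _ ∈ xs ] 1 ≡ length xs
  ∑-1 xs = trans (∑-const xs 1) (*-identityʳ (length xs))

  ∑-0 : (xs : List A) → ∑[ _ ∈ xs ] 0 ≡ 0
  ∑-0 xs = trans (∑-const xs 0) (*-zeroʳ (length xs))

  ∑-swap : (xs : List A) (ys : List B) (f : A → B → ℕ) →
           ∑[ x ∈ xs ] ∑[ y ∈ ys ] f x y ≡ ∑[ y ∈ ys ] ∑[ x ∈ xs ] f x y
  ∑-swap []       ys f = sym (∑-0 ys)
  ∑-swap (x ∷ xs) ys f =
    trans (cong (∑ ys (f x) +_) (∑-swap xs ys f)) (sym (∑-+ ys (f x) λ y → ∑[ x ∈ xs ] f x y))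

  ∑-*-∑ : (xs : List A) (ys : List B) (f : A → ℕ) (g : B → ℕ) →
          ∑[ x ∈ xs ] ∑[ y ∈ ys ] (f x * g y) ≡ ∑ xs f * ∑ ys g
  ∑-*-∑ xs ys f g = trans (∑-cong xs λ x → ∑-*ˡ ys (f x) g) (∑-*ʳ xs f (∑ ys g))

  ∑-∈-≤ : {xs : List A} {x : A} (f : A → ℕ) → x ∈ xs → f x ≤ ∑ xs f
  ∑-∈-≤ f (here refl) = m≤m+n _ _
  ∑-∈-≤ f (there x∈)  = ≤-trans (∑-∈-≤ f x∈) (m≤n+m _ _)

  ∑-filter : {P : A → Set} (P? : ∀ x → Dec (P x)) (xs : List A) (f : A → ℕ) →
             ∑ (List.filter P? xs) f ≡ ∑[ x ∈ xs ] (⟦ P? x ⟧ * f x)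
  ∑-filter P? []       f = refl
  ∑-filter P? (x ∷ xs) f with P? x
  ... | yes _ = cong₂ _+_ (sym (*-identityˡ (f x))) (∑-filter P? xs f)
  ... | no _  = ∑-filter P? xs f

  ∑-++ : (xs ys : List A) (f : A → ℕ) → ∑ (xs List.++ ys) f ≡ ∑ xs f + ∑ ys f
  ∑-++ []       ys f = refl
  ∑-++ (x ∷ xs) ys f = trans (cong (f x +_) (∑-++ xs ys f)) (sym (+-assoc (f x) _ _))

  ∑-map : (g : A → B) (xs : List A) (f : B → ℕ) → ∑ (List.map g xs) f ≡ ∑[ x ∈ xs ] f (g x)
  ∑-map g []       f = refl
  ∑-map g (x ∷ xs) f = cong (f (g x) +_) (∑-map g xs f)

  ∑-cartesianProductWith : {Ω : Set} (g : A → B → Ω) (xs : List A) (ys : List B) (f : Ω → ℕ) →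
    ∑ (List.cartesianProductWith g xs ys) f ≡ ∑[ x ∈ xs ] ∑[ y ∈ ys ] f (g x y)
  ∑-cartesianProductWith g []       ys f = refl
  ∑-cartesianProductWith g (x ∷ xs) ys f = trans
    (∑-++ (List.map (g x) ys) _ f)
    (cong₂ _+_ (∑-map (g x) ys f) (∑-cartesianProductWith g xs ys f))

  ∑-no : {P : A → Set} (P? : ∀ x → Dec (P x)) (xs : List A) →
         (∀ x → x ∈ xs → ¬ P x) → ∑[ x ∈ xs ] ⟦ P? x ⟧ ≡ 0
  ∑-no P? []       none = refl
  ∑-no P? (x ∷ xs) none =
    cong₂ _+_ (⟦⟧-no (P? x) (none x (here refl))) (∑-no P? xs λ y y∈ → none y (there y∈))

  ∑-exclusive-≤1 : {P : A → Set} (P? : ∀ x → Dec (P x)) {xs : List A} →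
                   AllPairs (λ x y → P x → ¬ P y) xs → ∑[ x ∈ xs ] ⟦ P? x ⟧ ≤ 1
  ∑-exclusive-≤1 P? []                    = z≤n
  ∑-exclusive-≤1 P? {x ∷ xs} (excl ∷ rest) with P? x
  ... | yes px = ≤-reflexive (cong suc (∑-no P? xs λ y y∈ → All.lookup excl y∈ px))
  ... | no _   = ∑-exclusive-≤1 P? rest

  module _ {P : A → Set} (P? : ∀ x → Dec (P x)) {xs : List A} (unique : Unique xs) where

    ∑-unique-≤1 : (∀ x y → P x → P y → x ≡ y) → ∑[ x ∈ xs ] ⟦ P? x ⟧ ≤ 1
    ∑-unique-≤1 same = ∑-exclusive-≤1 P?
      (AllPairs.map (λ {x} {y} x≢y px py → x≢y (same x y px py)) unique)

    ∑-unique-1 : (∀ x y → P x → P y → x ≡ y) → ∀ x → x ∈ xs → P x → ∑[ x ∈ xs ] ⟦ P? x ⟧ ≡ 1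
    ∑-unique-1 same x x∈ px = ≤-antisym (∑-unique-≤1 same)
      (≤-trans (≤-reflexive (sym (⟦⟧-yes (P? x) px))) (∑-∈-≤ (λ y → ⟦ P? y ⟧) x∈))

  module _ (_≟ᴮ_ : DecidableEquality B) {ys : List B} (unique : Unique ys) where

    ∑-pick : (h : B → ℕ) {b : B} → b ∈ ys → ∑[ y ∈ ys ] (⟦ b ≟ᴮ y ⟧ * h y) ≡ h b
    ∑-pick h {b} b∈ = begin
      ∑[ y ∈ ys ] (⟦ b ≟ᴮ y ⟧ * h y)  ≡⟨ ∑-cong ys (λ y → ⟦⟧*-cong (b ≟ᴮ y) λ b≡y → cong h (sym b≡y)) ⟩
      ∑[ y ∈ ys ] (⟦ b ≟ᴮ y ⟧ * h b)  ≡⟨ ∑-*ʳ ys (λ y → ⟦ b ≟ᴮ y ⟧) (h b) ⟩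
      (∑[ y ∈ ys ] ⟦ b ≟ᴮ y ⟧) * h b  ≡⟨ cong (_* h b) (∑-unique-1 (b ≟ᴮ_) unique (λ _ _ p q → trans (sym p) q) b b∈ refl) ⟩
      1 * h b                         ≡⟨ *-identityˡ (h b) ⟩
      h b                             ∎
      where open ≡-Reasoning

    -- Terms are sorted by the value of `g`; as `ys` has no repetition, each `x` is met by exactly
    -- one `y`. The weight takes that value as a separate argument, so that it can be replaced by
    -- the label `y` of the fibre.
    ∑-fibres : (xs : List A) (g : A → B) → (∀ x → x ∈ xs → g x ∈ ys) → (f : A → B → ℕ) →
               ∑[ x ∈ xs ] f x (g x) ≡ ∑[ y ∈ ys ] ∑[ x ∈ xs ] (⟦ g x ≟ᴮ y ⟧ * f x y)
    ∑-fibres xs g g∈ f = trans (go xs g∈) (∑-swap xs ys λ x y → ⟦ g x ≟ᴮ y ⟧ * f x y)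
      where
      go : ∀ xs → (∀ x → x ∈ xs → g x ∈ ys) →
           ∑[ x ∈ xs ] f x (g x) ≡ ∑[ x ∈ xs ] ∑[ y ∈ ys ] (⟦ g x ≟ᴮ y ⟧ * f x y)
      go []       g∈ = refl
      go (x ∷ xs) g∈ = cong₂ _+_ (sym (∑-pick (f x) (g∈ x (here refl)))) (go xs λ x x∈ → g∈ x (there x∈))

    -- After sorting by fibres, injectivity leaves at most one `x` above each `y`.
    ∑-reindex-≤ : {xs : List A} → Unique xs → (g : A → B) → (∀ x y → g x ≡ g y → x ≡ y) →
                  (∀ x → x ∈ xs → g x ∈ ys) → (h : B → ℕ) → ∑[ x ∈ xs ] h (g x) ≤ ∑ ys h
    ∑-reindex-≤ {xs = xs} uniqueˣ g inj g∈ h = begin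
      ∑[ x ∈ xs ] h (g x)                          ≡⟨ ∑-fibres xs g g∈ (λ _ → h) ⟩
      ∑[ y ∈ ys ] ∑[ x ∈ xs ] (⟦ g x ≟ᴮ y ⟧ * h y) ≡⟨ ∑-cong ys (λ y → ∑-*ʳ xs (λ x → ⟦ g x ≟ᴮ y ⟧) (h y)) ⟩
      ∑[ y ∈ ys ] ((∑[ x ∈ xs ] ⟦ g x ≟ᴮ y ⟧) * h y) ≤⟨ ∑-mono ys (λ y → *-monoˡ-≤ (h y)
                                                        (∑-unique-≤1 (λ x → g x ≟ᴮ y) uniqueˣ λ u v p q → inj u v (trans p (sym q)))) ⟩
      ∑[ y ∈ ys ] (1 * h y)                        ≡⟨ ∑-cong ys (λ y → *-identityˡ (h y)) ⟩
      ∑ ys h                                       ∎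
      where open ≤-Reasoning

  -- Bijections and the pigeonhole principle on finite sets

  record Finite (A : Set) : Set where
    field
      universe : List A
      unique   : Unique universe
      complete : ∀ x → x ∈ universe
      _≟ᵘ_     : DecidableEquality A

  module _ (fin : Finite A) where
    open Finite fin

    ∑-reindex : (g g⁻¹ : A → A) → (∀ x → g (g⁻¹ x) ≡ x) → (∀ x → g⁻¹ (g x) ≡ x) →
                (h : A → ℕ) → ∑[ x ∈ universe ] h (g x) ≡ ∑ universe h
    ∑-reindex g g⁻¹ gg⁻¹ g⁻¹g h = ≤-antisym
      (∑-reindex-≤ _≟ᵘ_ unique unique g (λ x y e → trans (sym (g⁻¹g x)) (trans (cong g⁻¹ e) (g⁻¹g y)))
        (λ x _ → complete (g x)) h)
      (≤-trans (≤-reflexive (∑-cong universe λ x → cong h (sym (gg⁻¹ x))))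
        (∑-reindex-≤ _≟ᵘ_ unique unique g⁻¹ (λ x y e → trans (sym (gg⁻¹ x)) (trans (cong g e) (gg⁻¹ y)))
          (λ x _ → complete (g⁻¹ x)) (h ∘ g)))

    -- If `y` were missed, a mark on `y` in addition to one on each image would still leave at most
    -- one mark per element, although there would be one more mark than elements.
    injective⇒surjective : (g : A → A) → (∀ x y → g x ≡ g y → x ≡ y) → ∀ y → ∃[ x ] g x ≡ y
    injective⇒surjective g inj y with any? (λ x → g x ≟ᵘ y) universe
    ... | yes found = satisfied found
    ... | no ¬found = ⊥-elim (1+n≰n (begin
      suc (length universe)
        ≡⟨ +-comm 1 (length universe) ⟩
      length universe + 1
        ≡⟨ cong₂ _+_ (trans (sym (∑-1 universe)) (∑-fibres _≟ᵘ_ unique universe g (λ x _ → complete (g x)) (λ _ _ → 1)))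
                     (sym (∑-unique-1 (y ≟ᵘ_) unique (λ _ _ p q → trans (sym p) q) y (complete y) refl)) ⟩
      (∑[ z ∈ universe ] ∑[ x ∈ universe ] (⟦ g x ≟ᵘ z ⟧ * 1)) + (∑[ z ∈ universe ] ⟦ y ≟ᵘ z ⟧)
        ≡⟨ ∑-+ universe _ _ ⟨
      ∑[ z ∈ universe ] ((∑[ x ∈ universe ] (⟦ g x ≟ᵘ z ⟧ * 1)) + ⟦ y ≟ᵘ z ⟧)
        ≤⟨ ∑-mono universe bound ⟩
      ∑[ z ∈ universe ] 1
        ≡⟨ ∑-1 universe ⟩
      length universe ∎))
      where
      open ≤-Reasoning
      fibre : ∀ z → ∑[ x ∈ universe ] (⟦ g x ≟ᵘ z ⟧ * 1) ≡ ∑[ x ∈ universe ] ⟦ g x ≟ᵘ z ⟧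
      fibre z = ∑-cong universe λ x → *-identityʳ _
      bound : ∀ z → (∑[ x ∈ universe ] (⟦ g x ≟ᵘ z ⟧ * 1)) + ⟦ y ≟ᵘ z ⟧ ≤ 1
      bound z rewrite fibre z with y ≟ᵘ z
      ... | yes refl = ≤-reflexive (cong (_+ 1) (∑-no (λ x → g x ≟ᵘ y) universe
                         λ x x∈ gx≡y → ¬found (lose x∈ gx≡y)))
      ... | no _ rewrite +-identityʳ (∑[ x ∈ universe ] ⟦ g x ≟ᵘ z ⟧) =
        ∑-unique-≤1 (λ x → g x ≟ᵘ z) unique λ u v p q → inj u v (trans p (sym q))

  -- Squares and absolute differences of natural numbers

  2*m*n≤m²+n² : ∀ m n → 2 * (m * n) ≤ m * m + n * n
  2*m*n≤m²+n² m n with ≤-total m n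
  ... | inj₁ m≤n with k , refl ← m≤n⇒∃[o]m+o≡n m≤n =
    ≤-trans (m≤m+n _ (k * k)) (≤-reflexive (lemma m k))
    where
    lemma : ∀ m k → 2 * (m * (m + k)) + k * k ≡ m * m + (m + k) * (m + k)
    lemma = solve-∀
  ... | inj₂ n≤m with k , refl ← m≤n⇒∃[o]m+o≡n n≤m =
    ≤-trans (m≤m+n _ (k * k)) (≤-reflexive (lemma n k))
    where
    lemma : ∀ n k → 2 * ((n + k) * n) + k * k ≡ (n + k) * (n + k) + n * n
    lemma = solve-∀

  -- Cauchy-Schwarz against the constant 1, obtained by summing 2mn ≤ m² + n² over all pairs of
  -- entries.
  ∑²≤length*∑² : (xs : List A) (f : A → ℕ) → ∑ xs f * ∑ xs f ≤ length xs * (∑[ x ∈ xs ] (f x * f x))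
  ∑²≤length*∑² xs f = *-cancelˡ-≤ 2 (begin
    2 * (∑ xs f * ∑ xs f)
      ≡⟨ cong (2 *_) (∑-*-∑ xs xs f f) ⟨
    2 * (∑[ x ∈ xs ] ∑[ y ∈ xs ] (f x * f y))
      ≡⟨ trans (sym (∑-*ˡ xs 2 _)) (∑-cong xs λ x → sym (∑-*ˡ xs 2 _)) ⟩
    ∑[ x ∈ xs ] ∑[ y ∈ xs ] (2 * (f x * f y))
      ≤⟨ ∑-mono xs (λ x → ∑-mono xs λ y → 2*m*n≤m²+n² (f x) (f y)) ⟩
    ∑[ x ∈ xs ] ∑[ y ∈ xs ] (f x * f x + f y * f y)
      ≡⟨ ∑-cong xs (λ x → trans (∑-+ xs _ _) (cong (_+ T) (∑-const xs (f x * f x)))) ⟩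
    ∑[ x ∈ xs ] (length xs * (f x * f x) + T)
      ≡⟨ trans (∑-+ xs _ _) (cong₂ _+_ (∑-*ˡ xs (length xs) _) (∑-const xs T)) ⟩
    length xs * T + length xs * T
      ≡⟨ cong (length xs * T +_) (sym (+-identityʳ _)) ⟩
    2 * (length xs * T) ∎)
    where
    open ≤-Reasoning
    T = ∑[ x ∈ xs ] (f x * f x)

  ∣∑-∑∣≤∑∣-∣ : (xs : List A) (f g : A → ℕ) → ∣ ∑ xs f - ∑ xs g ∣ ≤ ∑[ x ∈ xs ] ∣ f x - g x ∣
  ∣∑-∑∣≤∑∣-∣ []       f g = z≤n
  ∣∑-∑∣≤∑∣-∣ (x ∷ xs) f g = begin
    ∣ f x + ∑ xs f - (g x + ∑ xs g) ∣
      ≤⟨ ∣-∣-triangle (f x + ∑ xs f) (g x + ∑ xs f) (g x + ∑ xs g) ⟩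
    ∣ f x + ∑ xs f - g x + ∑ xs f ∣ + ∣ g x + ∑ xs f - g x + ∑ xs g ∣
      ≡⟨ cong₂ _+_ (trans (cong₂ ∣_-_∣ (+-comm (f x) _) (+-comm (g x) _)) (∣m+n-m+o∣≡∣n-o∣ (∑ xs f) (f x) (g x)))
                   (∣m+n-m+o∣≡∣n-o∣ (g x) (∑ xs f) (∑ xs g)) ⟩
    ∣ f x - g x ∣ + ∣ ∑ xs f - ∑ xs g ∣
      ≤⟨ +-monoʳ-≤ ∣ f x - g x ∣ (∣∑-∑∣≤∑∣-∣ xs f g) ⟩
    ∑[ x ∈ x ∷ xs ] ∣ f x - g x ∣ ∎
    where open ≤-Reasoning

  ∣m+n-m∣≡n : ∀ m n → ∣ m + n - m ∣ ≡ n
  ∣m+n-m∣≡n m n = trans (cong ∣ m + n -_∣ (sym (+-identityʳ m))) (trans (∣m+n-m+o∣≡∣n-o∣ m n 0) (∣-∣-identityʳ n))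

  -- The square of a difference, with the cross term on the left so that nothing is subtracted.
  ∣-∣²+2mn≡m²+n² : ∀ m n → ∣ m - n ∣ * ∣ m - n ∣ + 2 * (m * n) ≡ m * m + n * n
  ∣-∣²+2mn≡m²+n² m n with ≤-total m n
  ... | inj₁ m≤n with k , refl ← m≤n⇒∃[o]m+o≡n m≤n
    rewrite ∣-∣-comm m (m + k) | ∣m+n-m∣≡n m k = lemma m k
    where
    lemma : ∀ m k → k * k + 2 * (m * (m + k)) ≡ m * m + (m + k) * (m + k)
    lemma = solve-∀
  ... | inj₂ n≤m with k , refl ← m≤n⇒∃[o]m+o≡n n≤m
    rewrite ∣m+n-m∣≡n n k = lemma n k
    where
    lemma : ∀ n k → k * k + 2 * ((n + k) * n) ≡ (n + k) * (n + k) + n * n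
    lemma = solve-∀

  ∑-vectors : (xs : List A) (n : ℕ) (f : Vec A (suc n) → ℕ) →
              ∑ (vectors xs (suc n)) f ≡ ∑[ x ∈ xs ] ∑[ v ∈ vectors xs n ] f (x ∷ v)
  ∑-vectors xs n f = ∑-cartesianProductWith _∷_ xs (vectors xs n) f

  length-vectors : (xs : List A) (n : ℕ) → length (vectors xs n) ≡ length xs ^ n
  length-vectors xs zero    = refl
  length-vectors xs (suc n) = begin
    length (vectors xs (suc n))                 ≡⟨ ∑-1 (vectors xs (suc n)) ⟨
    ∑[ _ ∈ vectors xs (suc n) ] 1               ≡⟨ ∑-vectors xs n (λ _ → 1) ⟩
    ∑[ _ ∈ xs ] ∑[ _ ∈ vectors xs n ] 1         ≡⟨ ∑-const xs _ ⟩
    length xs * (∑[ _ ∈ vectors xs n ] 1)       ≡⟨ cong (length xs *_) (trans (∑-1 (vectors xs n)) (length-vectors xs n)) ⟩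
    length xs * length xs ^ n                   ∎
    where open ≡-Reasoning

  vectors-unique : {xs : List A} → Unique xs → (n : ℕ) → Unique (vectors xs n)
  vectors-unique unique zero    = All.[] ∷ []
  vectors-unique unique (suc n) = Unique.cartesianProductWith⁺ _∷_ Vec.∷-injective unique (vectors-unique unique n)

  -- Field arithmetic and roots of polynomials of degree at most 2

  module Scalars {q : ℕ} (F : FiniteField q) where

    open FiniteField F public
      renaming (Carrier to 𝔽; _+_ to infixl 6 _+ᶠ_; _*_ to infixl 7 _*ᶠ_; -_ to -ᶠ_; _≟_ to infix 4 _≟ᶠ_)

    commutativeRing : CommutativeRing _ _
    commutativeRing = record { isCommutativeRing = isCommutativeRing }

    module R = CommutativeRing commutativeRing

    open import Algebra.Properties.AbelianGroup R.+-abelianGroup using (∙-cancelˡ)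
    open import Algebra.Solver.Ring.NaturalCoefficients.Default R.commutativeSemiring public
      using (solve; con; _:+_; _:*_; _:=_)

    -- Subtraction is spelled with this constant to suit a solver for commutative semirings: it
    -- enters as an indeterminate, terms are collected with the factor `1# +ᶠ -1ᶠ`, and that factor
    -- is then replaced by 0.
    -1ᶠ : 𝔽
    -1ᶠ = -ᶠ 1#

    1+-1≡0 : 1# +ᶠ -1ᶠ ≡ 0#
    1+-1≡0 = R.-‿inverseʳ 1#

    elements-finite : Finite 𝔽
    elements-finite = record
      { universe = elements
      ; unique   = Unique.tabulate⁺ λ {i} {j} e →
          trans (sym (Inverse.strictlyInverseˡ enumeration i))
                (trans (cong index e) (Inverse.strictlyInverseˡ enumeration j))
      ; complete = elements-complete
      ; _≟ᵘ_     = _≟ᶠ_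
      }

    elements-unique : Unique elements
    elements-unique = Finite.unique elements-finite

    length-elements : length elements ≡ q
    length-elements = List.length-tabulate _

    +-cancelˡᶠ : ∀ x {y z} → x +ᶠ y ≡ x +ᶠ z → y ≡ z
    +-cancelˡᶠ x = ∙-cancelˡ x _ _

    *-cancelˡᶠ : ∀ {x} → x ≢ 0# → ∀ {y z} → x *ᶠ y ≡ x *ᶠ z → y ≡ z
    *-cancelˡᶠ {x} x≢0 {y} {z} xy≡xz = trans (sym (undo y)) (trans (cong (x⁻¹ *ᶠ_) xy≡xz) (undo z))
      where
      x⁻¹ = proj₁ (inverse x x≢0)
      undo : ∀ y → x⁻¹ *ᶠ (x *ᶠ y) ≡ y
      undo y = trans (sym (R.*-assoc x⁻¹ x y))
        (trans (cong (_*ᶠ y) (trans (R.*-comm x⁻¹ x) (proj₂ (inverse x x≢0)))) (R.*-identityˡ y))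

    x*y≡0⇒y≡0 : ∀ {x y} → x ≢ 0# → x *ᶠ y ≡ 0# → y ≡ 0#
    x*y≡0⇒y≡0 {x} x≢0 xy≡0 = *-cancelˡᶠ x≢0 (trans xy≡0 (sym (R.zeroʳ x)))

    x*y≢0 : ∀ {x y} → x ≢ 0# → y ≢ 0# → x *ᶠ y ≢ 0#
    x*y≢0 x≢0 y≢0 xy≡0 = y≢0 (x*y≡0⇒y≡0 x≢0 xy≡0)

    x-y≡0⇒x≡y : ∀ {x y} → x +ᶠ -1ᶠ *ᶠ y ≡ 0# → x ≡ y
    x-y≡0⇒x≡y {x} {y} e = begin
      x                                ≡⟨ R.+-identityʳ x ⟨
      x +ᶠ 0#                          ≡⟨ cong (x +ᶠ_) (trans (cong (_*ᶠ y) 1+-1≡0) (R.zeroˡ y)) ⟨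
      x +ᶠ (1# +ᶠ -1ᶠ) *ᶠ y            ≡⟨ solve 3 (λ x y m → x :+ (con 1 :+ m) :* y := (x :+ m :* y) :+ y) refl x y -1ᶠ ⟩
      (x +ᶠ -1ᶠ *ᶠ y) +ᶠ y             ≡⟨ cong (_+ᶠ y) e ⟩
      0# +ᶠ y                          ≡⟨ R.+-identityˡ y ⟩
      y                                ∎
      where open ≡-Reasoning

    linear-root : ∀ {β} γ δ → β ≢ 0# → ∑[ t ∈ elements ] ⟦ γ +ᶠ t *ᶠ β ≟ᶠ δ ⟧ ≡ 1
    linear-root {β} γ δ β≢0 = ∑-unique-1 (λ t → γ +ᶠ t *ᶠ β ≟ᶠ δ) elements-unique
      (λ s t p r → *-cancelˡᶠ β≢0 (trans (R.*-comm β s) (trans (+-cancelˡᶠ γ (trans p (sym r))) (R.*-comm t β))))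
      t₀ (elements-complete t₀) root
      where
      β⁻¹ = proj₁ (inverse β β≢0)
      t₀ = (δ +ᶠ -1ᶠ *ᶠ γ) *ᶠ β⁻¹
      root : γ +ᶠ t₀ *ᶠ β ≡ δ
      root = begin
        γ +ᶠ (δ +ᶠ -1ᶠ *ᶠ γ) *ᶠ β⁻¹ *ᶠ β
          ≡⟨ solve 5 (λ γ δ m b c → γ :+ (δ :+ m :* γ) :* c :* b := γ :+ (δ :+ m :* γ) :* (b :* c)) refl γ δ -1ᶠ β β⁻¹ ⟩
        γ +ᶠ (δ +ᶠ -1ᶠ *ᶠ γ) *ᶠ (β *ᶠ β⁻¹)
          ≡⟨ cong (λ i → γ +ᶠ (δ +ᶠ -1ᶠ *ᶠ γ) *ᶠ i) (proj₂ (inverse β β≢0)) ⟩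
        γ +ᶠ (δ +ᶠ -1ᶠ *ᶠ γ) *ᶠ 1#
          ≡⟨ solve 3 (λ γ δ m → γ :+ (δ :+ m :* γ) :* con 1 := δ :+ (con 1 :+ m) :* γ) refl γ δ -1ᶠ ⟩
        δ +ᶠ (1# +ᶠ -1ᶠ) *ᶠ γ
          ≡⟨ cong (λ o → δ +ᶠ o *ᶠ γ) 1+-1≡0 ⟩
        δ +ᶠ 0# *ᶠ γ
          ≡⟨ solve 2 (λ δ γ → δ :+ con 0 :* γ := δ) refl δ γ ⟩
        δ ∎
        where open ≡-Reasoning

    -- The difference of two values of a quadratic factors as (t - s)((s + t)α + β). The second
    -- factor is linear in t, which reduces the search for further roots to degree 1.
    root-difference : ∀ α β γ {s t} → γ +ᶠ t *ᶠ β +ᶠ t *ᶠ t *ᶠ α ≡ γ +ᶠ s *ᶠ β +ᶠ s *ᶠ s *ᶠ α →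
                      (t +ᶠ -1ᶠ *ᶠ s) *ᶠ ((s *ᶠ α +ᶠ β) +ᶠ t *ᶠ α) ≡ 0#
    root-difference α β γ {s} {t} e = +-cancelˡᶠ (γ +ᶠ s *ᶠ β +ᶠ s *ᶠ s *ᶠ α) (begin
      γ +ᶠ s *ᶠ β +ᶠ s *ᶠ s *ᶠ α +ᶠ (t +ᶠ -1ᶠ *ᶠ s) *ᶠ ((s *ᶠ α +ᶠ β) +ᶠ t *ᶠ α)
        ≡⟨ solve 6 (λ α β γ s t m →
             γ :+ s :* β :+ s :* s :* α :+ (t :+ m :* s) :* ((s :* α :+ β) :+ t :* α) :=
             (γ :+ t :* β :+ t :* t :* α) :+ (con 1 :+ m) :* (t :* s :* α :+ s :* s :* α :+ s :* β))
             refl α β γ s t -1ᶠ ⟩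
      (γ +ᶠ t *ᶠ β +ᶠ t *ᶠ t *ᶠ α) +ᶠ (1# +ᶠ -1ᶠ) *ᶠ (t *ᶠ s *ᶠ α +ᶠ s *ᶠ s *ᶠ α +ᶠ s *ᶠ β)
        ≡⟨ cong₂ (λ x o → x +ᶠ o *ᶠ (t *ᶠ s *ᶠ α +ᶠ s *ᶠ s *ᶠ α +ᶠ s *ᶠ β)) e 1+-1≡0 ⟩
      (γ +ᶠ s *ᶠ β +ᶠ s *ᶠ s *ᶠ α) +ᶠ 0# *ᶠ (t *ᶠ s *ᶠ α +ᶠ s *ᶠ s *ᶠ α +ᶠ s *ᶠ β)
        ≡⟨ cong (γ +ᶠ s *ᶠ β +ᶠ s *ᶠ s *ᶠ α +ᶠ_) (R.zeroˡ _) ⟩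
      γ +ᶠ s *ᶠ β +ᶠ s *ᶠ s *ᶠ α +ᶠ 0# ∎)
      where open ≡-Reasoning

    -- Relative to a fixed root s, every other root t satisfies (t + s) α + β = 0.
    quadratic-roots : ∀ α β γ δ → α ≢ 0# ⊎ β ≢ 0# →
                      ∑[ t ∈ elements ] ⟦ γ +ᶠ t *ᶠ β +ᶠ t *ᶠ t *ᶠ α ≟ᶠ δ ⟧ ≤ 2
    quadratic-roots α β γ δ nontrivial with any? (λ t → γ +ᶠ t *ᶠ β +ᶠ t *ᶠ t *ᶠ α ≟ᶠ δ) elements
    ... | no ¬root = ≤-trans (≤-reflexive (∑-no (λ t → γ +ᶠ t *ᶠ β +ᶠ t *ᶠ t *ᶠ α ≟ᶠ δ) elements
                       λ t t∈ root → ¬root (lose t∈ root))) z≤n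
    ... | yes root with s , s-root ← satisfied root = begin
      ∑[ t ∈ elements ] ⟦ γ +ᶠ t *ᶠ β +ᶠ t *ᶠ t *ᶠ α ≟ᶠ δ ⟧
        ≤⟨ ∑-mono elements (λ t → ⟦⟧-≤ (γ +ᶠ t *ᶠ β +ᶠ t *ᶠ t *ᶠ α ≟ᶠ δ) (split t)) ⟩
      ∑[ t ∈ elements ] (⟦ s ≟ᶠ t ⟧ + ⟦ (s *ᶠ α +ᶠ β) +ᶠ t *ᶠ α ≟ᶠ 0# ⟧)
        ≡⟨ ∑-+ elements _ _ ⟩
      (∑[ t ∈ elements ] ⟦ s ≟ᶠ t ⟧) + (∑[ t ∈ elements ] ⟦ (s *ᶠ α +ᶠ β) +ᶠ t *ᶠ α ≟ᶠ 0# ⟧)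
        ≤⟨ +-mono-≤ (∑-unique-≤1 (s ≟ᶠ_) elements-unique λ _ _ p r → trans (sym p) r) (other (α ≟ᶠ 0#) nontrivial) ⟩
      2 ∎
      where
      open ≤-Reasoning
      split : ∀ t → γ +ᶠ t *ᶠ β +ᶠ t *ᶠ t *ᶠ α ≡ δ → 1 ≤ ⟦ s ≟ᶠ t ⟧ + ⟦ (s *ᶠ α +ᶠ β) +ᶠ t *ᶠ α ≟ᶠ 0# ⟧
      split t t-root with s ≟ᶠ t
      ... | yes _ = s≤s z≤n
      ... | no s≢t = ≤-reflexive (sym (⟦⟧-yes ((s *ᶠ α +ᶠ β) +ᶠ t *ᶠ α ≟ᶠ 0#)
                       (x*y≡0⇒y≡0 (λ e → s≢t (sym (x-y≡0⇒x≡y e))) (root-difference α β γ (trans t-root (sym s-root))))))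
      other : Dec (α ≡ 0#) → α ≢ 0# ⊎ β ≢ 0# → ∑[ t ∈ elements ] ⟦ (s *ᶠ α +ᶠ β) +ᶠ t *ᶠ α ≟ᶠ 0# ⟧ ≤ 1
      other (no α≢0) _ = ≤-reflexive (linear-root (s *ᶠ α +ᶠ β) 0# α≢0)
      other (yes α≡0) (inj₁ α≢0) = ⊥-elim (α≢0 α≡0)
      other (yes refl) (inj₂ β≢0) = ≤-trans (≤-reflexive (∑-no (λ t → (s *ᶠ α +ᶠ β) +ᶠ t *ᶠ α ≟ᶠ 0#) elements λ t _ e →
        β≢0 (trans (solve 3 (λ s b t → b := (s :* con 0 :+ b) :+ t :* con 0) refl s β t) e))) z≤n

    -- If 1 + 1 = 0, then x ↦ x + 1 is an involution without fixed points.
    1+1≢0 : ¬ 2 ∣ q → 1# +ᶠ 1# ≢ 0#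
    1+1≢0 odd 1+1≡0 = odd (divides below (begin
      q                                     ≡⟨ trans (∑-1 elements) length-elements ⟨
      -- Exactly one of x and x + 1 has the smaller index. The involution exchanges the two cases,
      -- so they are equally frequent.
      ∑[ x ∈ elements ] 1                   ≡⟨ ∑-cong elements (λ x → trichotomy (index x) (index (s x)) (x≢sx x)) ⟩
      ∑[ x ∈ elements ] (⟦ index x Fin.<? index (s x) ⟧ + ⟦ index (s x) Fin.<? index x ⟧)
                                            ≡⟨ ∑-+ elements _ _ ⟩
      below + (∑[ x ∈ elements ] ⟦ index (s x) Fin.<? index x ⟧)
                                            ≡⟨ cong (below +_) (∑-reindex elements-finite s s ss ss _) ⟨
      below + (∑[ x ∈ elements ] ⟦ index (s (s x)) Fin.<? index (s x) ⟧)
                                            ≡⟨ cong (below +_) (∑-cong elements λ x → cong (λ y → ⟦ index y Fin.<? index (s x) ⟧) (ss x)) ⟩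
      below + below                         ≡⟨ trans (cong (below +_) (sym (+-identityʳ below))) (*-comm 2 below) ⟩
      below * 2                             ∎))
      where
      open ≡-Reasoning
      s : 𝔽 → 𝔽
      s x = x +ᶠ 1#
      ss : ∀ x → s (s x) ≡ x
      ss x = trans (R.+-assoc x 1# 1#) (trans (cong (x +ᶠ_) 1+1≡0) (R.+-identityʳ x))
      below = ∑[ x ∈ elements ] ⟦ index x Fin.<? index (s x) ⟧
      x≢sx : ∀ x → index x ≢ index (s x)
      x≢sx x e = 0≢1 (+-cancelˡᶠ x (trans (R.+-identityʳ x)
        (trans (sym (Inverse.strictlyInverseʳ enumeration x))
          (trans (cong (Inverse.from enumeration) e) (Inverse.strictlyInverseʳ enumeration (s x))))))
      trichotomy : ∀ (i j : Fin q) → i ≢ j → 1 ≡ ⟦ i Fin.<? j ⟧ + ⟦ j Fin.<? i ⟧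
      trichotomy i j i≢j with Fin.<-cmp i j
      ... | tri< i<j _ j≮i = sym (cong₂ _+_ (⟦⟧-yes (i Fin.<? j) i<j) (⟦⟧-no (j Fin.<? i) j≮i))
      ... | tri≈ _ i≡j _ = ⊥-elim (i≢j i≡j)
      ... | tri> i≮j _ j<i = sym (cong₂ _+_ (⟦⟧-no (i Fin.<? j) i≮j) (⟦⟧-yes (j Fin.<? i) j<i))

  -- Vectors and the standard bilinear form

  module Vectors {q : ℕ} (F : FiniteField q) where

    open Scalars F public

    infix 8 _⊙_
    infixl 7 _⊛_
    infixl 6 _⊞_ _⊟_

    _⊙_ : Vec 𝔽 n → Vec 𝔽 n → 𝔽
    x ⊙ y = Vec.foldr′ _+ᶠ_ 0# (Vec.zipWith _*ᶠ_ x y)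

    _⊞_ : Vec 𝔽 n → Vec 𝔽 n → Vec 𝔽 n
    _⊞_ = Vec.zipWith _+ᶠ_

    _⊛_ : 𝔽 → Vec 𝔽 n → Vec 𝔽 n
    c ⊛ x = Vec.map (c *ᶠ_) x

    _⊟_ : Vec 𝔽 n → Vec 𝔽 n → Vec 𝔽 n
    x ⊟ y = x ⊞ -1ᶠ ⊛ y

    𝟎 : Vec 𝔽 n
    𝟎 = Vec.replicate _ 0#

    basis : Fin n → Vec 𝔽 n
    basis zero    = 1# ∷ 𝟎
    basis (suc i) = 0# ∷ basis i

    ⊙-comm : (x y : Vec 𝔽 n) → x ⊙ y ≡ y ⊙ x
    ⊙-comm []      []      = refl
    ⊙-comm (a ∷ x) (b ∷ y) = cong₂ _+ᶠ_ (R.*-comm a b) (⊙-comm x y)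

    ⊙-⊞ʳ : (x y z : Vec 𝔽 n) → x ⊙ (y ⊞ z) ≡ x ⊙ y +ᶠ x ⊙ z
    ⊙-⊞ʳ []      []      []      = sym (R.+-identityˡ 0#)
    ⊙-⊞ʳ (a ∷ x) (b ∷ y) (c ∷ z) rewrite ⊙-⊞ʳ x y z =
      solve 5 (λ a b c s t → a :* (b :+ c) :+ (s :+ t) := (a :* b :+ s) :+ (a :* c :+ t)) refl a b c (x ⊙ y) (x ⊙ z)

    ⊙-⊛ʳ : (x : Vec 𝔽 n) (c : 𝔽) (y : Vec 𝔽 n) → x ⊙ (c ⊛ y) ≡ c *ᶠ x ⊙ y
    ⊙-⊛ʳ []      c []      = sym (R.zeroʳ c)
    ⊙-⊛ʳ (a ∷ x) c (b ∷ y) rewrite ⊙-⊛ʳ x c y =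
      solve 4 (λ a b c s → a :* (c :* b) :+ c :* s := c :* (a :* b :+ s)) refl a b c (x ⊙ y)

    ⊙-𝟎ʳ : (x : Vec 𝔽 n) → x ⊙ 𝟎 ≡ 0#
    ⊙-𝟎ʳ []      = refl
    ⊙-𝟎ʳ (a ∷ x) rewrite ⊙-𝟎ʳ x = trans (R.+-identityʳ _) (R.zeroʳ a)

    ⊙-⊞ˡ : (x y z : Vec 𝔽 n) → (x ⊞ y) ⊙ z ≡ x ⊙ z +ᶠ y ⊙ z
    ⊙-⊞ˡ x y z = trans (⊙-comm (x ⊞ y) z) (trans (⊙-⊞ʳ z x y) (cong₂ _+ᶠ_ (⊙-comm z x) (⊙-comm z y)))

    ⊙-⊛ˡ : (c : 𝔽) (x y : Vec 𝔽 n) → (c ⊛ x) ⊙ y ≡ c *ᶠ x ⊙ y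
    ⊙-⊛ˡ c x y = trans (⊙-comm (c ⊛ x) y) (trans (⊙-⊛ʳ y c x) (cong (c *ᶠ_) (⊙-comm y x)))

    ⊙-𝟎ˡ : (x : Vec 𝔽 n) → 𝟎 ⊙ x ≡ 0#
    ⊙-𝟎ˡ x = trans (⊙-comm 𝟎 x) (⊙-𝟎ʳ x)

    ⊙-⊟ʳ : (x y z : Vec 𝔽 n) → x ⊙ (y ⊟ z) ≡ x ⊙ y +ᶠ -1ᶠ *ᶠ x ⊙ z
    ⊙-⊟ʳ x y z = trans (⊙-⊞ʳ x y (-1ᶠ ⊛ z)) (cong (x ⊙ y +ᶠ_) (⊙-⊛ʳ x -1ᶠ z))

    ⊙-⊟ˡ : (x y z : Vec 𝔽 n) → (x ⊟ y) ⊙ z ≡ x ⊙ z +ᶠ -1ᶠ *ᶠ y ⊙ z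
    ⊙-⊟ˡ x y z = trans (⊙-⊞ˡ x (-1ᶠ ⊛ y) z) (cong (x ⊙ z +ᶠ_) (⊙-⊛ˡ -1ᶠ y z))

    basis-⊙ : (i : Fin n) (x : Vec 𝔽 n) → basis i ⊙ x ≡ lookup x i
    basis-⊙ zero    (a ∷ x) rewrite ⊙-𝟎ˡ x = trans (R.+-identityʳ _) (R.*-identityˡ a)
    basis-⊙ (suc i) (a ∷ x) rewrite basis-⊙ i x = trans (cong (_+ᶠ lookup x i) (R.zeroˡ a)) (R.+-identityˡ _)

    lookup-extensional : {x y : Vec A n} → (∀ i → lookup x i ≡ lookup y i) → x ≡ y
    lookup-extensional {x = x} {y} e =
      trans (sym (Vec.tabulate∘lookup x)) (trans (Vec.tabulate-cong e) (Vec.tabulate∘lookup y))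

    -- Pairing with basis vectors recovers the coordinates. Vector identities are proved below by
    -- pairing with an arbitrary `u`, which turns them into identities of scalars.
    ⊙-nondegenerate : {x y : Vec 𝔽 n} → (∀ u → u ⊙ x ≡ u ⊙ y) → x ≡ y
    ⊙-nondegenerate {x = x} {y} e = lookup-extensional λ i →
      trans (sym (basis-⊙ i x)) (trans (e (basis i)) (basis-⊙ i y))

    x⊟y≡𝟎⇒x≡y : {x y : Vec 𝔽 n} → x ⊟ y ≡ 𝟎 → x ≡ y
    x⊟y≡𝟎⇒x≡y {x = x} {y} e = ⊙-nondegenerate λ u →
      x-y≡0⇒x≡y (trans (sym (⊙-⊟ʳ u x y)) (trans (cong (u ⊙_) e) (⊙-𝟎ʳ u)))

    ⊟-⊞-cancel : (x y : Vec 𝔽 n) → (x ⊟ y) ⊞ y ≡ x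
    ⊟-⊞-cancel x y = ⊙-nondegenerate λ u → begin
      u ⊙ (x ⊟ y ⊞ y)                          ≡⟨ trans (⊙-⊞ʳ u (x ⊟ y) y) (cong (_+ᶠ u ⊙ y) (⊙-⊟ʳ u x y)) ⟩
      (u ⊙ x +ᶠ -1ᶠ *ᶠ u ⊙ y) +ᶠ u ⊙ y         ≡⟨ solve 3 (λ m a b → (a :+ m :* b) :+ b := a :+ (con 1 :+ m) :* b) refl -1ᶠ (u ⊙ x) (u ⊙ y) ⟩
      u ⊙ x +ᶠ (1# +ᶠ -1ᶠ) *ᶠ u ⊙ y            ≡⟨ cong (λ o → u ⊙ x +ᶠ o *ᶠ u ⊙ y) 1+-1≡0 ⟩
      u ⊙ x +ᶠ 0# *ᶠ u ⊙ y                     ≡⟨ solve 2 (λ a b → a :+ con 0 :* b := a) refl (u ⊙ x) (u ⊙ y) ⟩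
      u ⊙ x ∎
      where open ≡-Reasoning

    ⊞-⊟-cancel : (x y : Vec 𝔽 n) → (x ⊞ y) ⊟ y ≡ x
    ⊞-⊟-cancel x y = ⊙-nondegenerate λ u → begin
      u ⊙ (x ⊞ y ⊟ y)                          ≡⟨ trans (⊙-⊟ʳ u (x ⊞ y) y) (cong (_+ᶠ -1ᶠ *ᶠ u ⊙ y) (⊙-⊞ʳ u x y)) ⟩
      (u ⊙ x +ᶠ u ⊙ y) +ᶠ -1ᶠ *ᶠ u ⊙ y         ≡⟨ solve 3 (λ m a b → (a :+ b) :+ m :* b := a :+ (con 1 :+ m) :* b) refl -1ᶠ (u ⊙ x) (u ⊙ y) ⟩
      u ⊙ x +ᶠ (1# +ᶠ -1ᶠ) *ᶠ u ⊙ y            ≡⟨ cong (λ o → u ⊙ x +ᶠ o *ᶠ u ⊙ y) 1+-1≡0 ⟩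
      u ⊙ x +ᶠ 0# *ᶠ u ⊙ y                     ≡⟨ solve 2 (λ a b → a :+ con 0 :* b := a) refl (u ⊙ x) (u ⊙ y) ⟩
      u ⊙ x ∎
      where open ≡-Reasoning

    infix 20 _ᵀ·_

    _ᵀ·_ : Vec (Vec 𝔽 n) m → Vec 𝔽 m → Vec 𝔽 n
    []      ᵀ· []      = 𝟎
    (r ∷ θ) ᵀ· (a ∷ y) = a ⊛ r ⊞ θ ᵀ· y

    ᵀ-adjoint : (θ : Vec (Vec 𝔽 n) m) (y : Vec 𝔽 m) (x : Vec 𝔽 n) →
                y ⊙ Vec.map (_⊙ x) θ ≡ (θ ᵀ· y) ⊙ x
    ᵀ-adjoint []      []      x = sym (⊙-𝟎ˡ x)
    ᵀ-adjoint (r ∷ θ) (a ∷ y) x = begin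
      a *ᶠ r ⊙ x +ᶠ y ⊙ Vec.map (_⊙ x) θ    ≡⟨ cong₂ _+ᶠ_ (sym (⊙-⊛ˡ a r x)) (ᵀ-adjoint θ y x) ⟩
      (a ⊛ r) ⊙ x +ᶠ (θ ᵀ· y) ⊙ x           ≡⟨ ⊙-⊞ˡ (a ⊛ r) (θ ᵀ· y) x ⟨
      ((r ∷ θ) ᵀ· (a ∷ y)) ⊙ x              ∎
      where open ≡-Reasoning

    -- If `g` is adjoint to `f`, coordinate i of `f x` is e_i · f x = g e_i · x, so the rows of the
    -- matrix of `f` are the vectors g e_i. Linearity of `f` comes with adjointness.
    fromAdjoint : (Vec 𝔽 m → Vec 𝔽 n) → Vec (Vec 𝔽 n) m
    fromAdjoint g = Vec.tabulate (g ∘ basis)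

    fromAdjoint-· : (f : Vec 𝔽 n → Vec 𝔽 m) (g : Vec 𝔽 m → Vec 𝔽 n) →
                    (∀ y x → y ⊙ f x ≡ g y ⊙ x) → ∀ x → Vec.map (_⊙ x) (fromAdjoint g) ≡ f x
    fromAdjoint-· f g adjoint x = lookup-extensional λ i → begin
      lookup (Vec.map (_⊙ x) (fromAdjoint g)) i  ≡⟨ Vec.lookup-map i (_⊙ x) (fromAdjoint g) ⟩
      lookup (fromAdjoint g) i ⊙ x               ≡⟨ cong (_⊙ x) (Vec.lookup∘tabulate (g ∘ basis) i) ⟩
      g (basis i) ⊙ x                            ≡⟨ adjoint (basis i) x ⟨
      basis i ⊙ f x                              ≡⟨ basis-⊙ i (f x) ⟩
      lookup (f x) i                             ∎
      where open ≡-Reasoning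

  -- Averaging over lines, and the orthogonal group

  module Space {q : ℕ} (F : FiniteField q) (odd : ¬ 2 ∣ q) (d : ℕ) where

    open Vectors F public
    open Geometry F d public using (Point; points; points-complete; LinearMap; Orthogonal; _·_; ‖_‖; _≟ᴾ_; Simplex; _≅_; _≅?_)

    Q : ℕ
    Q = q ^ d

    points-finite : Finite Point
    points-finite = record
      { universe = points
      ; unique   = vectors-unique elements-unique d
      ; complete = points-complete
      ; _≟ᵘ_     = _≟ᴾ_
      }

    points-unique : Unique points
    points-unique = Finite.unique points-finite

    length-points : length points ≡ Q
    length-points = trans (length-vectors elements d) (cong (_^ d) length-elements)

    two≢0 : 1# +ᶠ 1# ≢ 0#
    two≢0 = 1+1≢0 odd

    x+x≡0⇒x≡0 : ∀ {x} → x +ᶠ x ≡ 0# → x ≡ 0#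
    x+x≡0⇒x≡0 {x} e = x*y≡0⇒y≡0 two≢0 (trans (solve 1 (λ x → (con 1 :+ con 1) :* x := x :+ x) refl x) e)

    ∑-translate : (w : Point) (f : Point → ℕ) → ∑[ v ∈ points ] f (v ⊞ w) ≡ ∑ points f
    ∑-translate w = ∑-reindex points-finite (_⊞ w) (_⊟ w) (λ v → ⊟-⊞-cancel v w) (λ v → ⊞-⊟-cancel v w)

    -- Each of the q translations by `t ⊛ w` permutes the points. A count in the whole space is
    -- thereby reduced to counts along lines in direction `w`, where the conditions become
    -- polynomial equations in t.
    ∑-average : (w : Point) (f : Point → ℕ) →
                q * ∑ points f ≡ ∑[ v ∈ points ] ∑[ t ∈ elements ] f (v ⊞ t ⊛ w)
    ∑-average w f = begin
      q * ∑ points f                                        ≡⟨ cong (_* ∑ points f) length-elements ⟨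
      length elements * ∑ points f                          ≡⟨ ∑-const elements (∑ points f) ⟨
      ∑[ t ∈ elements ] ∑ points f                          ≡⟨ ∑-cong elements (λ t → ∑-translate (t ⊛ w) f) ⟨
      ∑[ t ∈ elements ] ∑[ v ∈ points ] f (v ⊞ t ⊛ w)       ≡⟨ ∑-swap elements points (λ t v → f (v ⊞ t ⊛ w)) ⟩
      ∑[ v ∈ points ] ∑[ t ∈ elements ] f (v ⊞ t ⊛ w)       ∎
      where open ≡-Reasoning

    ⊙-shift : (u w : Point) (t : 𝔽) (v : Point) → (v ⊞ t ⊛ u) ⊙ w ≡ v ⊙ w +ᶠ t *ᶠ u ⊙ w
    ⊙-shift u w t v = trans (⊙-⊞ˡ v (t ⊛ u) w) (cong (v ⊙ w +ᶠ_) (⊙-⊛ˡ t u w))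

    ‖‖-shift : (u : Point) (t : 𝔽) (v : Point) →
               ‖ v ⊞ t ⊛ u ‖ ≡ ‖ v ‖ +ᶠ t *ᶠ (v ⊙ u +ᶠ v ⊙ u) +ᶠ t *ᶠ t *ᶠ ‖ u ‖
    ‖‖-shift u t v = begin
      (v ⊞ t ⊛ u) ⊙ (v ⊞ t ⊛ u)
        ≡⟨ trans (⊙-shift u (v ⊞ t ⊛ u) t v) (cong₂ (λ a b → a +ᶠ t *ᶠ b) (expand v) (expand u)) ⟩
      (v ⊙ v +ᶠ t *ᶠ v ⊙ u) +ᶠ t *ᶠ (u ⊙ v +ᶠ t *ᶠ u ⊙ u)
        ≡⟨ cong (λ a → (v ⊙ v +ᶠ t *ᶠ v ⊙ u) +ᶠ t *ᶠ (a +ᶠ t *ᶠ u ⊙ u)) (⊙-comm u v) ⟩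
      (v ⊙ v +ᶠ t *ᶠ v ⊙ u) +ᶠ t *ᶠ (v ⊙ u +ᶠ t *ᶠ u ⊙ u)
        ≡⟨ solve 4 (λ t a b c → (a :+ t :* b) :+ t :* (b :+ t :* c) := a :+ t :* (b :+ b) :+ t :* t :* c) refl t (v ⊙ v) (v ⊙ u) (u ⊙ u) ⟩
      ‖ v ‖ +ᶠ t *ᶠ (v ⊙ u +ᶠ v ⊙ u) +ᶠ t *ᶠ t *ᶠ ‖ u ‖ ∎
      where
      open ≡-Reasoning
      expand : ∀ w → w ⊙ (v ⊞ t ⊛ u) ≡ w ⊙ v +ᶠ t *ᶠ w ⊙ u
      expand w = trans (⊙-⊞ʳ w v (t ⊛ u)) (cong (w ⊙ v +ᶠ_) (⊙-⊛ʳ w t u))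

    ‖basis‖≢0 : (i : Fin d) → ‖ basis i ‖ ≢ 0#
    ‖basis‖≢0 i e = 0≢1 (trans (sym e) (trans (basis-⊙ i (basis i)) (diagonal i)))
      where
      diagonal : (i : Fin n) → lookup (basis i) i ≡ 1#
      diagonal zero    = refl
      diagonal (suc i) = diagonal i

    nonzero-coordinate : {w : Point} → w ≢ 𝟎 → ∃[ u ] u ⊙ w ≢ 0#
    nonzero-coordinate {w} w≢𝟎 with any? (λ u → ¬? (u ⊙ w ≟ᶠ 0#)) points
    ... | yes found = satisfied found
    ... | no ¬found = ⊥-elim (w≢𝟎 (⊙-nondegenerate λ u → trans (vanishes u) (sym (⊙-𝟎ʳ u))))
      where
      vanishes : ∀ u → u ⊙ w ≡ 0#
      vanishes u with u ⊙ w ≟ᶠ 0#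
      ... | yes e = e
      ... | no ne = ⊥-elim (¬found (lose (points-complete u) ne))

    -- Along a direction `u` not perpendicular to `w`, the scalar product with `w` is a nonconstant
    -- linear function of t, so every such line meets the hyperplane once.
    hyperplane : {w : Point} → w ≢ 𝟎 → ∀ c → q * (∑[ v ∈ points ] ⟦ v ⊙ w ≟ᶠ c ⟧) ≡ Q
    hyperplane {w} w≢𝟎 c with u , uw≢0 ← nonzero-coordinate w≢𝟎 = begin
      q * (∑[ v ∈ points ] ⟦ v ⊙ w ≟ᶠ c ⟧)
        ≡⟨ ∑-average u (λ v → ⟦ v ⊙ w ≟ᶠ c ⟧) ⟩
      ∑[ v ∈ points ] ∑[ t ∈ elements ] ⟦ (v ⊞ t ⊛ u) ⊙ w ≟ᶠ c ⟧
        ≡⟨ ∑-cong points (λ v → ∑-cong elements λ t → cong (λ a → ⟦ a ≟ᶠ c ⟧) (⊙-shift u w t v)) ⟩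
      ∑[ v ∈ points ] ∑[ t ∈ elements ] ⟦ v ⊙ w +ᶠ t *ᶠ u ⊙ w ≟ᶠ c ⟧
        ≡⟨ ∑-cong points (λ v → linear-root (v ⊙ w) c uw≢0) ⟩
      ∑[ v ∈ points ] 1
        ≡⟨ trans (∑-1 points) length-points ⟩
      Q ∎
      where open ≡-Reasoning

    sphere-line : {u : Point} → ‖ u ‖ ≢ 0# → ∀ v c → ∑[ t ∈ elements ] ⟦ ‖ v ⊞ t ⊛ u ‖ ≟ᶠ c ⟧ ≤ 2
    sphere-line {u} ‖u‖≢0 v c = ≤-trans
      (≤-reflexive (∑-cong elements λ t → cong (λ a → ⟦ a ≟ᶠ c ⟧) (‖‖-shift u t v)))
      (quadratic-roots (‖ u ‖) (v ⊙ u +ᶠ v ⊙ u) (‖ v ‖) c (inj₁ ‖u‖≢0))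

    ·-adjoint : (θ : LinearMap) (y x : Point) → y ⊙ (θ · x) ≡ (θ ᵀ· y) ⊙ x
    ·-adjoint = ᵀ-adjoint

    ·-⊞ : (θ : LinearMap) (x y : Point) → θ · (x ⊞ y) ≡ θ · x ⊞ θ · y
    ·-⊞ θ x y = ⊙-nondegenerate λ u → trans (·-adjoint θ u (x ⊞ y)) (trans (⊙-⊞ʳ (θ ᵀ· u) x y)
      (trans (cong₂ _+ᶠ_ (sym (·-adjoint θ u x)) (sym (·-adjoint θ u y))) (sym (⊙-⊞ʳ u (θ · x) (θ · y)))))

    ·-⊛ : (θ : LinearMap) (c : 𝔽) (x : Point) → θ · (c ⊛ x) ≡ c ⊛ θ · x
    ·-⊛ θ c x = ⊙-nondegenerate λ u → trans (·-adjoint θ u (c ⊛ x)) (trans (⊙-⊛ʳ (θ ᵀ· u) c x)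
      (trans (cong (c *ᶠ_) (sym (·-adjoint θ u x))) (sym (⊙-⊛ʳ u c (θ · x)))))

    ·-⊟ : (θ : LinearMap) (x y : Point) → θ · (x ⊟ y) ≡ θ · x ⊟ θ · y
    ·-⊟ θ x y = trans (·-⊞ θ x (-1ᶠ ⊛ y)) (cong (θ · x ⊞_) (·-⊛ θ -1ᶠ y))

    ·-extensional : {θ φ : LinearMap} → (∀ x → θ · x ≡ φ · x) → θ ≡ φ
    ·-extensional {θ} {φ} e = lookup-extensional λ i → ⊙-nondegenerate λ x → begin
      x ⊙ lookup θ i           ≡⟨ ⊙-comm x (lookup θ i) ⟩
      lookup θ i ⊙ x           ≡⟨ Vec.lookup-map i (_⊙ x) θ ⟨
      lookup (θ · x) i         ≡⟨ cong (λ y → lookup y i) (e x) ⟩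
      lookup (φ · x) i         ≡⟨ Vec.lookup-map i (_⊙ x) φ ⟩
      lookup φ i ⊙ x           ≡⟨ ⊙-comm (lookup φ i) x ⟩
      x ⊙ lookup φ i           ∎
      where open ≡-Reasoning

    ‖‖-⊞ : (x y : Point) → ‖ x ⊞ y ‖ ≡ (‖ x ‖ +ᶠ ‖ y ‖) +ᶠ (x ⊙ y +ᶠ x ⊙ y)
    ‖‖-⊞ x y rewrite ⊙-⊞ˡ x y (x ⊞ y) | ⊙-⊞ʳ x x y | ⊙-⊞ʳ y x y | ⊙-comm y x =
      solve 3 (λ a b c → (a :+ b) :+ (b :+ c) := (a :+ c) :+ (b :+ b)) refl (x ⊙ x) (x ⊙ y) (y ⊙ y)

    -- Polarization: the norm of a sum determines twice the scalar product, and 2 can be cancelled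
    -- because q is odd.
    orthogonal-⊙ : {θ : LinearMap} → Orthogonal θ → ∀ x y → (θ · x) ⊙ (θ · y) ≡ x ⊙ y
    orthogonal-⊙ {θ} orth x y = *-cancelˡᶠ two≢0 (trans (double _) (trans doubled (sym (double _))))
      where
      open ≡-Reasoning
      double : ∀ a → (1# +ᶠ 1#) *ᶠ a ≡ a +ᶠ a
      double = solve 1 (λ x → (con 1 :+ con 1) :* x := x :+ x) refl
      doubled : (θ · x) ⊙ (θ · y) +ᶠ (θ · x) ⊙ (θ · y) ≡ x ⊙ y +ᶠ x ⊙ y
      doubled = +-cancelˡᶠ (‖ x ‖ +ᶠ ‖ y ‖) (begin
        (‖ x ‖ +ᶠ ‖ y ‖) +ᶠ ((θ · x) ⊙ (θ · y) +ᶠ (θ · x) ⊙ (θ · y))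
          ≡⟨ cong₂ (λ a b → (a +ᶠ b) +ᶠ ((θ · x) ⊙ (θ · y) +ᶠ (θ · x) ⊙ (θ · y))) (orth x) (orth y) ⟨
        (‖ θ · x ‖ +ᶠ ‖ θ · y ‖) +ᶠ ((θ · x) ⊙ (θ · y) +ᶠ (θ · x) ⊙ (θ · y))
          ≡⟨ ‖‖-⊞ (θ · x) (θ · y) ⟨
        ‖ θ · x ⊞ θ · y ‖   ≡⟨ cong ‖_‖ (·-⊞ θ x y) ⟨
        ‖ θ · (x ⊞ y) ‖     ≡⟨ orth (x ⊞ y) ⟩
        ‖ x ⊞ y ‖           ≡⟨ ‖‖-⊞ x y ⟩
        (‖ x ‖ +ᶠ ‖ y ‖) +ᶠ (x ⊙ y +ᶠ x ⊙ y) ∎)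

    ᵀ-inverseˡ : {θ : LinearMap} → Orthogonal θ → ∀ x → θ ᵀ· (θ · x) ≡ x
    ᵀ-inverseˡ {θ} orth x = ⊙-nondegenerate λ u → begin
      u ⊙ (θ ᵀ· (θ · x))       ≡⟨ ⊙-comm u _ ⟩
      (θ ᵀ· (θ · x)) ⊙ u       ≡⟨ ·-adjoint θ (θ · x) u ⟨
      (θ · x) ⊙ (θ · u)        ≡⟨ orthogonal-⊙ {θ} orth x u ⟩
      x ⊙ u                    ≡⟨ ⊙-comm x u ⟩
      u ⊙ x                    ∎
      where open ≡-Reasoning

    orthogonal-injective : {θ : LinearMap} → Orthogonal θ → ∀ x y → θ · x ≡ θ · y → x ≡ y
    orthogonal-injective {θ} orth x y e =
      trans (sym (ᵀ-inverseˡ {θ} orth x)) (trans (cong (θ ᵀ·_) e) (ᵀ-inverseˡ {θ} orth y))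

    -- The left inverse is two-sided because an injective map of a finite space to itself is
    -- surjective.
    ᵀ-inverseʳ : {θ : LinearMap} → Orthogonal θ → ∀ x → θ · (θ ᵀ· x) ≡ x
    ᵀ-inverseʳ {θ} orth x
      with y , refl ← injective⇒surjective points-finite (θ ·_) (orthogonal-injective {θ} orth) x =
      cong (θ ·_) (ᵀ-inverseˡ {θ} orth y)

    infix 22 _⁻¹
    infix 21 _⨾_

    𝟏 : LinearMap
    𝟏 = fromAdjoint id

    _⁻¹ : LinearMap → LinearMap
    θ ⁻¹ = fromAdjoint (θ ·_)

    _⨾_ : LinearMap → LinearMap → LinearMap
    θ ⨾ φ = fromAdjoint λ y → φ ᵀ· (θ ᵀ· y)

    𝟏-· : ∀ x → 𝟏 · x ≡ x
    𝟏-· = fromAdjoint-· id id λ _ _ → refl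

    ⁻¹-· : (θ : LinearMap) → ∀ x → θ ⁻¹ · x ≡ θ ᵀ· x
    ⁻¹-· θ = fromAdjoint-· (θ ᵀ·_) (θ ·_) λ y x →
      trans (⊙-comm y (θ ᵀ· x)) (trans (sym (·-adjoint θ x y)) (⊙-comm x (θ · y)))

    ⨾-· : (θ φ : LinearMap) → ∀ x → (θ ⨾ φ) · x ≡ θ · (φ · x)
    ⨾-· θ φ = fromAdjoint-· (λ x → θ · (φ · x)) (λ y → φ ᵀ· (θ ᵀ· y)) λ y x →
      trans (·-adjoint θ y (φ · x)) (·-adjoint φ (θ ᵀ· y) x)

    𝟏-orthogonal : Orthogonal 𝟏
    𝟏-orthogonal x = cong ‖_‖ (𝟏-· x)

    ⁻¹-orthogonal : {θ : LinearMap} → Orthogonal θ → Orthogonal (θ ⁻¹)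
    ⁻¹-orthogonal {θ} orth x = begin
      ‖ θ ⁻¹ · x ‖        ≡⟨ cong ‖_‖ (⁻¹-· θ x) ⟩
      ‖ θ ᵀ· x ‖          ≡⟨ orth (θ ᵀ· x) ⟨
      ‖ θ · (θ ᵀ· x) ‖    ≡⟨ cong ‖_‖ (ᵀ-inverseʳ {θ} orth x) ⟩
      ‖ x ‖               ∎
      where open ≡-Reasoning

    ⨾-orthogonal : {θ φ : LinearMap} → Orthogonal θ → Orthogonal φ → Orthogonal (θ ⨾ φ)
    ⨾-orthogonal {θ} {φ} orthθ orthφ x =
      trans (cong ‖_‖ (⨾-· θ φ x)) (trans (orthθ (φ · x)) (orthφ x))

    ⁻¹-inverseˡ : {θ : LinearMap} → Orthogonal θ → ∀ x → θ ⁻¹ · (θ · x) ≡ x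
    ⁻¹-inverseˡ {θ} orth x = trans (⁻¹-· θ (θ · x)) (ᵀ-inverseˡ {θ} orth x)

    ⁻¹-inverseʳ : {θ : LinearMap} → Orthogonal θ → ∀ x → θ · (θ ⁻¹ · x) ≡ x
    ⁻¹-inverseʳ {θ} orth x = trans (cong (θ ·_) (⁻¹-· θ x)) (ᵀ-inverseʳ {θ} orth x)

    ⨾-injective : {θ : LinearMap} → Orthogonal θ → ∀ φ ψ → θ ⨾ φ ≡ θ ⨾ ψ → φ ≡ ψ
    ⨾-injective {θ} orth φ ψ e = ·-extensional λ x → orthogonal-injective {θ} orth _ _
      (trans (sym (⨾-· θ φ x)) (trans (cong (_· x) e) (⨾-· θ ψ x)))

    orthogonal? : (θ : LinearMap) → Dec (Orthogonal θ)
    orthogonal? θ = ∀? points points-complete λ v → ‖ θ · v ‖ ≟ᶠ ‖ v ‖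

    linearMaps : List LinearMap
    linearMaps = vectors points d

    O : List LinearMap
    O = List.filter orthogonal? linearMaps

    O-unique : Unique O
    O-unique = Unique.filter⁺ orthogonal? (vectors-unique points-unique d)

    orthogonal⇒∈O : {θ : LinearMap} → Orthogonal θ → θ ∈ O
    orthogonal⇒∈O {θ} = ∈-filter⁺ orthogonal? (vectors-complete points points-complete θ)

    ∈O⇒orthogonal : {θ : LinearMap} → θ ∈ O → Orthogonal θ
    ∈O⇒orthogonal θ∈ = proj₂ (∈-filter⁻ orthogonal? {xs = linearMaps} θ∈)

    _≟ᴸ_ : DecidableEquality LinearMap
    _≟ᴸ_ = Vec.≡-dec _≟ᴾ_

    -- Left multiplication by `θ` maps `O` injectively into itself. The inequality is the form in
    -- which the coset arguments below use this.
    ∑-⨾-≤ : {θ : LinearMap} → Orthogonal θ → (h : LinearMap → ℕ) → ∑[ φ ∈ O ] h (θ ⨾ φ) ≤ ∑ O h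
    ∑-⨾-≤ {θ} orth h = ∑-reindex-≤ _≟ᴸ_ O-unique O-unique (θ ⨾_) (⨾-injective {θ} orth)
      (λ φ φ∈ → orthogonal⇒∈O {θ ⨾ φ} (⨾-orthogonal {θ} {φ} orth (∈O⇒orthogonal {φ} φ∈))) h

    ∑-rotate : {θ : LinearMap} → Orthogonal θ → (f : Point → ℕ) → ∑[ x ∈ points ] f (θ · x) ≡ ∑ points f
    ∑-rotate {θ} orth = ∑-reindex points-finite (θ ·_) (θ ⁻¹ ·_) (⁻¹-inverseʳ {θ} orth) (⁻¹-inverseˡ {θ} orth)

  -- Counting equivalence classes through equivalent pairs

  module _ {_∼_ : A → A → Set} (equivalence : IsEquivalence _∼_) (_∼?_ : ∀ x y → Dec (x ∼ y)) where

    private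
      module ∼ = IsEquivalence equivalence

      ∼-decSetoid : DecSetoid _ _
      ∼-decSetoid = record { isDecEquivalence = record { isEquivalence = equivalence ; _≟_ = _∼?_ } }

    -- Cauchy-Schwarz over the class sizes. Every element is equivalent to some representative, and
    -- two elements have a common representative only if they are equivalent, and then at most one.
    length²≤classes*pairs : (xs : List A) → length xs * length xs ≤
      length (List.deduplicate _∼?_ xs) * (∑[ x ∈ xs ] ∑[ y ∈ xs ] ⟦ x ∼? y ⟧)
    length²≤classes*pairs xs = begin
      length xs * length xs
        ≤⟨ *-mono-≤ cover cover ⟩
      ∑ reps size * ∑ reps size
        ≤⟨ ∑²≤length*∑² reps size ⟩
      length reps * (∑[ r ∈ reps ] (size r * size r))
        ≡⟨ cong (length reps *_) (∑-cong reps λ r → sym (∑-*-∑ xs xs _ _)) ⟩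
      length reps * (∑[ r ∈ reps ] ∑[ x ∈ xs ] ∑[ y ∈ xs ] (⟦ r ∼? x ⟧ * ⟦ r ∼? y ⟧))
        ≡⟨ cong (length reps *_) (trans (∑-swap reps xs _) (∑-cong xs λ x → ∑-swap reps xs _)) ⟩
      length reps * (∑[ x ∈ xs ] ∑[ y ∈ xs ] ∑[ r ∈ reps ] (⟦ r ∼? x ⟧ * ⟦ r ∼? y ⟧))
        ≤⟨ *-monoʳ-≤ (length reps) (∑-mono xs λ x → ∑-mono xs λ y → common x y) ⟩
      length reps * (∑[ x ∈ xs ] ∑[ y ∈ xs ] ⟦ x ∼? y ⟧) ∎
      where
      open ≤-Reasoning
      reps = List.deduplicate _∼?_ xs
      size : A → ℕ
      size r = ∑[ x ∈ xs ] ⟦ r ∼? x ⟧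
      represented : ∀ x → x ∈ xs → 1 ≤ ∑[ r ∈ reps ] ⟦ r ∼? x ⟧
      represented x x∈ with r , r∈ , r∼x ← find (Any.deduplicate⁺ _∼?_ {P = _∼ x} ∼.trans (lose x∈ ∼.refl)) =
        ≤-trans (≤-reflexive (sym (⟦⟧-yes (r ∼? x) r∼x))) (∑-∈-≤ (λ r → ⟦ r ∼? x ⟧) r∈)
      cover : length xs ≤ ∑ reps size
      cover = begin
        length xs                                   ≡⟨ ∑-1 xs ⟨
        ∑[ x ∈ xs ] 1                               ≤⟨ ∑-mono-∈ xs represented ⟩
        ∑[ x ∈ xs ] ∑[ r ∈ reps ] ⟦ r ∼? x ⟧        ≡⟨ ∑-swap xs reps _ ⟩
        ∑ reps size                                 ∎
      common : ∀ x y → ∑[ r ∈ reps ] (⟦ r ∼? x ⟧ * ⟦ r ∼? y ⟧) ≤ ⟦ x ∼? y ⟧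
      common x y with x ∼? y
      ... | yes _ = begin
        ∑[ r ∈ reps ] (⟦ r ∼? x ⟧ * ⟦ r ∼? y ⟧)
          ≤⟨ ∑-mono reps (λ r → ≤-trans (*-monoʳ-≤ ⟦ r ∼? x ⟧ (⟦⟧≤1 (r ∼? y))) (≤-reflexive (*-identityʳ _))) ⟩
        ∑[ r ∈ reps ] ⟦ r ∼? x ⟧
          ≤⟨ ∑-exclusive-≤1 (_∼? x) (AllPairs.map (λ r≁s r∼x s∼x → r≁s (∼.trans r∼x (∼.sym s∼x)))
               (DecSetoid.deduplicate-! ∼-decSetoid xs)) ⟩
        1 ∎
      ... | no x≁y = ≤-reflexive (trans (∑-cong reps λ r → disjoint r (r ∼? x) (r ∼? y)) (∑-0 reps))
        where
        disjoint : ∀ r (p : Dec (r ∼ x)) (p′ : Dec (r ∼ y)) → ⟦ p ⟧ * ⟦ p′ ⟧ ≡ 0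
        disjoint r (yes p) (yes p′) = ⊥-elim (x≁y (∼.trans (∼.sym p) p′))
        disjoint r (yes _) (no _)   = refl
        disjoint r (no _)  _        = refl

  -- Stabilizers of finitely many vectors

  ladder : ℕ → ℕ → ℕ
  ladder j zero    = 0
  ladder j (suc m) = suc j + ladder (suc j) m

  -- `ladder j m` is (j+1) + ⋯ + (j+m), and its recursion removes the smallest term. A vector that
  -- depends on earlier ones does not increase j, so there the largest term has to be removed
  -- instead.
  ladder-last : ∀ j m → ladder j (suc m) ≡ ladder j m + (j + suc m)
  ladder-last j zero    = lemma j
    where
    lemma : ∀ j → suc j + 0 ≡ j + 1
    lemma = solve-∀
  ladder-last j (suc m) = trans (cong (suc j +_) (ladder-last (suc j) m)) (lemma j (ladder (suc j) m) m)
    where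
    lemma : ∀ j l m → suc j + (l + (suc j + suc m)) ≡ suc j + l + (j + suc (suc m))
    lemma = solve-∀

  module Stabilizers {q : ℕ} (F : FiniteField q) (odd : ¬ 2 ∣ q) (d : ℕ) where

    open Space F odd d public

    Perp : List Point → Point → Set
    Perp W u = All (λ w → u ⊙ w ≡ 0#) W

    perp? : (W : List Point) (u : Point) → Dec (Perp W u)
    perp? W u = All.all? (λ w → u ⊙ w ≟ᶠ 0#) W

    ∣_⊥∣ : List Point → ℕ
    ∣ W ⊥∣ = ∑[ u ∈ points ] ⟦ perp? W u ⟧

    Fixes : List Point → LinearMap → Set
    Fixes W θ = All (λ w → θ · w ≡ w) W

    fixes? : (W : List Point) (θ : LinearMap) → Dec (Fixes W θ)
    fixes? W θ = All.all? (λ w → θ · w ≟ᴾ w) W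

    ∣Stab_∣ : List Point → ℕ
    ∣Stab W ∣ = ∑[ θ ∈ O ] ⟦ fixes? W θ ⟧

    difference≡0 : ∀ {a b} → a ≡ b → a +ᶠ -1ᶠ *ᶠ b ≡ 0#
    difference≡0 {a} refl = trans (solve 2 (λ a m → a :+ m :* a := (con 1 :+ m) :* a) refl a -1ᶠ)
      (trans (cong (_*ᶠ a) 1+-1≡0) (R.zeroˡ a))

    -- The assumption puts `w` in the double complement of `W`. Every θᵀ v - v is perpendicular to
    -- the vectors of `W`, which θ fixes, hence also to `w`; this says v · θ w = v · w for all v.
    fixes-dependent : ∀ {W w} → (∀ u → Perp W u → u ⊙ w ≡ 0#) → ∀ {θ} → Fixes W θ → θ · w ≡ w
    fixes-dependent {W} {w} dependent {θ} fix = ⊙-nondegenerate λ v → trans (·-adjoint θ v w)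
      (x-y≡0⇒x≡y (trans (sym (⊙-⊟ˡ (θ ᵀ· v) v w)) (dependent (θ ᵀ· v ⊟ v) (All.map (moves v) fix))))
      where
      moves : ∀ v {w′} → θ · w′ ≡ w′ → (θ ᵀ· v ⊟ v) ⊙ w′ ≡ 0#
      moves v {w′} e = trans (⊙-⊟ˡ (θ ᵀ· v) v w′)
        (difference≡0 (trans (sym (·-adjoint θ v w′)) (cong (v ⊙_) e)))

    module Extend (W : List Point) (w : Point) where

      -- Orthogonal maps fixing `W` preserve scalar products with `W`, so they move `w` only within
      -- this coset of W⊥.
      Agree : Point → Set
      Agree v = All (λ w′ → v ⊙ w′ ≡ w ⊙ w′) W

      agree? : ∀ v → Dec (Agree v)
      agree? v = All.all? (λ w′ → v ⊙ w′ ≟ᶠ w ⊙ w′) W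

      candidate? : ∀ v → Dec (Agree v × ‖ v ‖ ≡ ‖ w ‖)
      candidate? v = agree? v ×-dec (‖ v ‖ ≟ᶠ ‖ w ‖)

      ∣Agree∣≤∣⊥∣ : ∑[ v ∈ points ] ⟦ agree? v ⟧ ≤ ∣ W ⊥∣
      ∣Agree∣≤∣⊥∣ = begin
        ∑[ v ∈ points ] ⟦ agree? v ⟧          ≡⟨ ∑-translate w (λ v → ⟦ agree? v ⟧) ⟨
        ∑[ v ∈ points ] ⟦ agree? (v ⊞ w) ⟧    ≤⟨ ∑-mono points (λ v → ⟦⟧-mono (agree? (v ⊞ w)) (perp? W v) (All.map (cancel v))) ⟩
        ∣ W ⊥∣                                ∎
        where
        open ≤-Reasoning
        cancel : ∀ v {w′} → (v ⊞ w) ⊙ w′ ≡ w ⊙ w′ → v ⊙ w′ ≡ 0#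
        cancel v {w′} e = +-cancelˡᶠ (w ⊙ w′) (trans (R.+-comm (w ⊙ w′) (v ⊙ w′))
          (trans (sym (⊙-⊞ˡ v w w′)) (trans e (sym (R.+-identityʳ (w ⊙ w′))))))

      agree-unshift : ∀ u → Perp W u → ∀ t v → Agree (v ⊞ t ⊛ u) → Agree v
      agree-unshift u perp t v agree = All.zipWith (λ {w′} → unshift {w′}) (perp , agree)
        where
        unshift : ∀ {w′} → u ⊙ w′ ≡ 0# × (v ⊞ t ⊛ u) ⊙ w′ ≡ w ⊙ w′ → v ⊙ w′ ≡ w ⊙ w′
        unshift {w′} (e , e′) = trans (sym (trans (⊙-shift u w′ t v)
          (trans (cong (λ a → v ⊙ w′ +ᶠ t *ᶠ a) e) (trans (cong (v ⊙ w′ +ᶠ_) (R.zeroʳ t)) (R.+-identityʳ _))))) e′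

      -- Averaging over lines in a direction u ⊥ W, along which the norm is a nonconstant polynomial of
      -- degree at most 2.
      q*candidates≤ : ∀ u → Perp W u →
        (∀ v → Agree v → ∑[ t ∈ elements ] ⟦ ‖ v ⊞ t ⊛ u ‖ ≟ᶠ ‖ w ‖ ⟧ ≤ 2) →
        q * (∑[ v ∈ points ] ⟦ candidate? v ⟧) ≤ 2 * ∣ W ⊥∣
      q*candidates≤ u perp roots = begin
        q * (∑[ v ∈ points ] ⟦ candidate? v ⟧)                                ≡⟨ ∑-average u (λ v → ⟦ candidate? v ⟧) ⟩
        ∑[ v ∈ points ] ∑[ t ∈ elements ] ⟦ candidate? (v ⊞ t ⊛ u) ⟧          ≤⟨ ∑-mono points (λ v → line v (agree? v)) ⟩
        ∑[ v ∈ points ] (2 * ⟦ agree? v ⟧)                                    ≡⟨ ∑-*ˡ points 2 _ ⟩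
        2 * (∑[ v ∈ points ] ⟦ agree? v ⟧)                                    ≤⟨ *-monoʳ-≤ 2 ∣Agree∣≤∣⊥∣ ⟩
        2 * ∣ W ⊥∣                                                            ∎
        where
        open ≤-Reasoning
        line : ∀ v (agree : Dec (Agree v)) → ∑[ t ∈ elements ] ⟦ candidate? (v ⊞ t ⊛ u) ⟧ ≤ 2 * ⟦ agree ⟧
        line v (yes agree) = ≤-trans
          (∑-mono elements λ t → ⟦⟧-mono (candidate? (v ⊞ t ⊛ u)) (‖ v ⊞ t ⊛ u ‖ ≟ᶠ ‖ w ‖) proj₂) (roots v agree)
        line v (no ¬agree) = ≤-reflexive (∑-no (λ t → candidate? (v ⊞ t ⊛ u)) elements
          λ t _ cand → ¬agree (agree-unshift u perp t v (proj₁ cand)))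

      -- If W⊥ has only isotropic vectors, polarization makes all scalar products inside W⊥ vanish.
      -- As v - w lies in W⊥, it follows that v·u = w·u ≠ 0, so the norm along the line has degree
      -- exactly 1 in t.
      isotropic-roots : ∀ u → Perp W u → w ⊙ u ≢ 0# → (∀ u → Perp W u → ‖ u ‖ ≡ 0#) →
        ∀ v → Agree v → ∑[ t ∈ elements ] ⟦ ‖ v ⊞ t ⊛ u ‖ ≟ᶠ ‖ w ‖ ⟧ ≤ 2
      isotropic-roots u perp wu≢0 isotropic v agree = ≤-trans
        (≤-reflexive (∑-cong elements λ t → cong (λ a → ⟦ a ≟ᶠ ‖ w ‖ ⟧) (‖‖-shift u t v)))
        (quadratic-roots (‖ u ‖) (v ⊙ u +ᶠ v ⊙ u) (‖ v ‖) (‖ w ‖)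
          (inj₂ λ e → wu≢0 (trans (sym vu≡wu) (x+x≡0⇒x≡0 e))))
        where
        perp-difference : Perp W (v ⊟ w)
        perp-difference = All.map (λ {w′} e → trans (⊙-⊟ˡ v w w′) (difference≡0 e)) agree
        perp-⊞ : Perp W (v ⊟ w ⊞ u)
        perp-⊞ = All.zipWith (λ {w′} (e , e′) → trans (⊙-⊞ˡ (v ⊟ w) u w′)
          (trans (cong₂ _+ᶠ_ e e′) (R.+-identityˡ 0#))) (perp-difference , perp)
        orthogonal : (v ⊟ w) ⊙ u ≡ 0#
        orthogonal = x+x≡0⇒x≡0 (+-cancelˡᶠ (0# +ᶠ 0#) (begin
          (0# +ᶠ 0#) +ᶠ ((v ⊟ w) ⊙ u +ᶠ (v ⊟ w) ⊙ u)
            ≡⟨ cong₂ (λ a b → (a +ᶠ b) +ᶠ ((v ⊟ w) ⊙ u +ᶠ (v ⊟ w) ⊙ u)) (isotropic (v ⊟ w) perp-difference) (isotropic u perp) ⟨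
          (‖ v ⊟ w ‖ +ᶠ ‖ u ‖) +ᶠ ((v ⊟ w) ⊙ u +ᶠ (v ⊟ w) ⊙ u)
            ≡⟨ ‖‖-⊞ (v ⊟ w) u ⟨
          ‖ v ⊟ w ⊞ u ‖
            ≡⟨ isotropic (v ⊟ w ⊞ u) perp-⊞ ⟩
          0#
            ≡⟨ solve 0 (con 0 := (con 0 :+ con 0) :+ con 0) refl ⟩
          (0# +ᶠ 0#) +ᶠ 0# ∎))
          where open ≡-Reasoning
        vu≡wu : v ⊙ u ≡ w ⊙ u
        vu≡wu = x-y≡0⇒x≡y (trans (sym (⊙-⊟ˡ v w u)) orthogonal)

      -- Orbit counting: the stabilizer of `W` is split by the image of `w`, always a candidate, and
      -- composing with the inverse of one member embeds each nonempty fibre into the stabilizer of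
      -- `w ∷ W`.
      ∣Stab∣≤candidates*∣Stab∣ : ∣Stab W ∣ ≤ (∑[ v ∈ points ] ⟦ candidate? v ⟧) * ∣Stab w ∷ W ∣
      ∣Stab∣≤candidates*∣Stab∣ = begin
        ∣Stab W ∣
          ≡⟨ ∑-fibres _≟ᴾ_ points-unique O (_· w) (λ θ _ → points-complete (θ · w)) (λ θ _ → ⟦ fixes? W θ ⟧) ⟩
        ∑[ v ∈ points ] ∑[ θ ∈ O ] (⟦ θ · w ≟ᴾ v ⟧ * ⟦ fixes? W θ ⟧)
          ≤⟨ ∑-mono points fibre ⟩
        ∑[ v ∈ points ] (⟦ candidate? v ⟧ * ∣Stab w ∷ W ∣)
          ≡⟨ ∑-*ʳ points _ ∣Stab w ∷ W ∣ ⟩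
        (∑[ v ∈ points ] ⟦ candidate? v ⟧) * ∣Stab w ∷ W ∣ ∎
        where
        open ≤-Reasoning
        hit? : ∀ v θ → Dec (θ · w ≡ v × Fixes W θ)
        hit? v θ = (θ · w ≟ᴾ v) ×-dec fixes? W θ
        hits : ∀ v → ∑[ θ ∈ O ] (⟦ θ · w ≟ᴾ v ⟧ * ⟦ fixes? W θ ⟧) ≡ ∑[ θ ∈ O ] ⟦ hit? v θ ⟧
        hits v = ∑-cong O λ θ → sym (⟦⟧-×-dec (θ · w ≟ᴾ v) (fixes? W θ))
        fibre : ∀ v → ∑[ θ ∈ O ] (⟦ θ · w ≟ᴾ v ⟧ * ⟦ fixes? W θ ⟧) ≤ ⟦ candidate? v ⟧ * ∣Stab w ∷ W ∣
        fibre v rewrite hits v with any? (hit? v) O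
        ... | no ¬hit = ≤-trans (≤-reflexive (∑-no (hit? v) O λ θ θ∈ hit → ¬hit (lose θ∈ hit))) z≤n
        ... | yes hit with θ , θ∈ , refl , fix ← find hit = begin
          ∑[ φ ∈ O ] ⟦ hit? (θ · w) φ ⟧
            ≤⟨ ∑-mono O (λ φ → ⟦⟧-mono (hit? (θ · w) φ) (fixes? (w ∷ W) (θ ⁻¹ ⨾ φ)) (carry φ)) ⟩
          ∑[ φ ∈ O ] ⟦ fixes? (w ∷ W) (θ ⁻¹ ⨾ φ) ⟧
            ≤⟨ ∑-⨾-≤ {θ ⁻¹} (⁻¹-orthogonal {θ} orth) (λ φ → ⟦ fixes? (w ∷ W) φ ⟧) ⟩
          ∣Stab w ∷ W ∣
            ≡⟨ trans (cong (_* ∣Stab w ∷ W ∣) (⟦⟧-yes (candidate? (θ · w)) candidate)) (*-identityˡ _) ⟨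
          ⟦ candidate? (θ · w) ⟧ * ∣Stab w ∷ W ∣ ∎
          where
          orth : Orthogonal θ
          orth = ∈O⇒orthogonal {θ} θ∈
          back : ∀ {φ x} → φ · x ≡ θ · x → (θ ⁻¹ ⨾ φ) · x ≡ x
          back {φ} {x} e = trans (⨾-· (θ ⁻¹) φ x) (trans (cong (θ ⁻¹ ·_) e) (⁻¹-inverseˡ {θ} orth x))
          carry : ∀ φ → φ · w ≡ θ · w × Fixes W φ → Fixes (w ∷ W) (θ ⁻¹ ⨾ φ)
          carry φ (e , fixφ) = back {φ} e ∷ All.zipWith (λ (f , g) → back {φ} (trans g (sym f))) (fix , fixφ)
          candidate : Agree (θ · w) × ‖ θ · w ‖ ≡ ‖ w ‖
          candidate = All.map (λ {w′} f → trans (cong ((θ · w) ⊙_) (sym f)) (orthogonal-⊙ {θ} orth w w′)) fix , orth w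

      -- An anisotropic vector of W⊥, if there is one, serves as the direction of the lines, even if
      -- it is perpendicular to `w`; otherwise the given `u` does.
      ∣Stab∣-extend : ∀ u → Perp W u → u ⊙ w ≢ 0# → q * ∣Stab W ∣ ≤ 2 * ∣ W ⊥∣ * ∣Stab w ∷ W ∣
      ∣Stab∣-extend u perp uw≢0 = begin
        q * ∣Stab W ∣                                                  ≤⟨ *-monoʳ-≤ q ∣Stab∣≤candidates*∣Stab∣ ⟩
        q * ((∑[ v ∈ points ] ⟦ candidate? v ⟧) * ∣Stab w ∷ W ∣)       ≡⟨ *-assoc q _ _ ⟨
        q * (∑[ v ∈ points ] ⟦ candidate? v ⟧) * ∣Stab w ∷ W ∣         ≤⟨ *-monoˡ-≤ ∣Stab w ∷ W ∣ candidates ⟩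
        2 * ∣ W ⊥∣ * ∣Stab w ∷ W ∣                                     ∎
        where
        open ≤-Reasoning
        candidates : q * (∑[ v ∈ points ] ⟦ candidate? v ⟧) ≤ 2 * ∣ W ⊥∣
        candidates with any? (λ u → perp? W u ×-dec ¬? (‖ u ‖ ≟ᶠ 0#)) points
        ... | yes found with u′ , perp′ , ‖u′‖≢0 ← satisfied found =
          q*candidates≤ u′ perp′ λ v _ → sphere-line ‖u′‖≢0 v (‖ w ‖)
        ... | no ¬found = q*candidates≤ u perp
          (isotropic-roots u perp (λ e → uw≢0 (trans (⊙-comm u w) e)) isotropic)
          where
          isotropic : ∀ u → Perp W u → ‖ u ‖ ≡ 0#
          isotropic u perp with ‖ u ‖ ≟ᶠ 0#
          ... | yes e = e
          ... | no ne = ⊥-elim (¬found (lose (points-complete u) (perp , ne)))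

      -- W⊥ is a union of lines parallel to `u`, and each of them meets the hyperplane perpendicular
      -- to `w` once.
      ∣⊥∣-extend : ∀ u → Perp W u → u ⊙ w ≢ 0# → q * ∣ w ∷ W ⊥∣ ≤ ∣ W ⊥∣
      ∣⊥∣-extend u perp uw≢0 = begin
        q * ∣ w ∷ W ⊥∣                                                        ≡⟨ ∑-average u _ ⟩
        ∑[ v ∈ points ] ∑[ t ∈ elements ] ⟦ perp? (w ∷ W) (v ⊞ t ⊛ u) ⟧       ≤⟨ ∑-mono points (λ v → line v (perp? W v)) ⟩
        ∣ W ⊥∣                                                                ∎
        where
        open ≤-Reasoning
        unshift : ∀ {v t w′} → u ⊙ w′ ≡ 0# × (v ⊞ t ⊛ u) ⊙ w′ ≡ 0# → v ⊙ w′ ≡ 0#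
        unshift {v} {t} {w′} (e , e′) = trans (sym (trans (⊙-shift u w′ t v)
          (trans (cong (λ a → v ⊙ w′ +ᶠ t *ᶠ a) e) (trans (cong (v ⊙ w′ +ᶠ_) (R.zeroʳ t)) (R.+-identityʳ _))))) e′
        line : ∀ v (p : Dec (Perp W v)) → ∑[ t ∈ elements ] ⟦ perp? (w ∷ W) (v ⊞ t ⊛ u) ⟧ ≤ ⟦ p ⟧
        line v (no ¬p) = ≤-reflexive (∑-no (λ t → perp? (w ∷ W) (v ⊞ t ⊛ u)) elements
          λ { t _ (_ ∷ p) → ¬p (All.zipWith (unshift {v} {t}) (perp , p)) })
        line v (yes _) = begin
          ∑[ t ∈ elements ] ⟦ perp? (w ∷ W) (v ⊞ t ⊛ u) ⟧
            ≤⟨ ∑-mono elements (λ t → ⟦⟧-mono (perp? (w ∷ W) (v ⊞ t ⊛ u)) (v ⊙ w +ᶠ t *ᶠ u ⊙ w ≟ᶠ 0#)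
                 λ { (e ∷ _) → trans (sym (⊙-shift u w t v)) e }) ⟩
          ∑[ t ∈ elements ] ⟦ v ⊙ w +ᶠ t *ᶠ u ⊙ w ≟ᶠ 0# ⟧
            ≡⟨ linear-root (v ⊙ w) 0# uw≢0 ⟩
          1 ∎

    -- The factors q ^ ladder 0 k and (2 * Q) ^ k bound the index of the stabilizer of k vectors
    -- by 2ᵏ q^((d-1) + (d-2) + ⋯ + (d-k)).
    stabilizer-chain : .{{_ : NonZero q}} → ∀ ws W j → q ^ j * ∣ W ⊥∣ ≤ Q → j + length ws ≤ d →
      q ^ ladder j (length ws) * ∣Stab W ∣ ≤ (2 * Q) ^ length ws * ∣Stab ws ʳ++ W ∣
    stabilizer-chain []       W j small room = ≤-refl
    stabilizer-chain (w ∷ ws) W j small room with any? (λ u → perp? W u ×-dec ¬? (u ⊙ w ≟ᶠ 0#)) points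
    ... | yes found with u , perp , uw≢0 ← satisfied found = begin
      q ^ (suc j + l) * ∣Stab W ∣                    ≡⟨ cong (_* ∣Stab W ∣) (^-distribˡ-+-* q (suc j) l) ⟩
      q * q ^ j * q ^ l * ∣Stab W ∣                  ≡⟨ rearrange q (q ^ j) (q ^ l) ∣Stab W ∣ ⟩
      q ^ l * q ^ j * (q * ∣Stab W ∣)                ≤⟨ *-monoʳ-≤ (q ^ l * q ^ j) (∣Stab∣-extend u perp uw≢0) ⟩
      q ^ l * q ^ j * (2 * ∣ W ⊥∣ * ∣Stab w ∷ W ∣)   ≡⟨ rearrange′ (q ^ l) (q ^ j) (∣ W ⊥∣) ∣Stab w ∷ W ∣ ⟩
      2 * (q ^ j * ∣ W ⊥∣) * (q ^ l * ∣Stab w ∷ W ∣) ≤⟨ *-mono-≤ (*-monoʳ-≤ 2 small) (stabilizer-chain ws (w ∷ W) (suc j) small′ room′) ⟩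
      2 * Q * ((2 * Q) ^ length ws * S)              ≡⟨ *-assoc (2 * Q) _ S ⟨
      (2 * Q) ^ length (w ∷ ws) * S                  ∎
      where
      open ≤-Reasoning
      open Extend W w
      l = ladder (suc j) (length ws)
      S = ∣Stab ws ʳ++ (w ∷ W) ∣
      rearrange : ∀ a b c s → a * b * c * s ≡ c * b * (a * s)
      rearrange = solve-∀
      rearrange′ : ∀ c b p s → c * b * (2 * p * s) ≡ 2 * (b * p) * (c * s)
      rearrange′ = solve-∀
      room′ : suc j + length ws ≤ d
      room′ = ≤-trans (≤-reflexive (sym (+-suc j (length ws)))) room
      small′ : q ^ suc j * ∣ w ∷ W ⊥∣ ≤ Q
      small′ = begin
        q * q ^ j * ∣ w ∷ W ⊥∣     ≡⟨ trans (cong (_* ∣ w ∷ W ⊥∣) (*-comm q (q ^ j))) (*-assoc (q ^ j) q _) ⟩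
        q ^ j * (q * ∣ w ∷ W ⊥∣)   ≤⟨ *-monoʳ-≤ (q ^ j) (∣⊥∣-extend u perp uw≢0) ⟩
        q ^ j * ∣ W ⊥∣             ≤⟨ small ⟩
        Q                          ∎
    -- The whole stabilizer of `W` fixes `w`. The largest remaining exponent is at most d by `room`,
    -- so its power of q is covered by the factor `2 * Q` granted to this vector.
    ... | no ¬found = begin
      q ^ ladder j (suc (length ws)) * ∣Stab W ∣
        ≡⟨ cong (λ e → q ^ e * ∣Stab W ∣) (ladder-last j (length ws)) ⟩
      q ^ (l + (j + suc (length ws))) * ∣Stab W ∣
        ≡⟨ cong (_* ∣Stab W ∣) (^-distribˡ-+-* q l _) ⟩
      q ^ l * q ^ (j + suc (length ws)) * ∣Stab W ∣
        ≤⟨ *-mono-≤ (*-monoʳ-≤ (q ^ l) (≤-trans (^-monoʳ-≤ q room) (m≤n*m Q 2))) grow ⟩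
      q ^ l * (2 * Q) * ∣Stab w ∷ W ∣
        ≡⟨ rearrange (q ^ l) (2 * Q) ∣Stab w ∷ W ∣ ⟩
      2 * Q * (q ^ l * ∣Stab w ∷ W ∣)
        ≤⟨ *-monoʳ-≤ (2 * Q) (stabilizer-chain ws (w ∷ W) j small′ (≤-trans (+-monoʳ-≤ j (n≤1+n _)) room)) ⟩
      2 * Q * ((2 * Q) ^ length ws * S)
        ≡⟨ *-assoc (2 * Q) _ S ⟨
      (2 * Q) ^ length (w ∷ ws) * S ∎
      where
      open ≤-Reasoning
      l = ladder j (length ws)
      S = ∣Stab ws ʳ++ (w ∷ W) ∣
      rearrange : ∀ a b c → a * b * c ≡ b * (a * c)
      rearrange = solve-∀
      dependent : ∀ u → Perp W u → u ⊙ w ≡ 0#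
      dependent u perp with u ⊙ w ≟ᶠ 0#
      ... | yes e = e
      ... | no ne = ⊥-elim (¬found (lose (points-complete u) (perp , ne)))
      grow : ∣Stab W ∣ ≤ ∣Stab w ∷ W ∣
      grow = ∑-mono O λ θ → ⟦⟧-mono (fixes? W θ) (fixes? (w ∷ W) θ) λ fix → fixes-dependent dependent fix ∷ fix
      small′ : q ^ j * ∣ w ∷ W ⊥∣ ≤ Q
      small′ = ≤-trans (*-monoʳ-≤ (q ^ j) (∑-mono points λ u → ⟦⟧-mono (perp? (w ∷ W) u) (perp? W u) All.tail)) small

  -- Congruent pairs of simplices and the moment

  ∏ : (A → B → ℕ) → Vec A n → Vec B n → ℕ
  ∏ κ []       []       = 1
  ∏ κ (x ∷ xs) (y ∷ ys) = κ x y * ∏ κ xs ys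

  -- The positions of a tuple are chosen independently. This turns the number of pairs of simplices
  -- carried by a given rigid motion into a power of the number of pairs of points it carries.
  ∑-∏ : (κ : A → B → ℕ) (as : List A) (bs : List B) (n : ℕ) →
        ∑[ x ∈ vectors as n ] ∑[ y ∈ vectors bs n ] ∏ κ x y ≡ (∑[ a ∈ as ] ∑[ b ∈ bs ] κ a b) ^ n
  ∑-∏ κ as bs zero    = refl
  ∑-∏ κ as bs (suc n) = begin
    ∑[ x ∈ vectors as (suc n) ] ∑[ y ∈ vectors bs (suc n) ] ∏ κ x y
      ≡⟨ trans (∑-vectors as n _) (∑-cong as λ a → ∑-cong (vectors as n) λ x → ∑-vectors bs n _) ⟩
    ∑[ a ∈ as ] ∑[ x ∈ vectors as n ] ∑[ b ∈ bs ] ∑[ y ∈ vectors bs n ] (κ a b * ∏ κ x y)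
      ≡⟨ ∑-cong as (λ a → ∑-swap (vectors as n) bs _) ⟩
    ∑[ a ∈ as ] ∑[ b ∈ bs ] ∑[ x ∈ vectors as n ] ∑[ y ∈ vectors bs n ] (κ a b * ∏ κ x y)
      ≡⟨ ∑-cong as (λ a → ∑-cong bs λ b → trans (∑-cong (vectors as n) λ x → ∑-*ˡ (vectors bs n) (κ a b) _)
           (trans (∑-*ˡ (vectors as n) (κ a b) _) (cong (κ a b *_) (∑-∏ κ as bs n)))) ⟩
    ∑[ a ∈ as ] ∑[ b ∈ bs ] (κ a b * P)
      ≡⟨ trans (∑-cong as λ a → ∑-*ʳ bs _ P) (∑-*ʳ as _ P) ⟩
    (∑[ a ∈ as ] ∑[ b ∈ bs ] κ a b) * P ∎
    where
    open ≡-Reasoning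
    P = (∑[ a ∈ as ] ∑[ b ∈ bs ] κ a b) ^ n

  module Congruence {q : ℕ} (F : FiniteField q) (odd : ¬ 2 ∣ q) (d : ℕ) where

    open Stabilizers F odd d public

    ⊞-comm : (x y : Point) → x ⊞ y ≡ y ⊞ x
    ⊞-comm = Vec.zipWith-comm R.+-comm

    ⊞-assoc : (x y z : Point) → (x ⊞ y) ⊞ z ≡ x ⊞ (y ⊞ z)
    ⊞-assoc = Vec.zipWith-assoc R.+-assoc

    ≅-refl : ∀ {k} {x : Simplex k} → x ≅ x
    ≅-refl {x = x} = 𝟏 , 𝟏-orthogonal , 𝟎 , λ i →
      trans (Vec.zipWith-identityˡ R.+-identityˡ _) (𝟏-· (lookup x i))

    ≅-sym : ∀ {k} {x y : Simplex k} → x ≅ y → y ≅ x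
    ≅-sym {x = x} {y} (θ , orth , z , e) =
      θ ⁻¹ , ⁻¹-orthogonal {θ} orth , -1ᶠ ⊛ θ ⁻¹ · z , λ i → begin
        (-1ᶠ ⊛ θ ⁻¹ · z) ⊞ θ ⁻¹ · lookup y i   ≡⟨ ⊞-comm _ _ ⟩
        θ ⁻¹ · lookup y i ⊟ θ ⁻¹ · z           ≡⟨ ·-⊟ (θ ⁻¹) (lookup y i) z ⟨
        θ ⁻¹ · (lookup y i ⊟ z)                ≡⟨ cong (λ v → θ ⁻¹ · (v ⊟ z)) (trans (sym (e i)) (⊞-comm z _)) ⟩
        θ ⁻¹ · (θ · lookup x i ⊞ z ⊟ z)        ≡⟨ cong (θ ⁻¹ ·_) (⊞-⊟-cancel (θ · lookup x i) z) ⟩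
        θ ⁻¹ · (θ · lookup x i)                ≡⟨ ⁻¹-inverseˡ {θ} orth (lookup x i) ⟩
        lookup x i                             ∎
      where open ≡-Reasoning

    ≅-trans : ∀ {k} {x y w : Simplex k} → x ≅ y → y ≅ w → x ≅ w
    ≅-trans {x = x} {y} {w} (θ , orth , z , e) (φ , orth′ , z′ , e′) =
      φ ⨾ θ , ⨾-orthogonal {φ} {θ} orth′ orth , z′ ⊞ φ · z , λ i → begin
        (z′ ⊞ φ · z) ⊞ (φ ⨾ θ) · lookup x i     ≡⟨ cong ((z′ ⊞ φ · z) ⊞_) (⨾-· φ θ (lookup x i)) ⟩
        (z′ ⊞ φ · z) ⊞ φ · (θ · lookup x i)     ≡⟨ ⊞-assoc z′ _ _ ⟩
        z′ ⊞ (φ · z ⊞ φ · (θ · lookup x i))     ≡⟨ cong (z′ ⊞_) (·-⊞ φ z _) ⟨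
        z′ ⊞ φ · (z ⊞ θ · lookup x i)           ≡⟨ cong (λ v → z′ ⊞ φ · v) (e i) ⟩
        z′ ⊞ φ · lookup y i                     ≡⟨ e′ i ⟩
        lookup w i                              ∎
      where open ≡-Reasoning

    ≅-isEquivalence : ∀ {k} → IsEquivalence (_≅_ {k})
    ≅-isEquivalence = record
      { refl  = λ {x} → ≅-refl {x = x}
      ; sym   = λ {x} {y} → ≅-sym {x = x} {y}
      ; trans = λ {x} {y} {w} → ≅-trans {x = x} {y} {w}
      }

    -- The indicator that a motion takes one tuple to the other, written as a product so that `∑-∏`
    -- applies.
    carries : LinearMap → Point → Vec Point n → Vec Point n → ℕ
    carries θ z = ∏ λ u v → ⟦ z ⊞ θ · u ≟ᴾ v ⟧

    carries≡1 : ∀ θ z (x y : Vec Point n) → (∀ i → z ⊞ θ · lookup x i ≡ lookup y i) → carries θ z x y ≡ 1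
    carries≡1 θ z []      []      e = refl
    carries≡1 θ z (u ∷ x) (v ∷ y) e =
      cong₂ _*_ (⟦⟧-yes (z ⊞ θ · u ≟ᴾ v) (e zero)) (carries≡1 θ z x y (e ∘ suc))

    -- Used with a and c the images of the base vertex under two linear maps, b and e those of
    -- another vertex: a translation corrected at the base vertex is right at the other one as soon
    -- as the edge images agree.
    ⊟-compensate : ∀ (z a b c e : Point) → b ⊟ a ≡ e ⊟ c → (z ⊞ c ⊟ a) ⊞ b ≡ z ⊞ e
    ⊟-compensate z a b c e same = ⊙-nondegenerate λ u → begin
      u ⊙ ((z ⊞ c ⊟ a) ⊞ b)
        ≡⟨ trans (⊙-⊞ʳ u _ b) (cong (_+ᶠ u ⊙ b) (trans (⊙-⊟ʳ u _ a) (cong (_+ᶠ -1ᶠ *ᶠ u ⊙ a) (⊙-⊞ʳ u z c)))) ⟩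
      ((u ⊙ z +ᶠ u ⊙ c) +ᶠ -1ᶠ *ᶠ u ⊙ a) +ᶠ u ⊙ b
        ≡⟨ solve 5 (λ m z c a b → ((z :+ c) :+ m :* a) :+ b := (z :+ c) :+ (b :+ m :* a)) refl -1ᶠ (u ⊙ z) (u ⊙ c) (u ⊙ a) (u ⊙ b) ⟩
      (u ⊙ z +ᶠ u ⊙ c) +ᶠ (u ⊙ b +ᶠ -1ᶠ *ᶠ u ⊙ a)
        ≡⟨ cong ((u ⊙ z +ᶠ u ⊙ c) +ᶠ_) (trans (sym (⊙-⊟ʳ u b a)) (trans (cong (u ⊙_) same) (⊙-⊟ʳ u e c))) ⟩
      (u ⊙ z +ᶠ u ⊙ c) +ᶠ (u ⊙ e +ᶠ -1ᶠ *ᶠ u ⊙ c)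
        ≡⟨ solve 4 (λ m z c e → (z :+ c) :+ (e :+ m :* c) := (z :+ e) :+ (con 1 :+ m) :* c) refl -1ᶠ (u ⊙ z) (u ⊙ c) (u ⊙ e) ⟩
      (u ⊙ z +ᶠ u ⊙ e) +ᶠ (1# +ᶠ -1ᶠ) *ᶠ u ⊙ c
        ≡⟨ cong (λ o → (u ⊙ z +ᶠ u ⊙ e) +ᶠ o *ᶠ u ⊙ c) 1+-1≡0 ⟩
      (u ⊙ z +ᶠ u ⊙ e) +ᶠ 0# *ᶠ u ⊙ c
        ≡⟨ solve 3 (λ z c e → (z :+ e) :+ con 0 :* c := z :+ e) refl (u ⊙ z) (u ⊙ c) (u ⊙ e) ⟩
      u ⊙ z +ᶠ u ⊙ e
        ≡⟨ ⊙-⊞ʳ u z e ⟨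
      u ⊙ (z ⊞ e) ∎
      where open ≡-Reasoning

    edges : ∀ {k} → Simplex k → List Point
    edges (x ∷ xs) = Vec.toList (Vec.map (_⊟ x) xs)

    length-edges : ∀ {k} (x : Simplex k) → length (edges x) ≡ k
    length-edges (x ∷ xs) = Vec.length-toList (Vec.map (_⊟ x) xs)

    -- If θ is the linear part of one congruence from `x` to `y`, then so is θ φ, with an adjusted
    -- translation, for every φ fixing the edges at the first vertex; and φ ↦ θ φ is injective.
    stabilizer≤carriers : ∀ {k} (x y : Simplex k) → x ≅ y →
      ∣Stab edges x ʳ++ [] ∣ ≤ ∑[ θ ∈ O ] ∑[ z ∈ points ] carries θ z x y
    stabilizer≤carriers {k} (x ∷ xs) (y ∷ ys) (θ , orth , z , e) = begin
      ∣Stab edges (x ∷ xs) ʳ++ [] ∣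
        ≤⟨ ∑-mono O (λ φ → ⟦⟧-≤ (fixes? (edges (x ∷ xs) ʳ++ []) φ) (translated φ)) ⟩
      ∑[ φ ∈ O ] ∑[ z ∈ points ] carries (θ ⨾ φ) z (x ∷ xs) (y ∷ ys)
        ≤⟨ ∑-⨾-≤ {θ} orth (λ φ → ∑[ z ∈ points ] carries φ z (x ∷ xs) (y ∷ ys)) ⟩
      ∑[ φ ∈ O ] ∑[ z ∈ points ] carries φ z (x ∷ xs) (y ∷ ys) ∎
      where
      open ≤-Reasoning
      translated : ∀ φ → Fixes (edges (x ∷ xs) ʳ++ []) φ →
                   1 ≤ ∑[ z ∈ points ] carries (θ ⨾ φ) z (x ∷ xs) (y ∷ ys)
      translated φ fix = ≤-trans (≤-reflexive (sym (carries≡1 (θ ⨾ φ) z′ (x ∷ xs) (y ∷ ys) onto)))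
        (∑-∈-≤ (λ z → carries (θ ⨾ φ) z (x ∷ xs) (y ∷ ys)) (points-complete z′))
        where
        z′ = z ⊞ θ · x ⊟ (θ ⨾ φ) · x
        fixed : ∀ i → φ · (lookup xs i ⊟ x) ≡ lookup xs i ⊟ x
        fixed i = All.lookup fix (Any.reverse⁺
          (VecMembership.∈-toList⁺ (VecMembership.∈-map⁺ (_⊟ x) (VecMembership.∈-lookup i xs))))
        onto : ∀ i → z′ ⊞ (θ ⨾ φ) · lookup (x ∷ xs) i ≡ lookup (y ∷ ys) i
        onto zero    = trans (⊟-⊞-cancel (z ⊞ θ · x) ((θ ⨾ φ) · x)) (e zero)
        onto (suc i) = trans (⊟-compensate z _ _ _ (θ · lookup xs i) (E.begin
          (θ ⨾ φ) · lookup xs i ⊟ (θ ⨾ φ) · x   E.≡⟨ ·-⊟ (θ ⨾ φ) (lookup xs i) x ⟨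
          (θ ⨾ φ) · (lookup xs i ⊟ x)           E.≡⟨ trans (⨾-· θ φ _) (cong (θ ·_) (fixed i)) ⟩
          θ · (lookup xs i ⊟ x)                 E.≡⟨ ·-⊟ θ (lookup xs i) x ⟩
          θ · lookup xs i ⊟ θ · x               E.∎)) (e (suc i))
          where module E = ≡-Reasoning

    module _ .{{_ : NonZero q}} where

      ∣O∣≤carriers : ∀ {k} → k ≤ d → (x y : Simplex k) → x ≅ y →
        q ^ ladder 0 k * length O ≤ (2 * Q) ^ k * (∑[ θ ∈ O ] ∑[ z ∈ points ] carries θ z x y)
      ∣O∣≤carriers {k} k≤d x y x≅y = begin
        q ^ ladder 0 k * length O                              ≡⟨ cong₂ (λ l s → q ^ ladder 0 l * s) (sym (length-edges x)) all-stable ⟩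
        q ^ ladder 0 (length (edges x)) * ∣Stab [] ∣           ≤⟨ stabilizer-chain (edges x) [] 0 small room ⟩
        (2 * Q) ^ length (edges x) * ∣Stab edges x ʳ++ [] ∣    ≤⟨ *-mono-≤ (≤-reflexive (cong ((2 * Q) ^_) (length-edges x))) (stabilizer≤carriers x y x≅y) ⟩
        (2 * Q) ^ k * (∑[ θ ∈ O ] ∑[ z ∈ points ] carries θ z x y) ∎
        where
        open ≤-Reasoning
        all-stable : length O ≡ ∣Stab [] ∣
        all-stable = trans (sym (∑-1 O)) (∑-cong O λ θ → sym (⟦⟧-yes (fixes? [] θ) []))
        small : 1 * ∣ [] ⊥∣ ≤ Q
        small = ≤-trans (≤-reflexive (*-identityˡ _))
          (≤-trans (∑-mono points λ u → ⟦⟧≤1 (perp? [] u)) (≤-reflexive (trans (∑-1 points) length-points)))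
        room : length (edges x) ≤ d
        room = ≤-trans (≤-reflexive (length-edges x)) k≤d

      moment : List Point → ℕ → ℕ
      moment E n = ∑[ θ ∈ O ] ∑[ z ∈ points ] ((∑[ u ∈ E ] ∑[ v ∈ E ] ⟦ z ⊞ θ · u ≟ᴾ v ⟧) ^ n)

      -- Every congruent pair is carried by at least |O| q^(1+⋯+k) / (2Q)^k motions. Summing over
      -- all pairs of simplices with the motion outermost turns the number of carriers into the
      -- moment.
      classes-moment : (E : List Point) {k : ℕ} → k ≤ d →
        q ^ ladder 0 k * length O * (length E ^ suc k * length E ^ suc k) ≤
        length (List.deduplicate (_≅?_ {k}) (vectors E (suc k))) * ((2 * Q) ^ k * moment E (suc k))
      classes-moment E {k} k≤d = begin
        c * (length E ^ suc k * length E ^ suc k)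
          ≡⟨ cong (λ l → c * (l * l)) (length-vectors E (suc k)) ⟨
        c * (length X * length X)
          ≤⟨ *-monoʳ-≤ c (length²≤classes*pairs ≅-isEquivalence _≅?_ X) ⟩
        c * (N * (∑[ x ∈ X ] ∑[ y ∈ X ] ⟦ x ≅? y ⟧))
          ≡⟨ rearrange c N _ ⟩
        N * (c * (∑[ x ∈ X ] ∑[ y ∈ X ] ⟦ x ≅? y ⟧))
          ≡⟨ cong (N *_) (trans (sym (∑-*ˡ X c _)) (∑-cong X λ x → sym (∑-*ˡ X c _))) ⟩
        N * (∑[ x ∈ X ] ∑[ y ∈ X ] (c * ⟦ x ≅? y ⟧))
          ≤⟨ *-monoʳ-≤ N (∑-mono X λ x → ∑-mono X λ y → pair x y (x ≅? y)) ⟩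
        N * (∑[ x ∈ X ] ∑[ y ∈ X ] (D * (∑[ θ ∈ O ] ∑[ z ∈ points ] carries θ z x y)))
          ≡⟨ cong (N *_) (trans (∑-cong X λ x → ∑-*ˡ X D _) (∑-*ˡ X D _)) ⟩
        N * (D * (∑[ x ∈ X ] ∑[ y ∈ X ] ∑[ θ ∈ O ] ∑[ z ∈ points ] carries θ z x y))
          ≡⟨ cong (λ s → N * (D * s)) reorder ⟩
        N * (D * moment E (suc k)) ∎
        where
        open ≤-Reasoning
        X = vectors E (suc k)
        N = length (List.deduplicate (_≅?_ {k}) X)
        c = q ^ ladder 0 k * length O
        D = (2 * Q) ^ k
        rearrange : ∀ a b c → a * (b * c) ≡ b * (a * c)
        rearrange = solve-∀
        pair : ∀ x y (p : Dec (x ≅ y)) → c * ⟦ p ⟧ ≤ D * (∑[ θ ∈ O ] ∑[ z ∈ points ] carries θ z x y)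
        pair x y (yes p) = ≤-trans (≤-reflexive (*-identityʳ c)) (∣O∣≤carriers k≤d x y p)
        pair x y (no _)  = ≤-trans (≤-reflexive (*-zeroʳ c)) z≤n
        reorder : ∑[ x ∈ X ] ∑[ y ∈ X ] ∑[ θ ∈ O ] ∑[ z ∈ points ] carries θ z x y ≡ moment E (suc k)
        reorder = begin-equality
          ∑[ x ∈ X ] ∑[ y ∈ X ] ∑[ θ ∈ O ] ∑[ z ∈ points ] carries θ z x y
            ≡⟨ trans (∑-cong X λ x → ∑-swap X O _) (∑-swap X O _) ⟩
          ∑[ θ ∈ O ] ∑[ x ∈ X ] ∑[ y ∈ X ] ∑[ z ∈ points ] carries θ z x y
            ≡⟨ ∑-cong O (λ θ → trans (∑-cong X λ x → ∑-swap X points _) (∑-swap X points _)) ⟩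
          ∑[ θ ∈ O ] ∑[ z ∈ points ] ∑[ x ∈ X ] ∑[ y ∈ X ] carries θ z x y
            ≡⟨ ∑-cong O (λ θ → ∑-cong points λ z → ∑-∏ (λ u v → ⟦ z ⊞ θ · u ≟ᴾ v ⟧) E E (suc k)) ⟩
          moment E (suc k) ∎

  -- Reflections and lower bounds for orbits

  module Reflections {q : ℕ} (F : FiniteField q) (odd : ¬ 2 ∣ q) (d : ℕ) where

    open Congruence F odd d public

    module _ (n : Point) (‖n‖≢0 : ‖ n ‖ ≢ 0#) where

      -- This is -2 / ‖n‖, the factor in the usual formula x - 2 (n·x / ‖n‖) n for a reflection.
      coefficient : 𝔽
      coefficient = -1ᶠ *ᶠ ((1# +ᶠ 1#) *ᶠ proj₁ (inverse (‖ n ‖) ‖n‖≢0))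

      coefficient*‖n‖ : coefficient *ᶠ ‖ n ‖ ≡ -1ᶠ *ᶠ (1# +ᶠ 1#)
      coefficient*‖n‖ = trans
        (solve 4 (λ m t i a → m :* (t :* i) :* a := m :* t :* (a :* i)) refl -1ᶠ (1# +ᶠ 1#) _ (‖ n ‖))
        (trans (cong (-1ᶠ *ᶠ (1# +ᶠ 1#) *ᶠ_) (proj₂ (inverse (‖ n ‖) ‖n‖≢0))) (R.*-identityʳ _))

      coefficient≢0 : coefficient ≢ 0#
      coefficient≢0 e = two≢0 (begin
        1# +ᶠ 1#                                            ≡⟨ R.+-identityʳ _ ⟨
        1# +ᶠ 1# +ᶠ 0#                                      ≡⟨ cong (1# +ᶠ 1# +ᶠ_) (R.zeroˡ (‖ n ‖)) ⟨
        1# +ᶠ 1# +ᶠ 0# *ᶠ ‖ n ‖                             ≡⟨ cong (λ c → 1# +ᶠ 1# +ᶠ c *ᶠ ‖ n ‖) e ⟨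
        1# +ᶠ 1# +ᶠ coefficient *ᶠ ‖ n ‖                    ≡⟨ cong (1# +ᶠ 1# +ᶠ_) coefficient*‖n‖ ⟩
        1# +ᶠ 1# +ᶠ -1ᶠ *ᶠ (1# +ᶠ 1#)                       ≡⟨ solve 1 (λ m → con 1 :+ con 1 :+ m :* (con 1 :+ con 1) := (con 1 :+ m) :* (con 1 :+ con 1)) refl -1ᶠ ⟩
        (1# +ᶠ -1ᶠ) *ᶠ (1# +ᶠ 1#)                           ≡⟨ trans (cong (_*ᶠ (1# +ᶠ 1#)) 1+-1≡0) (R.zeroˡ _) ⟩
        0#                                                  ∎)
        where open ≡-Reasoning

      reflect : Point → Point
      reflect x = x ⊞ (coefficient *ᶠ n ⊙ x) ⊛ n

      reflect-adjoint : ∀ y x → y ⊙ reflect x ≡ reflect y ⊙ x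
      reflect-adjoint y x = begin
        y ⊙ reflect x
          ≡⟨ trans (⊙-⊞ʳ y x _) (cong (y ⊙ x +ᶠ_) (⊙-⊛ʳ y _ n)) ⟩
        y ⊙ x +ᶠ coefficient *ᶠ n ⊙ x *ᶠ y ⊙ n
          ≡⟨ cong (λ b → y ⊙ x +ᶠ coefficient *ᶠ n ⊙ x *ᶠ b) (⊙-comm y n) ⟩
        y ⊙ x +ᶠ coefficient *ᶠ n ⊙ x *ᶠ n ⊙ y
          ≡⟨ solve 4 (λ s c a b → s :+ c :* a :* b := s :+ c :* b :* a) refl (y ⊙ x) coefficient (n ⊙ x) (n ⊙ y) ⟩
        y ⊙ x +ᶠ coefficient *ᶠ n ⊙ y *ᶠ n ⊙ x
          ≡⟨ ⊙-shift n x _ y ⟨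
        reflect y ⊙ x ∎
        where open ≡-Reasoning

      ‖reflect‖ : ∀ x → ‖ reflect x ‖ ≡ ‖ x ‖
      ‖reflect‖ x = begin
        ‖ reflect x ‖
          ≡⟨ trans (‖‖-shift n _ x) (cong (λ b → ‖ x ‖ +ᶠ c *ᶠ a *ᶠ (b +ᶠ b) +ᶠ c *ᶠ a *ᶠ (c *ᶠ a) *ᶠ ‖ n ‖) (⊙-comm x n)) ⟩
        ‖ x ‖ +ᶠ c *ᶠ a *ᶠ (a +ᶠ a) +ᶠ c *ᶠ a *ᶠ (c *ᶠ a) *ᶠ ‖ n ‖
          ≡⟨ solve 4 (λ x c a l → x :+ c :* a :* (a :+ a) :+ c :* a :* (c :* a) :* l := x :+ c :* a :* (a :+ a) :+ c :* a :* a :* (c :* l)) refl (‖ x ‖) c a (‖ n ‖) ⟩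
        ‖ x ‖ +ᶠ c *ᶠ a *ᶠ (a +ᶠ a) +ᶠ c *ᶠ a *ᶠ a *ᶠ (c *ᶠ ‖ n ‖)
          ≡⟨ cong (λ b → ‖ x ‖ +ᶠ c *ᶠ a *ᶠ (a +ᶠ a) +ᶠ c *ᶠ a *ᶠ a *ᶠ b) coefficient*‖n‖ ⟩
        ‖ x ‖ +ᶠ c *ᶠ a *ᶠ (a +ᶠ a) +ᶠ c *ᶠ a *ᶠ a *ᶠ (-1ᶠ *ᶠ (1# +ᶠ 1#))
          ≡⟨ solve 4 (λ x c a m → x :+ c :* a :* (a :+ a) :+ c :* a :* a :* (m :* (con 1 :+ con 1)) := x :+ (con 1 :+ m) :* (c :* a :* (a :+ a))) refl (‖ x ‖) c a -1ᶠ ⟩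
        ‖ x ‖ +ᶠ (1# +ᶠ -1ᶠ) *ᶠ (c *ᶠ a *ᶠ (a +ᶠ a))
          ≡⟨ cong (‖ x ‖ +ᶠ_) (trans (cong (_*ᶠ (c *ᶠ a *ᶠ (a +ᶠ a))) 1+-1≡0) (R.zeroˡ _)) ⟩
        ‖ x ‖ +ᶠ 0#
          ≡⟨ R.+-identityʳ _ ⟩
        ‖ x ‖ ∎
        where
        open ≡-Reasoning
        c = coefficient
        a = n ⊙ x

      reflection : LinearMap
      reflection = fromAdjoint reflect

      reflection-· : ∀ x → reflection · x ≡ reflect x
      reflection-· = fromAdjoint-· reflect reflect reflect-adjoint

      reflection-orthogonal : Orthogonal reflection
      reflection-orthogonal x = trans (cong ‖_‖ (reflection-· x)) (‖reflect‖ x)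

      normal-from-image : ∀ {x} → n ⊙ x ≢ 0# → ∃[ t ] t ⊛ (reflect x ⊟ x) ≡ n
      normal-from-image {x} nx≢0 = t , ⊙-nondegenerate λ u → begin
        u ⊙ (t ⊛ (reflect x ⊟ x))
          ≡⟨ trans (⊙-⊛ʳ u t _) (cong (t *ᶠ_) (trans (⊙-⊟ʳ u _ x) (cong (_+ᶠ -1ᶠ *ᶠ u ⊙ x) (trans (⊙-⊞ʳ u x _) (cong (u ⊙ x +ᶠ_) (⊙-⊛ʳ u s n)))))) ⟩
        t *ᶠ (u ⊙ x +ᶠ s *ᶠ u ⊙ n +ᶠ -1ᶠ *ᶠ u ⊙ x)
          ≡⟨ solve 5 (λ t s x n m → t :* (x :+ s :* n :+ m :* x) := t :* ((con 1 :+ m) :* x) :+ (s :* t) :* n) refl t s (u ⊙ x) (u ⊙ n) -1ᶠ ⟩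
        t *ᶠ ((1# +ᶠ -1ᶠ) *ᶠ u ⊙ x) +ᶠ (s *ᶠ t) *ᶠ u ⊙ n
          ≡⟨ cong₂ (λ o i → t *ᶠ (o *ᶠ u ⊙ x) +ᶠ i *ᶠ u ⊙ n) 1+-1≡0 (proj₂ (inverse s s≢0)) ⟩
        t *ᶠ (0# *ᶠ u ⊙ x) +ᶠ 1# *ᶠ u ⊙ n
          ≡⟨ solve 3 (λ t x n → t :* (con 0 :* x) :+ con 1 :* n := n) refl t (u ⊙ x) (u ⊙ n) ⟩
        u ⊙ n ∎
        where
        open ≡-Reasoning
        s = coefficient *ᶠ n ⊙ x
        s≢0 : s ≢ 0#
        s≢0 = x*y≢0 coefficient≢0 nx≢0
        t = proj₁ (inverse s s≢0)

    transporters : Point → Point → ℕ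
    transporters η ξ = ∑[ θ ∈ O ] ⟦ θ · η ≟ᴾ ξ ⟧

    -- These are the normals whose reflection exists and moves `ξ`.
    mirror? : (ξ n : Point) → Dec (‖ n ‖ ≢ 0# × n ⊙ ξ ≢ 0#)
    mirror? ξ n = ¬? (‖ n ‖ ≟ᶠ 0#) ×-dec ¬? (n ⊙ ξ ≟ᶠ 0#)

    mirrors : Point → ℕ
    mirrors ξ = ∑[ n ∈ points ] ⟦ mirror? ξ n ⟧

    -- A reflection ρ carries the θ with θ η = ξ into those with θ η = ρ ξ, and an image ρ ξ ≠ ξ determines
    -- its mirror normal up to a scalar; so the orbit of ξ has at least about q^(d-1) points.
    mirrors*transporters≤ : ∀ ξ η → mirrors ξ * transporters η ξ ≤ length O * q
    mirrors*transporters≤ ξ η = begin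
      mirrors ξ * transporters η ξ
        ≡⟨ ∑-*ʳ points _ (transporters η ξ) ⟨
      ∑[ n ∈ points ] (⟦ mirror? ξ n ⟧ * transporters η ξ)
        ≤⟨ ∑-mono points (λ n → ⟦⟧*≤ (mirror? ξ n) λ (‖n‖≢0 , nξ≢0) → reflected n ‖n‖≢0 nξ≢0) ⟩
      ∑[ n ∈ points ] ∑[ θ ∈ O ] ∑[ t ∈ elements ] ⟦ t ⊛ (θ · η ⊟ ξ) ≟ᴾ n ⟧
        ≡⟨ trans (∑-swap points O _) (∑-cong O λ θ → ∑-swap points elements _) ⟩
      ∑[ θ ∈ O ] ∑[ t ∈ elements ] ∑[ n ∈ points ] ⟦ t ⊛ (θ · η ⊟ ξ) ≟ᴾ n ⟧
        ≤⟨ ∑-mono O (λ θ → ∑-mono elements λ t → ∑-unique-≤1 (t ⊛ (θ · η ⊟ ξ) ≟ᴾ_) points-unique λ _ _ p p′ → trans (sym p) p′) ⟩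
      ∑[ θ ∈ O ] ∑[ t ∈ elements ] 1
        ≡⟨ trans (∑-const O _) (cong (length O *_) (trans (∑-1 elements) length-elements)) ⟩
      length O * q ∎
      where
      open ≤-Reasoning
      reflected : ∀ n → ‖ n ‖ ≢ 0# → n ⊙ ξ ≢ 0# →
        transporters η ξ ≤ ∑[ θ ∈ O ] ∑[ t ∈ elements ] ⟦ t ⊛ (θ · η ⊟ ξ) ≟ᴾ n ⟧
      reflected n ‖n‖≢0 nξ≢0 = begin
        ∑[ θ ∈ O ] ⟦ θ · η ≟ᴾ ξ ⟧
          ≤⟨ ∑-mono O (λ θ → ⟦⟧-mono (θ · η ≟ᴾ ξ) ((ρ ⨾ θ) · η ≟ᴾ reflect n ‖n‖≢0 ξ)
               λ e → trans (⨾-· ρ θ η) (trans (cong (ρ ·_) e) (reflection-· n ‖n‖≢0 ξ))) ⟩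
        ∑[ θ ∈ O ] ⟦ (ρ ⨾ θ) · η ≟ᴾ reflect n ‖n‖≢0 ξ ⟧
          ≤⟨ ∑-⨾-≤ {ρ} (reflection-orthogonal n ‖n‖≢0) (λ θ → ⟦ θ · η ≟ᴾ reflect n ‖n‖≢0 ξ ⟧) ⟩
        ∑[ θ ∈ O ] ⟦ θ · η ≟ᴾ reflect n ‖n‖≢0 ξ ⟧
          ≤⟨ ∑-mono O (λ θ → ⟦⟧-≤ (θ · η ≟ᴾ reflect n ‖n‖≢0 ξ) (recover θ)) ⟩
        ∑[ θ ∈ O ] ∑[ t ∈ elements ] ⟦ t ⊛ (θ · η ⊟ ξ) ≟ᴾ n ⟧ ∎
        where
        ρ = reflection n ‖n‖≢0
        recover : ∀ θ → θ · η ≡ reflect n ‖n‖≢0 ξ → 1 ≤ ∑[ t ∈ elements ] ⟦ t ⊛ (θ · η ⊟ ξ) ≟ᴾ n ⟧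
        recover θ e = ≤-trans (≤-reflexive (sym (⟦⟧-yes (t ⊛ (θ · η ⊟ ξ) ≟ᴾ n)
            (trans (cong (λ v → t ⊛ (v ⊟ ξ)) e) (proj₂ normal)))))
          (∑-∈-≤ (λ t → ⟦ t ⊛ (θ · η ⊟ ξ) ≟ᴾ n ⟧) (elements-complete t))
          where
          normal = normal-from-image n ‖n‖≢0 nξ≢0
          t = proj₁ normal

    module _ (i : Fin d) where

      -- Along a line in direction e_i the norm is a quadratic polynomial with leading coefficient
      -- ‖e_i‖ = 1.
      isotropic-count : q * (∑[ n ∈ points ] ⟦ ‖ n ‖ ≟ᶠ 0# ⟧) ≤ 2 * Q
      isotropic-count = begin
        q * (∑[ n ∈ points ] ⟦ ‖ n ‖ ≟ᶠ 0# ⟧)                               ≡⟨ ∑-average (basis i) _ ⟩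
        ∑[ n ∈ points ] ∑[ t ∈ elements ] ⟦ ‖ n ⊞ t ⊛ basis i ‖ ≟ᶠ 0# ⟧     ≤⟨ ∑-mono points (λ n → sphere-line (‖basis‖≢0 i) n 0#) ⟩
        ∑[ n ∈ points ] 2                                                   ≡⟨ trans (∑-const points 2) (trans (cong (_* 2) length-points) (*-comm Q 2)) ⟩
        2 * Q                                                               ∎
        where open ≤-Reasoning

      -- Only the isotropic vectors, of density at most 2/q, and the hyperplane perpendicular to
      -- `ξ`, of density 1/q, are excluded; together they give the 3.
      mirrors-many : ∀ {ξ} → ξ ≢ 𝟎 → q * Q ≤ q * mirrors ξ + 3 * Q
      mirrors-many {ξ} ξ≢𝟎 = begin
        q * Q
          ≡⟨ cong (q *_) (trans (∑-1 points) length-points) ⟨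
        q * (∑[ n ∈ points ] 1)
          ≤⟨ *-monoʳ-≤ q (∑-mono points λ n → classify (‖ n ‖ ≟ᶠ 0#) (n ⊙ ξ ≟ᶠ 0#)) ⟩
        q * (∑[ n ∈ points ] (⟦ mirror? ξ n ⟧ + (⟦ ‖ n ‖ ≟ᶠ 0# ⟧ + ⟦ n ⊙ ξ ≟ᶠ 0# ⟧)))
          ≡⟨ cong (q *_) (trans (∑-+ points _ _) (cong (mirrors ξ +_) (∑-+ points _ _))) ⟩
        q * (mirrors ξ + ((∑[ n ∈ points ] ⟦ ‖ n ‖ ≟ᶠ 0# ⟧) + (∑[ n ∈ points ] ⟦ n ⊙ ξ ≟ᶠ 0# ⟧)))
          ≡⟨ distribute q (mirrors ξ) _ _ ⟩
        q * mirrors ξ + (q * (∑[ n ∈ points ] ⟦ ‖ n ‖ ≟ᶠ 0# ⟧) + q * (∑[ n ∈ points ] ⟦ n ⊙ ξ ≟ᶠ 0# ⟧))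
          ≤⟨ +-monoʳ-≤ (q * mirrors ξ) (+-mono-≤ isotropic-count (≤-reflexive (hyperplane ξ≢𝟎 0#))) ⟩
        q * mirrors ξ + (2 * Q + Q)
          ≡⟨ cong (q * mirrors ξ +_) (+-comm (2 * Q) Q) ⟩
        q * mirrors ξ + 3 * Q ∎
        where
        open ≤-Reasoning
        distribute : ∀ q a b c → q * (a + (b + c)) ≡ q * a + (q * b + q * c)
        distribute = solve-∀
        classify : {P S : Set} (P? : Dec P) (S? : Dec S) → 1 ≤ ⟦ ¬? P? ×-dec ¬? S? ⟧ + (⟦ P? ⟧ + ⟦ S? ⟧)
        classify (yes _) (yes _) = s≤s z≤n
        classify (yes _) (no _)  = s≤s z≤n
        classify (no _)  (yes _) = s≤s z≤n
        classify (no _)  (no _)  = s≤s z≤n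

      -- The count of mirrors leaves the factor q - 3 = 1 + s, which is at least q / 4 once q ≥ 4.
      transporters-bound-large : ∀ s → q ≡ 4 + s → ∀ {ξ} η → ξ ≢ 𝟎 → Q * transporters η ξ ≤ 4 * (q * length O)
      transporters-bound-large s q≡4+s {ξ} η ξ≢𝟎 = *-cancelˡ-≤ (suc s) (+-cancelʳ-≤ (3 * (Q * T)) _ _ (begin
        suc s * (Q * T) + 3 * (Q * T)              ≡⟨ collect s (Q * T) ⟩
        (4 + s) * (Q * T)                          ≡⟨ trans (cong (_* (Q * T)) (sym q≡4+s)) (sym (*-assoc q Q T)) ⟩
        q * Q * T                                  ≤⟨ *-monoˡ-≤ T (mirrors-many ξ≢𝟎) ⟩
        (q * mirrors ξ + 3 * Q) * T                ≡⟨ rearrange q (mirrors ξ) Q T ⟩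
        q * (mirrors ξ * T) + 3 * (Q * T)          ≤⟨ +-monoˡ-≤ (3 * (Q * T)) (*-monoʳ-≤ q (mirrors*transporters≤ ξ η)) ⟩
        q * (length O * q) + 3 * (Q * T)           ≤⟨ +-monoˡ-≤ (3 * (Q * T)) (*-monoˡ-≤ (length O * q) q≤4[1+s]) ⟩
        4 * suc s * (length O * q) + 3 * (Q * T)   ≡⟨ cong (_+ 3 * (Q * T)) (rearrange′ (suc s) (length O) q) ⟩
        suc s * (4 * (q * length O)) + 3 * (Q * T) ∎))
        where
        open ≤-Reasoning
        T = transporters η ξ
        collect : ∀ s x → suc s * x + 3 * x ≡ (4 + s) * x
        collect = solve-∀
        rearrange : ∀ q m p t → (q * m + 3 * p) * t ≡ q * (m * t) + 3 * (p * t)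
        rearrange = solve-∀
        rearrange′ : ∀ a o q → 4 * a * (o * q) ≡ a * (4 * (q * o))
        rearrange′ = solve-∀
        q≤4[1+s] : q ≤ 4 * suc s
        q≤4[1+s] = ≤-trans (≤-reflexive q≡4+s) (≤-trans (m≤m+n (4 + s) (3 * s)) (≤-reflexive (expand s)))
          where
          expand : ∀ s → 4 + s + 3 * s ≡ 4 * suc s
          expand = solve-∀

      transporters-bound : .{{_ : NonZero q}} .{{_ : NonZero d}} → ∀ {ξ} η → ξ ≢ 𝟎 → Q * transporters η ξ ≤ 4 ^ d * (q * length O)
      transporters-bound {ξ} η ξ≢𝟎 with 4 ≤? q
      ... | yes 4≤q with s , e ← m≤n⇒∃[o]m+o≡n 4≤q = ≤-trans (transporters-bound-large s (sym e) η ξ≢𝟎)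
            (*-monoˡ-≤ (q * length O) 4≤4^d)
        where
        4≤4^d : 4 ≤ 4 ^ d
        4≤4^d = ^-monoʳ-≤ 4 {1} {d} (>-nonZero⁻¹ d)
      -- Too few mirrors are guaranteed here. Instead q^d is bounded by 4^d, and the transporters by
      -- all of `O`.
      ... | no q<4 = *-mono-≤ (^-monoˡ-≤ d (<⇒≤ (≰⇒> q<4)))
            (≤-trans (∑-mono O (λ θ → ⟦⟧≤1 (θ · η ≟ᴾ ξ))) (≤-trans (≤-reflexive (∑-1 O)) (m≤n*m (length O) q)))

  -- Collisions and equidistribution of functions with finite range

  module _ (finite : Finite Ω) where

    open Finite finite

    hits : List B → (B → Ω) → Ω → ℕ
    hits S ℓ c = ∑[ x ∈ S ] ⟦ ℓ x ≟ᵘ c ⟧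

    energy : List B → (B → Ω) → ℕ
    energy S ℓ = ∑[ x ∈ S ] ∑[ y ∈ S ] ⟦ ℓ x ≟ᵘ ℓ y ⟧

    ∑-hits : (S : List B) (ℓ : B → Ω) → ∑ universe (hits S ℓ) ≡ length S
    ∑-hits S ℓ = trans (∑-swap universe S λ c x → ⟦ ℓ x ≟ᵘ c ⟧)
      (trans (∑-cong S λ x → ∑-unique-1 (ℓ x ≟ᵘ_) unique (λ _ _ p r → trans (sym p) r) (ℓ x) (complete (ℓ x)) refl)
        (∑-1 S))

    -- A colliding pair is counted once, at its common value: the second moment of the value counts
    -- is the number of collisions.
    ∑-hits² : (S : List B) (ℓ : B → Ω) → ∑[ c ∈ universe ] (hits S ℓ c * hits S ℓ c) ≡ energy S ℓ
    ∑-hits² S ℓ = begin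
      ∑[ c ∈ universe ] (hits S ℓ c * hits S ℓ c)
        ≡⟨ ∑-cong universe (λ c → sym (∑-*-∑ S S _ _)) ⟩
      ∑[ c ∈ universe ] ∑[ x ∈ S ] ∑[ y ∈ S ] (⟦ ℓ x ≟ᵘ c ⟧ * ⟦ ℓ y ≟ᵘ c ⟧)
        ≡⟨ trans (∑-swap universe S _) (∑-cong S λ x → ∑-swap universe S _) ⟩
      ∑[ x ∈ S ] ∑[ y ∈ S ] ∑[ c ∈ universe ] (⟦ ℓ x ≟ᵘ c ⟧ * ⟦ ℓ y ≟ᵘ c ⟧)
        ≡⟨ ∑-cong S (λ x → ∑-cong S λ y → trans (∑-pick _≟ᵘ_ unique (λ c → ⟦ ℓ y ≟ᵘ c ⟧) (complete (ℓ x)))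
             (⟦⟧-cong (ℓ y ≟ᵘ ℓ x) (ℓ x ≟ᵘ ℓ y) sym sym)) ⟩
      energy S ℓ ∎
      where open ≡-Reasoning

  -- The second moment about M / c, with the denominator cleared and the mixed term on the left.
  ∑-deviation² : (xs : List A) (f : A → ℕ) (c M : ℕ) →
    (∑[ x ∈ xs ] (∣ c * f x - M ∣ * ∣ c * f x - M ∣)) + 2 * (c * ∑ xs f * M) ≡
    c * c * (∑[ x ∈ xs ] (f x * f x)) + length xs * (M * M)
  ∑-deviation² xs f c M = begin
    ∑ xs dev² + 2 * (c * ∑ xs f * M)
      ≡⟨ cong (∑ xs dev² +_) (trans (rearrange c (∑ xs f) M) (sym (∑-*ʳ xs f (2 * c * M)))) ⟩
    ∑ xs dev² + (∑[ x ∈ xs ] (f x * (2 * c * M)))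
      ≡⟨ ∑-+ xs dev² _ ⟨
    ∑[ x ∈ xs ] (dev² x + f x * (2 * c * M))
      ≡⟨ ∑-cong xs (λ x → trans (cong (dev² x +_) (rearrange′ (f x) c M)) (trans (∣-∣²+2mn≡m²+n² (c * f x) M) (cong (_+ M * M) (square c (f x))))) ⟩
    ∑[ x ∈ xs ] (c * c * (f x * f x) + M * M)
      ≡⟨ trans (∑-+ xs _ _) (cong₂ _+_ (∑-*ˡ xs (c * c) _) (∑-const xs (M * M))) ⟩
    c * c * (∑[ x ∈ xs ] (f x * f x)) + length xs * (M * M) ∎
    where
    open ≡-Reasoning
    dev² : _ → ℕ
    dev² x = ∣ c * f x - M ∣ * ∣ c * f x - M ∣
    rearrange : ∀ c s M → 2 * (c * s * M) ≡ s * (2 * c * M)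
    rearrange = solve-∀
    rearrange′ : ∀ f c M → f * (2 * c * M) ≡ 2 * (c * f * M)
    rearrange′ = solve-∀
    square : ∀ c f → c * f * (c * f) ≡ c * c * (f * f)
    square = solve-∀

  module Dispersion {q : ℕ} (F : FiniteField q) where

    open Scalars F

    -- q² ∑_c (hits c - |S| / q)²: the distance from being equidistributed over 𝔽.
    dispersion : List B → (B → 𝔽) → ℕ
    dispersion S ℓ = ∑[ c ∈ elements ] (∣ q * hits elements-finite S ℓ c - length S ∣ * ∣ q * hits elements-finite S ℓ c - length S ∣)

    -- The mean of the hits is |S| / q, so the mixed term is twice the constant term, and one of its
    -- two copies cancels.
    dispersion-energy : (S : List B) (ℓ : B → 𝔽) →
      dispersion S ℓ + q * (length S * length S) ≡ q * q * energy elements-finite S ℓ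
    dispersion-energy S ℓ = +-cancelʳ-≡ (q * (length S * length S)) _ _ (begin
      dispersion S ℓ + q * N² + q * N²
        ≡⟨ double (dispersion S ℓ) q (length S) ⟩
      dispersion S ℓ + 2 * (q * length S * length S)
        ≡⟨ cong (λ s → dispersion S ℓ + 2 * (q * s * length S)) (∑-hits elements-finite S ℓ) ⟨
      dispersion S ℓ + 2 * (q * ∑ elements (hits elements-finite S ℓ) * length S)
        ≡⟨ ∑-deviation² elements (hits elements-finite S ℓ) q (length S) ⟩
      q * q * (∑[ c ∈ elements ] (hits elements-finite S ℓ c * hits elements-finite S ℓ c)) + length elements * N²
        ≡⟨ cong₂ (λ e l → q * q * e + l * N²) (∑-hits² elements-finite S ℓ) length-elements ⟩
      q * q * energy elements-finite S ℓ + q * N² ∎)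
      where
      open ≡-Reasoning
      N² = length S * length S
      double : ∀ d q s → d + q * (s * s) + q * (s * s) ≡ d + 2 * (q * s * s)
      double = solve-∀

    -- A Radon-type inversion: if ℓ_ξ separates any two points of S for all but a proportion 1/q
    -- of the parameters ξ, the total dispersion only sees the coincidences in S.
    ∑-dispersion : ∀ s → q ≡ suc s → (Ξ : List A) (S : List B) (ℓ : A → B → 𝔽) (κ : B → B → ℕ) →
      (∀ x y → q * (∑[ ξ ∈ Ξ ] ⟦ ℓ ξ x ≟ᶠ ℓ ξ y ⟧) ≡ length Ξ + s * length Ξ * κ x y) →
      ∑[ ξ ∈ Ξ ] dispersion S (ℓ ξ) ≡ q * s * length Ξ * (∑[ x ∈ S ] ∑[ y ∈ S ] κ x y)
    ∑-dispersion s q≡1+s Ξ S ℓ κ separates = +-cancelʳ-≡ (q * (M * N²)) _ _ (begin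
      (∑[ ξ ∈ Ξ ] dispersion S (ℓ ξ)) + q * (M * N²)
        ≡⟨ cong (∑ Ξ (dispersion S ∘ ℓ) +_) (trans (swap q M N²) (sym (∑-const Ξ (q * N²)))) ⟩
      ∑ Ξ (dispersion S ∘ ℓ) + (∑[ ξ ∈ Ξ ] (q * N²))
        ≡⟨ trans (sym (∑-+ Ξ _ _)) (∑-cong Ξ λ ξ → dispersion-energy S (ℓ ξ)) ⟩
      ∑[ ξ ∈ Ξ ] (q * q * energy elements-finite S (ℓ ξ))
        ≡⟨ trans (∑-*ˡ Ξ (q * q) _) (*-assoc q q _) ⟩
      q * (q * (∑[ ξ ∈ Ξ ] energy elements-finite S (ℓ ξ)))
        ≡⟨ cong (q *_) total ⟩
      q * (M * N² + s * M * K)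
        ≡⟨ rearrange q M N² s K ⟩
      q * s * M * K + q * (M * N²) ∎)
      where
      open ≡-Reasoning
      M = length Ξ
      N² = length S * length S
      K = ∑[ x ∈ S ] ∑[ y ∈ S ] κ x y
      swap : ∀ q m n → q * (m * n) ≡ m * (q * n)
      swap = solve-∀
      rearrange : ∀ q m n s k → q * (m * n + s * m * k) ≡ q * s * m * k + q * (m * n)
      rearrange = solve-∀
      total : q * (∑[ ξ ∈ Ξ ] energy elements-finite S (ℓ ξ)) ≡ M * N² + s * M * K
      total = begin
        q * (∑[ ξ ∈ Ξ ] energy elements-finite S (ℓ ξ))
          ≡⟨ cong (q *_) (trans (∑-swap Ξ S _) (∑-cong S λ x → ∑-swap Ξ S _)) ⟩
        q * (∑[ x ∈ S ] ∑[ y ∈ S ] ∑[ ξ ∈ Ξ ] ⟦ ℓ ξ x ≟ᶠ ℓ ξ y ⟧)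
          ≡⟨ trans (sym (∑-*ˡ S q _)) (∑-cong S λ x → sym (∑-*ˡ S q _)) ⟩
        ∑[ x ∈ S ] ∑[ y ∈ S ] (q * (∑[ ξ ∈ Ξ ] ⟦ ℓ ξ x ≟ᶠ ℓ ξ y ⟧))
          ≡⟨ ∑-cong S (λ x → ∑-cong S (separates x)) ⟩
        ∑[ x ∈ S ] ∑[ y ∈ S ] (M + s * M * κ x y)
          ≡⟨ ∑-cong S (λ x → trans (∑-+ S _ _) (cong₂ _+_ (∑-const S M) (∑-*ˡ S (s * M) (κ x)))) ⟩
        ∑[ x ∈ S ] (length S * M + s * M * (∑[ y ∈ S ] κ x y))
          ≡⟨ trans (∑-+ S _ _) (cong₂ _+_ (∑-const S _) (∑-*ˡ S (s * M) _)) ⟩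
        length S * (length S * M) + s * M * K
          ≡⟨ cong (_+ s * M * K) (rotate (length S) M) ⟩
        M * N² + s * M * K ∎
        where
        rotate : ∀ l m → l * (l * m) ≡ m * (l * l)
        rotate = solve-∀

    -- Deviations from the means add up, Cauchy-Schwarz over `I` costs the factor |I|, and a sum
    -- over the whole field is invariant under the shifts.
    dispersion-superpose : (S : List B) (ℓ : B → 𝔽) (I : List A) (T : A → List Ω) (ℓ′ : A → Ω → 𝔽) (shift : A → 𝔽) →
      (∀ c → hits elements-finite S ℓ c ≡ ∑[ b ∈ I ] hits elements-finite (T b) (ℓ′ b) (c +ᶠ shift b)) →
      length S ≡ ∑[ b ∈ I ] length (T b) →
      dispersion S ℓ ≤ length I * (∑[ b ∈ I ] dispersion (T b) (ℓ′ b))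
    dispersion-superpose S ℓ I T ℓ′ shift decompose lengths = begin
      ∑[ c ∈ elements ] (∣ q * hits elements-finite S ℓ c - length S ∣ * ∣ q * hits elements-finite S ℓ c - length S ∣)
        ≤⟨ ∑-mono elements (λ c → *-mono-≤ (triangle c) (triangle c)) ⟩
      ∑[ c ∈ elements ] ((∑[ b ∈ I ] dev b (c +ᶠ shift b)) * (∑[ b ∈ I ] dev b (c +ᶠ shift b)))
        ≤⟨ ∑-mono elements (λ c → ∑²≤length*∑² I _) ⟩
      ∑[ c ∈ elements ] (length I * (∑[ b ∈ I ] (dev b (c +ᶠ shift b) * dev b (c +ᶠ shift b))))
        ≡⟨ trans (∑-*ˡ elements (length I) _) (cong (length I *_) (∑-swap elements I _)) ⟩
      length I * (∑[ b ∈ I ] ∑[ c ∈ elements ] (dev b (c +ᶠ shift b) * dev b (c +ᶠ shift b)))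
        ≡⟨ cong (length I *_) (∑-cong I λ b → ∑-reindex elements-finite (_+ᶠ shift b) (_+ᶠ -ᶠ shift b)
             (λ c → trans (R.+-assoc c _ _) (trans (cong (c +ᶠ_) (R.-‿inverseˡ _)) (R.+-identityʳ c)))
             (λ c → trans (R.+-assoc c _ _) (trans (cong (c +ᶠ_) (R.-‿inverseʳ _)) (R.+-identityʳ c)))
             (λ c → dev b c * dev b c)) ⟩
      length I * (∑[ b ∈ I ] dispersion (T b) (ℓ′ b)) ∎
      where
      open ≤-Reasoning
      dev : _ → 𝔽 → ℕ
      dev b c = ∣ q * hits elements-finite (T b) (ℓ′ b) c - length (T b) ∣
      triangle : ∀ c → ∣ q * hits elements-finite S ℓ c - length S ∣ ≤ ∑[ b ∈ I ] dev b (c +ᶠ shift b)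
      triangle c = ≤-trans
        (≤-reflexive (cong₂ ∣_-_∣ (trans (cong (q *_) (decompose c)) (sym (∑-*ˡ I q _))) lengths))
        (∣∑-∑∣≤∑∣-∣ I (λ b → q * hits elements-finite (T b) (ℓ′ b) (c +ᶠ shift b)) (λ b → length (T b)))

  ∑-cartesianProduct : (as : List A) (bs : List B) (f : A × B → ℕ) →
    ∑ (List.cartesianProduct as bs) f ≡ ∑[ a ∈ as ] ∑[ b ∈ bs ] f (a , b)
  ∑-cartesianProduct = ∑-cartesianProductWith _,_

  length-cartesianProduct : (as : List A) (bs : List B) →
    length (List.cartesianProduct as bs) ≡ length as * length bs
  length-cartesianProduct as bs = trans (sym (∑-1 (List.cartesianProduct as bs)))
    (trans (∑-cartesianProduct as bs _) (trans (∑-const as _) (cong (length as *_) (∑-1 bs))))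

  -- The variance of λ_θ over translations, summed over rotations

  module Variance {q s : ℕ} (q≡1+s : q ≡ suc s) .{{_ : NonZero q}} .{{_ : NonZero s}}
    (F : FiniteField q) (odd : ¬ 2 ∣ q) (d : ℕ) .{{_ : NonZero d}} where

    open Reflections F odd d public
    open Dispersion F public

    x+a≡y⇒x≡y-a : ∀ x a {y} → x +ᶠ a ≡ y → x ≡ y +ᶠ -1ᶠ *ᶠ a
    x+a≡y⇒x≡y-a x a {y} e = begin
      x                              ≡⟨ solve 2 (λ x a → x := x :+ con 0 :* a) refl x a ⟩
      x +ᶠ 0# *ᶠ a                   ≡⟨ cong (λ o → x +ᶠ o *ᶠ a) 1+-1≡0 ⟨
      x +ᶠ (1# +ᶠ -1ᶠ) *ᶠ a          ≡⟨ solve 3 (λ x a m → x :+ (con 1 :+ m) :* a := (x :+ a) :+ m :* a) refl x a -1ᶠ ⟩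
      (x +ᶠ a) +ᶠ -1ᶠ *ᶠ a           ≡⟨ cong (_+ᶠ -1ᶠ *ᶠ a) e ⟩
      y +ᶠ -1ᶠ *ᶠ a                  ∎
      where open ≡-Reasoning

    x≡y-a⇒x+a≡y : ∀ {x} a y → x ≡ y +ᶠ -1ᶠ *ᶠ a → x +ᶠ a ≡ y
    x≡y-a⇒x+a≡y {x} a y e = begin
      x +ᶠ a                         ≡⟨ cong (_+ᶠ a) e ⟩
      (y +ᶠ -1ᶠ *ᶠ a) +ᶠ a           ≡⟨ solve 3 (λ y a m → (y :+ m :* a) :+ a := y :+ (con 1 :+ m) :* a) refl y a -1ᶠ ⟩
      y +ᶠ (1# +ᶠ -1ᶠ) *ᶠ a          ≡⟨ cong (λ o → y +ᶠ o *ᶠ a) 1+-1≡0 ⟩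
      y +ᶠ 0# *ᶠ a                   ≡⟨ solve 2 (λ y a → y :+ con 0 :* a := y) refl y a ⟩
      y                              ∎
      where open ≡-Reasoning

    -- The solutions ξ form an affine hyperplane with normal v - v′.
    separation : ∀ {v v′} → v ≢ v′ → ∀ a b →
      q * (∑[ ξ ∈ points ] ⟦ ξ ⊙ v +ᶠ a ≟ᶠ ξ ⊙ v′ +ᶠ b ⟧) ≡ Q
    separation {v} {v′} v≢v′ a b = trans
      (cong (q *_) (∑-cong points λ ξ → ⟦⟧-cong (ξ ⊙ v +ᶠ a ≟ᶠ ξ ⊙ v′ +ᶠ b) (ξ ⊙ (v ⊟ v′) ≟ᶠ b +ᶠ -1ᶠ *ᶠ a) (to ξ) (from ξ)))
      (hyperplane (v≢v′ ∘ x⊟y≡𝟎⇒x≡y) (b +ᶠ -1ᶠ *ᶠ a))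
      where
      exchange : ∀ x y a b m → (y +ᶠ b) +ᶠ m *ᶠ a ≡ (b +ᶠ m *ᶠ a) +ᶠ y
      exchange x y a b m = solve 4 (λ y a b m → (y :+ b) :+ m :* a := (b :+ m :* a) :+ y) refl y a b m
      to : ∀ ξ → ξ ⊙ v +ᶠ a ≡ ξ ⊙ v′ +ᶠ b → ξ ⊙ (v ⊟ v′) ≡ b +ᶠ -1ᶠ *ᶠ a
      to ξ e = trans (⊙-⊟ʳ ξ v v′) (sym (x+a≡y⇒x≡y-a _ (ξ ⊙ v′)
        (sym (trans (x+a≡y⇒x≡y-a (ξ ⊙ v) a e) (exchange (ξ ⊙ v) (ξ ⊙ v′) a b -1ᶠ)))))
      from : ∀ ξ → ξ ⊙ (v ⊟ v′) ≡ b +ᶠ -1ᶠ *ᶠ a → ξ ⊙ v +ᶠ a ≡ ξ ⊙ v′ +ᶠ b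
      from ξ e = x≡y-a⇒x+a≡y a _ (trans
        (sym (x≡y-a⇒x+a≡y (ξ ⊙ v′) (ξ ⊙ v) (trans (sym e) (⊙-⊟ʳ ξ v v′))))
        (sym (exchange (ξ ⊙ v) (ξ ⊙ v′) a b -1ᶠ)))

    q*∑-1 : (xs : List A) → q * (∑[ _ ∈ xs ] 1) ≡ length xs + s * length xs * 1
    q*∑-1 xs = trans (cong₂ _*_ q≡1+s (∑-1 xs)) (lemma s (length xs))
      where
      lemma : ∀ s l → suc s * l ≡ l + s * l * 1
      lemma = solve-∀

    separation-⟦⟧ : ∀ v v′ → q * (∑[ ξ ∈ points ] ⟦ ξ ⊙ v ≟ᶠ ξ ⊙ v′ ⟧) ≡ length points + s * length points * ⟦ v ≟ᴾ v′ ⟧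
    separation-⟦⟧ v v′ = go (v ≟ᴾ v′)
      where
      go : (p : Dec (v ≡ v′)) → q * (∑[ ξ ∈ points ] ⟦ ξ ⊙ v ≟ᶠ ξ ⊙ v′ ⟧) ≡ length points + s * length points * ⟦ p ⟧
      go (yes refl) = trans (cong (q *_) (∑-cong points λ ξ → ⟦⟧-yes (ξ ⊙ v ≟ᶠ ξ ⊙ v) refl)) (q*∑-1 points)
      go (no v≢v′) = begin
        q * (∑[ ξ ∈ points ] ⟦ ξ ⊙ v ≟ᶠ ξ ⊙ v′ ⟧)
          ≡⟨ cong (q *_) (∑-cong points λ ξ → cong₂ (λ a b → ⟦ a ≟ᶠ b ⟧) (R.+-identityʳ _) (R.+-identityʳ _)) ⟨
        q * (∑[ ξ ∈ points ] ⟦ ξ ⊙ v +ᶠ 0# ≟ᶠ ξ ⊙ v′ +ᶠ 0# ⟧)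
          ≡⟨ trans (separation v≢v′ 0# 0#) (sym length-points) ⟩
        length points
          ≡⟨ trans (cong (length points +_) (*-zeroʳ (s * length points))) (+-identityʳ _) ⟨
        length points + s * length points * 0 ∎
        where open ≡-Reasoning

    -- This linear form on pairs takes the place of a character; (ξ, η) plays the role of its
    -- frequency.
    pairing : Point → Point → Point × Point → 𝔽
    pairing ξ η (u , v) = ξ ⊙ v +ᶠ -1ᶠ *ᶠ η ⊙ u

    -- Equality of pairs, kept as a product so that its sum over a product list factors.
    coincide : Point × Point → Point × Point → ℕ
    coincide (u , v) (u′ , v′) = ⟦ v ≟ᴾ v′ ⟧ * ⟦ u ≟ᴾ u′ ⟧

    frequencies : List (Point × Point)
    frequencies = List.cartesianProduct points points

    length-frequencies : length frequencies ≡ Q * Q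
    length-frequencies = trans (length-cartesianProduct points points) (cong₂ _*_ length-points length-points)

    -- If v ≠ v′, the frequencies ξ of a collision form a hyperplane for each fixed η. If only u ≠
    -- u′, the roles of ξ and η are exchanged.
    separation-pairing : ∀ x y →
      q * (∑[ ω ∈ frequencies ] ⟦ pairing (proj₁ ω) (proj₂ ω) x ≟ᶠ pairing (proj₁ ω) (proj₂ ω) y ⟧) ≡
      length frequencies + s * length frequencies * coincide x y
    separation-pairing x@(u , v) y@(u′ , v′) = go (v ≟ᴾ v′) (u ≟ᴾ u′)
      where
      open ≡-Reasoning
      empty : ∀ c → length frequencies ≡ length frequencies + s * length frequencies * (c * 0)
      empty c = sym (trans (cong (λ z → length frequencies + s * length frequencies * z) (*-zeroʳ c))
        (trans (cong (length frequencies +_) (*-zeroʳ (s * length frequencies))) (+-identityʳ _)))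
      Q*Q : ∑[ _ ∈ points ] Q ≡ length frequencies
      Q*Q = trans (∑-const points Q) (trans (cong (_* Q) length-points) (sym length-frequencies))
      go : (p : Dec (v ≡ v′)) (r : Dec (u ≡ u′)) →
        q * (∑[ ω ∈ frequencies ] ⟦ pairing (proj₁ ω) (proj₂ ω) x ≟ᶠ pairing (proj₁ ω) (proj₂ ω) y ⟧) ≡
        length frequencies + s * length frequencies * (⟦ p ⟧ * ⟦ r ⟧)
      go (yes refl) (yes refl) = trans
        (cong (q *_) (∑-cong frequencies λ (ξ , η) → ⟦⟧-yes (pairing ξ η x ≟ᶠ pairing ξ η x) refl)) (q*∑-1 frequencies)
      go (no v≢v′) r = begin
        q * (∑[ ω ∈ frequencies ] ⟦ pairing (proj₁ ω) (proj₂ ω) x ≟ᶠ pairing (proj₁ ω) (proj₂ ω) y ⟧)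
          ≡⟨ cong (q *_) (trans (∑-cartesianProduct points points _) (∑-swap points points _)) ⟩
        q * (∑[ η ∈ points ] ∑[ ξ ∈ points ] ⟦ ξ ⊙ v +ᶠ -1ᶠ *ᶠ η ⊙ u ≟ᶠ ξ ⊙ v′ +ᶠ -1ᶠ *ᶠ η ⊙ u′ ⟧)
          ≡⟨ trans (sym (∑-*ˡ points q _)) (∑-cong points λ η → separation v≢v′ (-1ᶠ *ᶠ η ⊙ u) (-1ᶠ *ᶠ η ⊙ u′)) ⟩
        ∑[ η ∈ points ] Q
          ≡⟨ trans Q*Q (empty 0) ⟩
        length frequencies + s * length frequencies * (0 * 0) ∎
      go (yes refl) (no u≢u′) = begin
        q * (∑[ ω ∈ frequencies ] ⟦ pairing (proj₁ ω) (proj₂ ω) x ≟ᶠ pairing (proj₁ ω) (proj₂ ω) y ⟧)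
          ≡⟨ cong (q *_) (trans (∑-cartesianProduct points points _) (∑-cong points λ ξ → ∑-cong points λ η →
               ⟦⟧-cong (pairing ξ η x ≟ᶠ pairing ξ η y) (η ⊙ u′ +ᶠ 0# ≟ᶠ η ⊙ u +ᶠ 0#) (to ξ η) (from ξ η))) ⟩
        q * (∑[ ξ ∈ points ] ∑[ η ∈ points ] ⟦ η ⊙ u′ +ᶠ 0# ≟ᶠ η ⊙ u +ᶠ 0# ⟧)
          ≡⟨ trans (sym (∑-*ˡ points q _)) (∑-cong points λ ξ → separation (u≢u′ ∘ sym) 0# 0#) ⟩
        ∑[ ξ ∈ points ] Q
          ≡⟨ trans Q*Q (empty 1) ⟩
        length frequencies + s * length frequencies * (1 * 0) ∎
        where
        to : ∀ ξ η → pairing ξ η x ≡ pairing ξ η y → η ⊙ u′ +ᶠ 0# ≡ η ⊙ u +ᶠ 0#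
        to ξ η e = cong (_+ᶠ 0#) (*-cancelˡᶠ -1≢0 (sym (+-cancelˡᶠ (ξ ⊙ v) e)))
          where
          -1≢0 : -1ᶠ ≢ 0#
          -1≢0 e = 0≢1 (trans (sym 1+-1≡0) (trans (cong (1# +ᶠ_) e) (R.+-identityʳ 1#)))
        from : ∀ ξ η → η ⊙ u′ +ᶠ 0# ≡ η ⊙ u +ᶠ 0# → pairing ξ η x ≡ pairing ξ η y
        from ξ η e = cong (λ a → ξ ⊙ v +ᶠ -1ᶠ *ᶠ a)
          (trans (sym (R.+-identityʳ (η ⊙ u))) (trans (sym e) (R.+-identityʳ (η ⊙ u′))))

    module _ (E : List Point) where

      E² : List (Point × Point)
      E² = List.cartesianProduct E E

      L N : ℕ
      L = length E
      N = L * L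

      length-E² : length E² ≡ N
      length-E² = length-cartesianProduct E E

      -- The one translation z with z + θ u = v, so that λ_θ counts how often each value is taken on
      -- E × E.
      displacement : LinearMap → Point × Point → Point
      displacement θ (u , v) = v ⊟ θ · u

      multiplicity : LinearMap → Point → ℕ
      multiplicity θ z = ∑[ u ∈ E ] ∑[ v ∈ E ] ⟦ z ⊞ θ · u ≟ᴾ v ⟧

      multiplicity-hits : ∀ θ z → multiplicity θ z ≡ hits points-finite E² (displacement θ) z
      multiplicity-hits θ z = sym (trans (∑-cartesianProduct E E _) (∑-cong E λ u → ∑-cong E λ v →
        ⟦⟧-cong (v ⊟ θ · u ≟ᴾ z) (z ⊞ θ · u ≟ᴾ v)
          (λ e → trans (cong (_⊞ θ · u) (sym e)) (⊟-⊞-cancel v (θ · u)))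
          (λ e → trans (cong (_⊟ θ · u) (sym e)) (⊞-⊟-cancel z (θ · u)))))

      ∑-multiplicity : ∀ θ → ∑ points (multiplicity θ) ≡ N
      ∑-multiplicity θ = trans (∑-cong points (multiplicity-hits θ))
        (trans (∑-hits points-finite E² (displacement θ)) length-E²)

      coincidences : LinearMap → ℕ
      coincidences θ = energy points-finite E² (displacement θ)

      variance : LinearMap → ℕ
      variance θ = ∑[ z ∈ points ] (∣ Q * multiplicity θ z - N ∣ * ∣ Q * multiplicity θ z - N ∣)

      -- The computation is that of `dispersion-energy`, with 𝔽^d in place of 𝔽 and mean N / Q.
      variance-coincidences : ∀ θ → variance θ + Q * (N * N) ≡ Q * Q * coincidences θ
      variance-coincidences θ = +-cancelʳ-≡ (Q * (N * N)) _ _ (begin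
        variance θ + Q * (N * N) + Q * (N * N)
          ≡⟨ double (variance θ) Q N ⟩
        variance θ + 2 * (Q * N * N)
          ≡⟨ cong (λ t → variance θ + 2 * (Q * t * N)) (∑-multiplicity θ) ⟨
        variance θ + 2 * (Q * ∑ points (multiplicity θ) * N)
          ≡⟨ ∑-deviation² points (multiplicity θ) Q N ⟩
        Q * Q * (∑[ z ∈ points ] (multiplicity θ z * multiplicity θ z)) + length points * (N * N)
          ≡⟨ cong₂ (λ t l → Q * Q * t + l * (N * N))
               (trans (∑-cong points λ z → cong₂ _*_ (multiplicity-hits θ z) (multiplicity-hits θ z)) (∑-hits² points-finite E² (displacement θ)))
               length-points ⟩
        Q * Q * coincidences θ + Q * (N * N) ∎)
        where
        open ≡-Reasoning
        double : ∀ v q n → v + q * (n * n) + q * (n * n) ≡ v + 2 * (q * n * n)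
        double = solve-∀

      D : Point → Point → ℕ
      D ξ η = dispersion E² (pairing ξ η)

      pairing-rotate : ∀ {θ} → Orthogonal θ → ∀ η x → pairing (θ · η) η x ≡ (θ · η) ⊙ displacement θ x
      pairing-rotate {θ} orth η (u , v) = sym (trans (⊙-⊟ʳ (θ · η) v (θ · u))
        (cong (λ a → (θ · η) ⊙ v +ᶠ -1ᶠ *ᶠ a) (orthogonal-⊙ {θ} orth η u)))

      -- For ξ = θ η the form ξ·v - η·u equals θ η · (v - θ u) and depends only on the displacement.
      -- As θ η also runs over all points, distinct displacements collide for a proportion 1/q of
      -- the directions.
      ∑-D-rotate : ∀ {θ} → Orthogonal θ → ∑[ η ∈ points ] D (θ · η) η ≡ q * s * Q * coincidences θ
      ∑-D-rotate {θ} orth = trans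
        (∑-dispersion s q≡1+s points E² (λ η → pairing (θ · η) η) (λ x y → ⟦ displacement θ x ≟ᴾ displacement θ y ⟧) λ x y → begin
          q * (∑[ η ∈ points ] ⟦ pairing (θ · η) η x ≟ᶠ pairing (θ · η) η y ⟧)
            ≡⟨ cong (q *_) (∑-cong points λ η → cong₂ (λ a b → ⟦ a ≟ᶠ b ⟧) (pairing-rotate {θ} orth η x) (pairing-rotate {θ} orth η y)) ⟩
          q * (∑[ η ∈ points ] ⟦ (θ · η) ⊙ displacement θ x ≟ᶠ (θ · η) ⊙ displacement θ y ⟧)
            ≡⟨ cong (q *_) (∑-rotate {θ} orth λ ξ → ⟦ ξ ⊙ displacement θ x ≟ᶠ ξ ⊙ displacement θ y ⟧) ⟩
          q * (∑[ ξ ∈ points ] ⟦ ξ ⊙ displacement θ x ≟ᶠ ξ ⊙ displacement θ y ⟧)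
            ≡⟨ separation-⟦⟧ (displacement θ x) (displacement θ y) ⟩
          length points + s * length points * ⟦ displacement θ x ≟ᴾ displacement θ y ⟧ ∎)
        (cong (λ l → q * s * l * coincidences θ) length-points)
        where open ≡-Reasoning

      ·-𝟎 : ∀ θ → θ · 𝟎 ≡ 𝟎
      ·-𝟎 θ = ⊙-nondegenerate λ u → trans (·-adjoint θ u 𝟎) (trans (⊙-𝟎ʳ (θ ᵀ· u)) (sym (⊙-𝟎ʳ u)))

      D-𝟎 : D 𝟎 𝟎 ≡ q * s * (N * N)
      D-𝟎 = +-cancelʳ-≡ (q * (N * N)) _ _ (begin
        D 𝟎 𝟎 + q * (N * N)
          ≡⟨ cong (λ l → D 𝟎 𝟎 + q * (l * l)) length-E² ⟨
        D 𝟎 𝟎 + q * (length E² * length E²)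
          ≡⟨ dispersion-energy E² (pairing 𝟎 𝟎) ⟩
        q * q * energy elements-finite E² (pairing 𝟎 𝟎)
          ≡⟨ cong (q * q *_) (trans (∑-cong E² λ x → trans (∑-cong E² λ y → ⟦⟧-yes (pairing 𝟎 𝟎 x ≟ᶠ pairing 𝟎 𝟎 y)
               (trans (vanish x) (sym (vanish y)))) (∑-1 E²)) (trans (∑-const E² _) (cong₂ _*_ length-E² length-E²))) ⟩
        q * q * (N * N)
          ≡⟨ trans (cong (λ p → q * p * (N * N)) q≡1+s) (expand q s (N * N)) ⟩
        q * s * (N * N) + q * (N * N) ∎)
        where
        open ≡-Reasoning
        expand : ∀ q s n → q * suc s * n ≡ q * s * n + q * n
        expand = solve-∀
        vanish : ∀ x → pairing 𝟎 𝟎 x ≡ 0#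
        vanish (u , v) = trans (cong₂ (λ a b → a +ᶠ -1ᶠ *ᶠ b) (⊙-𝟎ˡ v) (⊙-𝟎ˡ u))
          (trans (R.+-identityˡ _) (R.zeroʳ -1ᶠ))

      nonzero? : (η : Point) → Dec (η ≢ 𝟎)
      nonzero? η = ¬? (η ≟ᴾ 𝟎)

      -- The form with η = 0 is constant, and its dispersion is exactly the share of the squared
      -- mean of λ_θ. Omitting it turns the number of coincidences into the variance.
      variance-D : ∀ {θ} → Orthogonal θ →
        q * s * variance θ ≡ Q * (∑[ η ∈ points ] (⟦ nonzero? η ⟧ * D (θ · η) η))
      variance-D {θ} orth = +-cancelʳ-≡ (Q * (q * s * (N * N))) _ _ (begin
        q * s * variance θ + Q * (q * s * (N * N))
          ≡⟨ factor (q * s) (variance θ) Q (N * N) ⟩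
        q * s * (variance θ + Q * (N * N))
          ≡⟨ cong (q * s *_) (variance-coincidences θ) ⟩
        q * s * (Q * Q * coincidences θ)
          ≡⟨ regroup (q * s) Q (coincidences θ) ⟩
        Q * (q * s * Q * coincidences θ)
          ≡⟨ cong (Q *_) (∑-D-rotate {θ} orth) ⟨
        Q * (∑[ η ∈ points ] D (θ · η) η)
          ≡⟨ cong (Q *_) (∑-cong points λ η → split η (η ≟ᴾ 𝟎)) ⟩
        Q * (∑[ η ∈ points ] (⟦ nonzero? η ⟧ * D (θ · η) η + ⟦ 𝟎 ≟ᴾ η ⟧ * D (θ · η) η))
          ≡⟨ cong (Q *_) (∑-+ points _ _) ⟩
        Q * (T + (∑[ η ∈ points ] (⟦ 𝟎 ≟ᴾ η ⟧ * D (θ · η) η)))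
          ≡⟨ cong (λ t → Q * (T + t)) (trans (∑-pick _≟ᴾ_ points-unique (λ η → D (θ · η) η) (points-complete 𝟎))
               (trans (cong (λ x → D x 𝟎) (·-𝟎 θ)) D-𝟎)) ⟩
        Q * (T + q * s * (N * N))
          ≡⟨ *-distribˡ-+ Q T _ ⟩
        Q * T + Q * (q * s * (N * N)) ∎)
        where
        open ≡-Reasoning
        T = ∑[ η ∈ points ] (⟦ nonzero? η ⟧ * D (θ · η) η)
        factor : ∀ c v q n → c * v + q * (c * n) ≡ c * (v + q * n)
        factor = solve-∀
        regroup : ∀ c q k → c * (q * q * k) ≡ q * (c * q * k)
        regroup = solve-∀
        split : ∀ η (p : Dec (η ≡ 𝟎)) → D (θ · η) η ≡ ⟦ ¬? p ⟧ * D (θ · η) η + ⟦ 𝟎 ≟ᴾ η ⟧ * D (θ · η) η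
        split η (yes e) = sym (trans (cong (_* D (θ · η) η) (⟦⟧-yes (𝟎 ≟ᴾ η) (sym e))) (*-identityˡ _))
        split η (no ne) = sym (trans (cong₂ _+_ (*-identityˡ _) (cong (_* D (θ · η) η) (⟦⟧-no (𝟎 ≟ᴾ η) (ne ∘ sym)))) (+-identityʳ _))

      -- Membership of ξ in the orbit of η is relaxed to equality of norms, a condition that can be
      -- counted along lines.
      equinormal : ℕ
      equinormal = ∑[ η ∈ points ] ∑[ ξ ∈ points ] (⟦ ‖ ξ ‖ ≟ᶠ ‖ η ‖ ⟧ * D ξ η)

      module _ (i : Fin d) where

        -- Sorting the maps by ξ = θ η gives a sum over ξ weighted by the transporters. For η ≠ 0
        -- these vanish unless ξ is nonzero and of the same norm, and then the reflection bound
        -- applies.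
        ∑-variance-equinormal : q * s * ∑ O variance ≤ 4 ^ d * (q * length O) * equinormal
        ∑-variance-equinormal = begin
          q * s * ∑ O variance
            ≡⟨ ∑-*ˡ O (q * s) variance ⟨
          ∑[ θ ∈ O ] (q * s * variance θ)
            ≤⟨ ∑-mono-∈ O (λ θ θ∈ → ≤-reflexive (variance-D {θ} (∈O⇒orthogonal {θ} θ∈))) ⟩
          ∑[ θ ∈ O ] (Q * (∑[ η ∈ points ] (⟦ nonzero? η ⟧ * D (θ · η) η)))
            ≡⟨ trans (∑-*ˡ O Q _) (cong (Q *_) (trans (∑-swap O points _) (∑-cong points λ η → ∑-*ˡ O ⟦ nonzero? η ⟧ _))) ⟩
          Q * (∑[ η ∈ points ] (⟦ nonzero? η ⟧ * (∑[ θ ∈ O ] D (θ · η) η)))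
            ≡⟨ cong (Q *_) (∑-cong points λ η → cong (⟦ nonzero? η ⟧ *_) (trans
                 (∑-fibres _≟ᴾ_ points-unique O (_· η) (λ θ _ → points-complete (θ · η)) (λ θ ξ → D ξ η))
                 (∑-cong points λ ξ → ∑-*ʳ O _ (D ξ η)))) ⟩
          Q * (∑[ η ∈ points ] (⟦ nonzero? η ⟧ * (∑[ ξ ∈ points ] (transporters η ξ * D ξ η))))
            ≡⟨ trans (sym (∑-*ˡ points Q _)) (∑-cong points λ η → trans (cong (Q *_) (sym (∑-*ˡ points ⟦ nonzero? η ⟧ _))) (sym (∑-*ˡ points Q _))) ⟩
          ∑[ η ∈ points ] ∑[ ξ ∈ points ] (Q * (⟦ nonzero? η ⟧ * (transporters η ξ * D ξ η)))
            ≡⟨ ∑-cong points (λ η → ∑-cong points λ ξ → regroup Q ⟦ nonzero? η ⟧ (transporters η ξ) (D ξ η)) ⟩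
          ∑[ η ∈ points ] ∑[ ξ ∈ points ] (⟦ nonzero? η ⟧ * (Q * transporters η ξ) * D ξ η)
            ≤⟨ ∑-mono points (λ η → ∑-mono points λ ξ → *-monoˡ-≤ (D ξ η) (bound η ξ (η ≟ᴾ 𝟎) (‖ ξ ‖ ≟ᶠ ‖ η ‖))) ⟩
          ∑[ η ∈ points ] ∑[ ξ ∈ points ] (R * ⟦ ‖ ξ ‖ ≟ᶠ ‖ η ‖ ⟧ * D ξ η)
            ≡⟨ ∑-cong points (λ η → trans (∑-cong points λ ξ → *-assoc R _ _) (∑-*ˡ points R _)) ⟩
          ∑[ η ∈ points ] (R * (∑[ ξ ∈ points ] (⟦ ‖ ξ ‖ ≟ᶠ ‖ η ‖ ⟧ * D ξ η)))
            ≡⟨ ∑-*ˡ points R _ ⟩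
          R * equinormal ∎
          where
          open ≤-Reasoning
          R = 4 ^ d * (q * length O)
          regroup : ∀ q b t d → q * (b * (t * d)) ≡ b * (q * t) * d
          regroup = solve-∀
          no-transporters : ∀ η ξ → (∀ θ → Orthogonal θ → θ · η ≢ ξ) → Q * transporters η ξ ≤ 0
          no-transporters η ξ none = ≤-reflexive (trans (cong (Q *_) (∑-no (λ θ → θ · η ≟ᴾ ξ) O
            λ θ θ∈ → none θ (∈O⇒orthogonal {θ} θ∈))) (*-zeroʳ Q))
          bound : ∀ η ξ (p : Dec (η ≡ 𝟎)) (r : Dec (‖ ξ ‖ ≡ ‖ η ‖)) → ⟦ ¬? p ⟧ * (Q * transporters η ξ) ≤ R * ⟦ r ⟧
          bound η ξ (yes _) r = z≤n
          bound η ξ (no η≢𝟎) (no ‖ξ‖≢‖η‖) = ≤-trans (≤-reflexive (*-identityˡ _))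
            (≤-trans (no-transporters η ξ λ θ orth e → ‖ξ‖≢‖η‖ (trans (cong ‖_‖ (sym e)) (orth η))) z≤n)
          bound η ξ (no η≢𝟎) (yes _) = ≤-trans (≤-reflexive (*-identityˡ _)) (≤-trans (moved (ξ ≟ᴾ 𝟎)) (≤-reflexive (sym (*-identityʳ R))))
            where
            moved : Dec (ξ ≡ 𝟎) → Q * transporters η ξ ≤ R
            moved (no ξ≢𝟎) = transporters-bound i η ξ≢𝟎
            moved (yes e) = ≤-trans (no-transporters η ξ λ θ orth e′ → η≢𝟎
              (orthogonal-injective {θ} orth η 𝟎 (trans e′ (trans e (sym (·-𝟎 θ)))))) z≤n

        module _ (E-unique : Unique E) (A : List 𝔽) (A-unique : Unique A) (covers : ∀ u → u ∈ E → lookup u i ∈ A) where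

          slice : 𝔽 → List Point
          slice b = List.filter (λ v → lookup v i ≟ᶠ b) E

          slab : 𝔽 → List (Point × Point)
          slab b = List.cartesianProduct E (slice b)

          ∑-slices : (f : Point → 𝔽 → ℕ) →
            ∑[ v ∈ E ] f v (lookup v i) ≡ ∑[ b ∈ A ] ∑[ v ∈ slice b ] f v b
          ∑-slices f = trans (∑-fibres _≟ᶠ_ A-unique E (λ v → lookup v i) covers f)
            (∑-cong A λ b → sym (∑-filter (λ v → lookup v i ≟ᶠ b) E (λ v → f v b)))

          ∑-slabs : (f : Point → Point → 𝔽 → ℕ) →
            ∑[ u ∈ E ] ∑[ v ∈ E ] f u v (lookup v i) ≡ ∑[ b ∈ A ] ∑[ (u , v) ∈ slab b ] f u v b
          ∑-slabs f = trans (∑-cong E λ u → ∑-slices (f u))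
            (trans (∑-swap E A _) (∑-cong A λ b → sym (∑-cartesianProduct E (slice b) _)))

          -- On the slab of b, moving ξ by t e_i adds the constant t b to the form, so E × E is a
          -- superposition of shifted slabs and the bound is independent of t.
          D-slabs : ∀ t ξ η → D (ξ ⊞ t ⊛ basis i) η ≤ length A * (∑[ b ∈ A ] dispersion (slab b) (pairing ξ η))
          D-slabs t ξ η = dispersion-superpose E² (pairing (ξ ⊞ t ⊛ basis i) η) A slab (λ _ → pairing ξ η) (λ b → -1ᶠ *ᶠ (t *ᶠ b))
            (λ c → begin
              hits elements-finite E² (pairing (ξ ⊞ t ⊛ basis i) η) c
                ≡⟨ ∑-cartesianProduct E E _ ⟩
              ∑[ u ∈ E ] ∑[ v ∈ E ] ⟦ pairing (ξ ⊞ t ⊛ basis i) η (u , v) ≟ᶠ c ⟧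
                ≡⟨ ∑-cong E (λ u → ∑-cong E λ v → ⟦⟧-cong (pairing (ξ ⊞ t ⊛ basis i) η (u , v) ≟ᶠ c)
                     (pairing ξ η (u , v) ≟ᶠ c +ᶠ -1ᶠ *ᶠ (t *ᶠ lookup v i))
                     (λ e → x+a≡y⇒x≡y-a _ _ (trans (sym (expand u v)) e))
                     (λ e → trans (expand u v) (x≡y-a⇒x+a≡y _ c e))) ⟩
              ∑[ u ∈ E ] ∑[ v ∈ E ] ⟦ pairing ξ η (u , v) ≟ᶠ c +ᶠ -1ᶠ *ᶠ (t *ᶠ lookup v i) ⟧
                ≡⟨ ∑-slabs (λ u v b → ⟦ pairing ξ η (u , v) ≟ᶠ c +ᶠ -1ᶠ *ᶠ (t *ᶠ b) ⟧) ⟩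
              ∑[ b ∈ A ] hits elements-finite (slab b) (pairing ξ η) (c +ᶠ -1ᶠ *ᶠ (t *ᶠ b)) ∎)
            slabs-lengths
            where
            open ≡-Reasoning
            expand : ∀ u v → pairing (ξ ⊞ t ⊛ basis i) η (u , v) ≡ pairing ξ η (u , v) +ᶠ t *ᶠ lookup v i
            expand u v = trans (cong (_+ᶠ -1ᶠ *ᶠ η ⊙ u) (trans (⊙-shift (basis i) v t ξ) (cong (λ a → ξ ⊙ v +ᶠ t *ᶠ a) (basis-⊙ i v))))
              (solve 3 (λ x y z → (x :+ y) :+ z := (x :+ z) :+ y) refl (ξ ⊙ v) (t *ᶠ lookup v i) (-1ᶠ *ᶠ η ⊙ u))
            slabs-lengths : length E² ≡ ∑[ b ∈ A ] length (slab b)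
            slabs-lengths = trans (sym (∑-1 E²)) (trans (∑-cartesianProduct E E _) (trans (∑-slabs λ _ _ _ → 1) (∑-cong A λ b → ∑-1 (slab b))))

          slabs-total : ∑[ b ∈ A ] length (slab b) ≡ N
          slabs-total = trans (∑-cong A λ b → sym (∑-1 (slab b)))
            (trans (sym (∑-slabs λ _ _ _ → 1)) (trans (∑-const E _) (cong (L *_) (∑-1 E))))

          -- With ξ and η unrestricted, the inversion over all frequencies applies. As `E` has no
          -- repetition, a pair coincides at most with itself.
          ∑-slab-dispersion : ∀ b → ∑[ η ∈ points ] ∑[ ξ ∈ points ] dispersion (slab b) (pairing ξ η) ≤ q * s * (Q * Q) * length (slab b)
          ∑-slab-dispersion b = begin
            ∑[ η ∈ points ] ∑[ ξ ∈ points ] dispersion (slab b) (pairing ξ η)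
              ≡⟨ trans (∑-swap points points _) (sym (∑-cartesianProduct points points _)) ⟩
            ∑[ (ξ , η) ∈ frequencies ] dispersion (slab b) (pairing ξ η)
              ≡⟨ ∑-dispersion s q≡1+s frequencies (slab b) (λ (ξ , η) → pairing ξ η) coincide separation-pairing ⟩
            q * s * length frequencies * (∑[ x ∈ slab b ] ∑[ y ∈ slab b ] coincide x y)
              ≤⟨ *-mono-≤ (≤-reflexive (cong (q * s *_) length-frequencies))
                   (≤-trans (∑-mono (slab b) isolated) (≤-reflexive (∑-1 (slab b)))) ⟩
            q * s * (Q * Q) * length (slab b) ∎
            where
            open ≤-Reasoning
            isolated : ∀ x → ∑[ y ∈ slab b ] coincide x y ≤ 1
            isolated (u , v) = begin
              ∑[ y ∈ slab b ] coincide (u , v) y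
                ≡⟨ ∑-cartesianProduct E (slice b) _ ⟩
              ∑[ u′ ∈ E ] ∑[ v′ ∈ slice b ] (⟦ v ≟ᴾ v′ ⟧ * ⟦ u ≟ᴾ u′ ⟧)
                ≡⟨ trans (∑-swap E (slice b) _) (∑-*-∑ (slice b) E _ _) ⟩
              (∑[ v′ ∈ slice b ] ⟦ v ≟ᴾ v′ ⟧) * (∑[ u′ ∈ E ] ⟦ u ≟ᴾ u′ ⟧)
                ≤⟨ *-mono-≤ (∑-unique-≤1 (v ≟ᴾ_) (Unique.filter⁺ (λ v → lookup v i ≟ᶠ b) E-unique) λ _ _ p r → trans (sym p) r)
                            (∑-unique-≤1 (u ≟ᴾ_) E-unique λ _ _ p r → trans (sym p) r) ⟩
              1 ∎

          -- The slabs do not see a shift of ξ along the i-th axis, and each line in that direction contains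
          -- at most two points of the norm of η.
          equinormal-bound : q * equinormal ≤ q * (2 * length A * s * (Q * Q) * N)
          equinormal-bound = begin
            q * equinormal
              ≡⟨ ∑-*ˡ points q _ ⟨
            ∑[ η ∈ points ] (q * (∑[ ξ ∈ points ] (⟦ ‖ ξ ‖ ≟ᶠ ‖ η ‖ ⟧ * D ξ η)))
              ≡⟨ ∑-cong points (λ η → ∑-average (basis i) (λ ξ → ⟦ ‖ ξ ‖ ≟ᶠ ‖ η ‖ ⟧ * D ξ η)) ⟩
            ∑[ η ∈ points ] ∑[ ξ ∈ points ] ∑[ t ∈ elements ] (⟦ ‖ ξ ⊞ t ⊛ basis i ‖ ≟ᶠ ‖ η ‖ ⟧ * D (ξ ⊞ t ⊛ basis i) η)
              ≤⟨ ∑-mono points (λ η → ∑-mono points λ ξ → line ξ η) ⟩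
            ∑[ η ∈ points ] ∑[ ξ ∈ points ] (2 * a * (∑[ b ∈ A ] dispersion (slab b) (pairing ξ η)))
              ≡⟨ trans (∑-cong points λ η → ∑-*ˡ points (2 * a) _) (∑-*ˡ points (2 * a) _) ⟩
            2 * a * (∑[ η ∈ points ] ∑[ ξ ∈ points ] ∑[ b ∈ A ] dispersion (slab b) (pairing ξ η))
              ≡⟨ cong (2 * a *_) (trans (∑-cong points λ η → ∑-swap points A _) (∑-swap points A _)) ⟩
            2 * a * (∑[ b ∈ A ] ∑[ η ∈ points ] ∑[ ξ ∈ points ] dispersion (slab b) (pairing ξ η))
              ≤⟨ *-monoʳ-≤ (2 * a) (∑-mono A ∑-slab-dispersion) ⟩
            2 * a * (∑[ b ∈ A ] (q * s * (Q * Q) * length (slab b)))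
              ≡⟨ cong (2 * a *_) (trans (∑-*ˡ A (q * s * (Q * Q)) _) (cong (q * s * (Q * Q) *_) slabs-total)) ⟩
            2 * a * (q * s * (Q * Q) * N)
              ≡⟨ regroup a q s (Q * Q) N ⟩
            q * (2 * a * s * (Q * Q) * N) ∎
            where
            open ≤-Reasoning
            a = length A
            regroup : ∀ a q s p n → 2 * a * (q * s * p * n) ≡ q * (2 * a * s * p * n)
            regroup = solve-∀
            line : ∀ ξ η → ∑[ t ∈ elements ] (⟦ ‖ ξ ⊞ t ⊛ basis i ‖ ≟ᶠ ‖ η ‖ ⟧ * D (ξ ⊞ t ⊛ basis i) η) ≤
                   2 * a * (∑[ b ∈ A ] dispersion (slab b) (pairing ξ η))
            line ξ η = begin
              ∑[ t ∈ elements ] (⟦ ‖ ξ ⊞ t ⊛ basis i ‖ ≟ᶠ ‖ η ‖ ⟧ * D (ξ ⊞ t ⊛ basis i) η)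
                ≤⟨ ∑-mono elements (λ t → *-monoʳ-≤ ⟦ ‖ ξ ⊞ t ⊛ basis i ‖ ≟ᶠ ‖ η ‖ ⟧ (D-slabs t ξ η)) ⟩
              ∑[ t ∈ elements ] (⟦ ‖ ξ ⊞ t ⊛ basis i ‖ ≟ᶠ ‖ η ‖ ⟧ * (a * X))
                ≡⟨ ∑-*ʳ elements _ (a * X) ⟩
              (∑[ t ∈ elements ] ⟦ ‖ ξ ⊞ t ⊛ basis i ‖ ≟ᶠ ‖ η ‖ ⟧) * (a * X)
                ≤⟨ *-monoˡ-≤ (a * X) (sphere-line (‖basis‖≢0 i) ξ (‖ η ‖)) ⟩
              2 * (a * X)
                ≡⟨ *-assoc 2 a X ⟨
              2 * a * X ∎
              where X = ∑[ b ∈ A ] dispersion (slab b) (pairing ξ η)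

          ∑-variance : ∑ O variance ≤ 4 ^ d * length O * (2 * length A * (Q * Q) * N)
          ∑-variance = *-cancelˡ-≤ (q * s) {{m*n≢0 q s}} (begin
            q * s * ∑ O variance
              ≤⟨ ∑-variance-equinormal ⟩
            4 ^ d * (q * length O) * equinormal
              ≤⟨ *-monoʳ-≤ (4 ^ d * (q * length O)) (*-cancelˡ-≤ q equinormal-bound) ⟩
            4 ^ d * (q * length O) * (2 * length A * s * (Q * Q) * N)
              ≡⟨ regroup (4 ^ d) q (length O) (length A) s (Q * Q) N ⟩
            q * s * (4 ^ d * length O * (2 * length A * (Q * Q) * N)) ∎)
            where
            open ≤-Reasoning
            regroup : ∀ c q o a s p n → c * (q * o) * (2 * a * s * p * n) ≡ q * s * (c * o * (2 * a * p * n))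
            regroup = solve-∀

  -- From the variance to the number of classes

  ladder≡C : ∀ k → ladder 0 k ≡ suc k C 2
  ladder≡C zero    = refl
  ladder≡C (suc k) = begin
    ladder 0 (suc k)          ≡⟨ ladder-last 0 k ⟩
    ladder 0 k + suc k        ≡⟨ cong₂ _+_ (ladder≡C k) (sym (nC1≡n (suc k))) ⟩
    suc k C 2 + suc k C 1     ≡⟨ +-comm (suc k C 2) (suc k C 1) ⟩
    suc k C 1 + suc k C 2     ≡⟨ nCk+nC[k+1]≡[n+1]C[k+1] (suc k) 1 ⟩
    suc (suc k) C 2           ∎
    where open ≡-Reasoning

  ^-distribʳ-* : ∀ m n o → (m * n) ^ o ≡ m ^ o * n ^ o
  ^-distribʳ-* m n zero    = refl
  ^-distribʳ-* m n (suc o) rewrite ^-distribʳ-* m n o = lemma m n (m ^ o) (n ^ o)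
    where
    lemma : ∀ a b c d → a * b * (c * d) ≡ a * c * (b * d)
    lemma = solve-∀

  2n≤m⇒m≤2∣m-n∣ : ∀ m n → 2 * n ≤ m → m ≤ 2 * ∣ m - n ∣
  2n≤m⇒m≤2∣m-n∣ m n 2n≤m with r , refl ← m≤n⇒∃[o]m+o≡n (≤-trans (m≤n*m n 2) 2n≤m) = begin
    n + r                   ≤⟨ +-monoˡ-≤ r n≤r ⟩
    r + r                   ≡⟨ cong (r +_) (sym (+-identityʳ r)) ⟩
    2 * r                   ≡⟨ cong (2 *_) (∣m+n-m∣≡n n r) ⟨
    2 * ∣ n + r - n ∣       ∎
    where
    open ≤-Reasoning
    n≤r : n ≤ r
    n≤r = ≤-trans (≤-reflexive (sym (+-identityʳ n))) (+-cancelˡ-≤ n _ _ 2n≤m)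

  -- Values up to twice the mean are bounded trivially, larger ones by their deviation.
  moment-split : ∀ Q x N L j → x ≤ L → let k = suc j in
    Q ^ k * (Q * Q) * x ^ suc k ≤
    (2 * N) ^ k * (Q * Q) * x + 4 * Q ^ k * L ^ j * (∣ Q * x - N ∣ * ∣ Q * x - N ∣)
  moment-split Q x N L j x≤L with ≤-total (Q * x) (2 * N)
  ... | inj₁ small = ≤-trans (begin
    Q ^ k * (Q * Q) * (x * x ^ k)       ≡⟨ regroup (Q ^ k) (Q * Q) x (x ^ k) ⟩
    Q ^ k * x ^ k * (Q * Q) * x         ≡⟨ cong (λ p → p * (Q * Q) * x) (^-distribʳ-* Q x k) ⟨
    (Q * x) ^ k * (Q * Q) * x           ≤⟨ *-monoˡ-≤ x (*-monoˡ-≤ (Q * Q) (^-monoˡ-≤ k small)) ⟩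
    (2 * N) ^ k * (Q * Q) * x           ∎) (m≤m+n _ _)
    where
    open ≤-Reasoning
    k = suc j
    regroup : ∀ a b x p → a * b * (x * p) ≡ a * p * b * x
    regroup = solve-∀
  ... | inj₂ large = ≤-trans (begin
    Q ^ k * (Q * Q) * (x * (x * x ^ j))             ≡⟨ regroup (Q ^ k) Q x (x ^ j) ⟩
    Q ^ k * x ^ j * (Q * x * (Q * x))               ≤⟨ *-mono-≤ (*-monoʳ-≤ (Q ^ k) (^-monoˡ-≤ j x≤L)) (*-mono-≤ dev dev) ⟩
    Q ^ k * L ^ j * (2 * r * (2 * r))               ≡⟨ regroup′ (Q ^ k) (L ^ j) r ⟩
    4 * Q ^ k * L ^ j * (r * r)                     ∎) (m≤n+m _ _)
    where
    open ≤-Reasoning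
    k = suc j
    r = ∣ Q * x - N ∣
    dev : Q * x ≤ 2 * r
    dev = 2n≤m⇒m≤2∣m-n∣ (Q * x) N large
    regroup : ∀ a q x p → a * (q * q) * (x * (x * p)) ≡ a * p * (q * x * (q * x))
    regroup = solve-∀
    regroup′ : ∀ a l r → a * l * (2 * r * (2 * r)) ≡ 4 * a * l * (r * r)
    regroup′ = solve-∀

  -- One `2 ^ k` comes from the index of the stabilizer, the other from values up to twice the mean.
  -- The 8 is the 4 of `moment-split` times the 2 of the variance bound, and `4 ^ d` is the loss in
  -- the orbit bound.
  denominator : (d k m n : ℕ) → ℕ
  denominator d k m n = 2 ^ k * (2 ^ k * m + 8 * 4 ^ d * n)

  module Classes {q s : ℕ} (q≡1+s : q ≡ suc s) .{{_ : NonZero q}} .{{_ : NonZero s}}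
    (F : FiniteField q) (odd : ¬ 2 ∣ q) (d : ℕ) .{{_ : NonZero d}}
    (E : List (Vec (FiniteField.Carrier F) d)) (E-unique : Unique E)
    (i : Fin d) (A : List (FiniteField.Carrier F)) (A-unique : Unique A)
    (covers : ∀ u → u ∈ E → lookup u i ∈ A) where

    open Variance q≡1+s F odd d

    a X : ℕ
    a = length A
    X = L E

    instance
      Q≢0 : NonZero Q
      Q≢0 = m^n≢0 q d

      QQ≢0 : NonZero (Q * Q)
      QQ≢0 = m*n≢0 Q Q

      O≢0 : NonZero (length O)
      O≢0 = >-nonZero (≤-trans (∑-∈-≤ (λ _ → 1) (orthogonal⇒∈O {𝟏} 𝟏-orthogonal)) (≤-reflexive (∑-1 O)))

    multiplicity≤ : ∀ θ z → multiplicity E θ z ≤ X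
    multiplicity≤ θ z = ≤-trans
      (∑-mono E λ u → ∑-unique-≤1 (z ⊞ θ · u ≟ᴾ_) E-unique λ _ _ p r → trans (sym p) r)
      (≤-reflexive (∑-1 E))

    -- As k = j + 1, two factors λ can be traded for a squared deviation, which leaves j factors
    -- bounded by |E|. The other part is linear in λ and is summed by means of ∑_z λ_θ(z) = |E|².
    moment-bound : ∀ j → let k = suc j in
      Q ^ k * moment E (suc k) ≤
      length O * ((2 * (X * X)) ^ k * (X * X) + 8 * 4 ^ d * a * Q ^ k * (X ^ j * (X * X)))
    moment-bound j = *-cancelˡ-≤ (Q * Q) (begin
      Q * Q * (Q ^ k * moment E (suc k))
        ≡⟨ trans (sym (*-assoc (Q * Q) (Q ^ k) _)) (cong (_* moment E (suc k)) (*-comm (Q * Q) (Q ^ k))) ⟩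
      c * moment E (suc k)
        ≡⟨ trans (sym (∑-*ˡ O c _)) (∑-cong O λ θ → sym (∑-*ˡ points c _)) ⟩
      ∑[ θ ∈ O ] ∑[ z ∈ points ] (c * multiplicity E θ z ^ suc k)
        ≤⟨ ∑-mono O (λ θ → ∑-mono points λ z → moment-split Q (multiplicity E θ z) M X j (multiplicity≤ θ z)) ⟩
      ∑[ θ ∈ O ] ∑[ z ∈ points ] (e * multiplicity E θ z + f * (∣ Q * multiplicity E θ z - M ∣ * ∣ Q * multiplicity E θ z - M ∣))
        ≡⟨ ∑-cong O (λ θ → trans (∑-+ points _ _) (cong₂ _+_ (trans (∑-*ˡ points e _) (cong (e *_) (∑-multiplicity E θ))) (∑-*ˡ points f _))) ⟩
      ∑[ θ ∈ O ] (e * M + f * variance E θ)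
        ≡⟨ trans (∑-+ O _ _) (cong₂ _+_ (∑-const O (e * M)) (∑-*ˡ O f (variance E))) ⟩
      length O * (e * M) + f * ∑ O (variance E)
        ≤⟨ +-monoʳ-≤ (length O * (e * M)) (*-monoʳ-≤ f (∑-variance E i E-unique A A-unique covers)) ⟩
      length O * (e * M) + f * (4 ^ d * length O * (2 * a * (Q * Q) * M))
        ≡⟨ regroup (length O) ((2 * M) ^ k) (Q * Q) M (Q ^ k) (X ^ j) (4 ^ d) a ⟩
      Q * Q * (length O * ((2 * M) ^ k * M + 8 * 4 ^ d * a * Q ^ k * (X ^ j * M))) ∎)
      where
      open ≤-Reasoning
      k = suc j
      M = X * X
      c = Q ^ k * (Q * Q)
      e = (2 * M) ^ k * (Q * Q)
      f = 4 * Q ^ k * X ^ j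
      regroup : ∀ o t p m u x c a →
        o * (t * p * m) + 4 * u * x * (c * o * (2 * a * p * m)) ≡ p * (o * (t * m + 8 * c * a * u * (x * m)))
      regroup = solve-∀

    classes : ℕ → ℕ
    classes k = length (List.deduplicate (_≅?_ {k}) (vectors E (suc k)))

    -- With K = m / n the hypothesis absorbs the variance term into a multiple of |E|^(2k+2). That
    -- power and |O| then stand on both sides; they are nonzero and cancel.
    classes-bound : ∀ k m n → 1 ≤ k → k ≤ d → .{{_ : NonZero X}} → m * q ^ (k * d) * a ≤ n * X ^ suc k →
      m * q ^ (suc k C 2) ≤ classes k * denominator d k m n
    classes-bound k@(suc j) m n 1≤k k≤d large = *-cancelˡ-≤ (length O * (Y * Y)) {{nonzero}} (*-cancelˡ-≤ (Q ^ k) {{m^n≢0 Q k}} (begin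
      Q ^ k * (length O * (Y * Y) * (m * q ^ (suc k C 2)))
        ≡⟨ cong (λ e → Q ^ k * (length O * (Y * Y) * (m * q ^ e))) (ladder≡C k) ⟨
      Q ^ k * (length O * (Y * Y) * (m * T))
        ≡⟨ regroup₁ (Q ^ k) (length O) (Y * Y) m T ⟩
      Q ^ k * m * (T * length O * (Y * Y))
        ≤⟨ *-monoʳ-≤ (Q ^ k * m) (classes-moment E k≤d) ⟩
      Q ^ k * m * (classes k * ((2 * Q) ^ k * moment E (suc k)))
        ≡⟨ cong (λ p → Q ^ k * m * (classes k * (p * moment E (suc k)))) (^-distribʳ-* 2 Q k) ⟩
      Q ^ k * m * (classes k * (2 ^ k * Q ^ k * moment E (suc k)))
        ≡⟨ regroup₂ (Q ^ k) m (classes k) (2 ^ k) (moment E (suc k)) ⟩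
      Q ^ k * (classes k * 2 ^ k * (m * (Q ^ k * moment E (suc k))))
        ≤⟨ *-monoʳ-≤ (Q ^ k) (*-monoʳ-≤ (classes k * 2 ^ k) average) ⟩
      Q ^ k * (classes k * 2 ^ k * (length O * (Y * Y) * (2 ^ k * m + 8 * 4 ^ d * n)))
        ≡⟨ regroup₃ (Q ^ k) (classes k) (2 ^ k) (length O * (Y * Y)) (2 ^ k * m + 8 * 4 ^ d * n) ⟩
      Q ^ k * (length O * (Y * Y) * (classes k * denominator d k m n)) ∎))
      where
      open ≤-Reasoning
      T = q ^ ladder 0 k
      Y = X ^ suc k
      nonzero : NonZero (length O * (Y * Y))
      nonzero = m*n≢0 (length O) (Y * Y) {{O≢0}} {{m*n≢0 Y Y {{m^n≢0 X (suc k)}} {{m^n≢0 X (suc k)}}}}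
      regroup₁ : ∀ p o y m t → p * (o * y * (m * t)) ≡ p * m * (t * o * y)
      regroup₁ = solve-∀
      regroup₂ : ∀ p m c t z → p * m * (c * (t * p * z)) ≡ p * (c * t * (m * (p * z)))
      regroup₂ = solve-∀
      regroup₃ : ∀ p c t y z → p * (c * t * (y * z)) ≡ p * (y * (c * (t * z)))
      regroup₃ = solve-∀
      Y-split : X ^ j * (X * X) ≡ Y
      Y-split = trans (*-comm (X ^ j) (X * X)) (*-assoc X X (X ^ j))
      YY-split : (2 * (X * X)) ^ k * (X * X) ≡ 2 ^ k * (Y * Y)
      YY-split = begin-equality
        (2 * (X * X)) ^ k * (X * X)                ≡⟨ cong (_* (X * X)) (trans (^-distribʳ-* 2 (X * X) k) (cong (2 ^ k *_) (^-distribʳ-* X X k))) ⟩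
        2 ^ k * (X ^ k * X ^ k) * (X * X)          ≡⟨ square (2 ^ k) (X ^ k) X ⟩
        2 ^ k * (X * X ^ k * (X * X ^ k))          ∎
        where
        square : ∀ t y x → t * (y * y) * (x * x) ≡ t * (x * y * (x * y))
        square = solve-∀
      large′ : m * Q ^ k * a ≤ n * Y
      large′ = ≤-trans (≤-reflexive (cong (λ p → m * p * a) (trans (^-*-assoc q d k) (cong (q ^_) (*-comm d k))))) large
      average : m * (Q ^ k * moment E (suc k)) ≤ length O * (Y * Y) * (2 ^ k * m + 8 * 4 ^ d * n)
      average = begin
        m * (Q ^ k * moment E (suc k))
          ≤⟨ *-monoʳ-≤ m (moment-bound j) ⟩
        m * (length O * ((2 * (X * X)) ^ k * (X * X) + 8 * 4 ^ d * a * Q ^ k * (X ^ j * (X * X))))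
          ≡⟨ cong₂ (λ y z → m * (length O * (y + 8 * 4 ^ d * a * Q ^ k * z))) YY-split Y-split ⟩
        m * (length O * (2 ^ k * (Y * Y) + 8 * 4 ^ d * a * Q ^ k * Y))
          ≡⟨ regroup₅ m (length O) (2 ^ k) Y (4 ^ d) a (Q ^ k) ⟩
        length O * (2 ^ k * m * (Y * Y) + 8 * 4 ^ d * (m * Q ^ k * a) * Y)
          ≤⟨ *-monoʳ-≤ (length O) (+-monoʳ-≤ (2 ^ k * m * (Y * Y)) (*-monoˡ-≤ Y (*-monoʳ-≤ (8 * 4 ^ d) large′))) ⟩
        length O * (2 ^ k * m * (Y * Y) + 8 * 4 ^ d * (n * Y) * Y)
          ≡⟨ regroup₆ (length O) (2 ^ k) m Y (4 ^ d) n ⟩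
        length O * (Y * Y) * (2 ^ k * m + 8 * 4 ^ d * n) ∎
        where
        regroup₅ : ∀ m o t y c a p → m * (o * (t * (y * y) + 8 * c * a * p * y)) ≡ o * (t * m * (y * y) + 8 * c * (m * p * a) * y)
        regroup₅ = solve-∀
        regroup₆ : ∀ o t m y c n → o * (t * m * (y * y) + 8 * c * (n * y) * y) ≡ o * (y * y) * (t * m + 8 * c * n)
        regroup₆ = solve-∀

  -- Prime powers, the factors of the product set, and rational constants

  odd-power : ∀ {p} → Prime p → p ≢ 2 → ∀ r → ¬ 2 ∣ p ^ r
  odd-power pp p≢2 zero    2∣1 with () ← ∣1⇒≡1 2∣1
  odd-power {p} pp p≢2 (suc r) 2∣pp^r with euclidsLemma p (p ^ r) prime[2] 2∣pp^r
  ... | inj₂ 2∣p^r = odd-power pp p≢2 r 2∣p^r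
  ... | inj₁ 2∣p with prime⇒irreducible pp 2∣p
  ... | inj₁ ()
  ... | inj₂ 2≡p = p≢2 (sym 2≡p)

  1<prime-power : ∀ {p} → Prime p → ∀ r → 1 ≤ r → 1 < p ^ r
  1<prime-power {p} pp r 1≤r = begin-strict
    1        <⟨ nonTrivial⇒n>1 p {{prime⇒nonTrivial pp}} ⟩
    p        ≡⟨ *-identityʳ p ⟨
    p ^ 1    ≤⟨ ^-monoʳ-≤ p {{prime⇒nonZero pp}} 1≤r ⟩
    p ^ r    ∎
    where open ≤-Reasoning

  -- Compares the list of field elements in a factor with the cardinality of its set of indices.
  length-filter-tabulate : {P : A → Set} (P? : ∀ x → Dec (P x)) (g : Fin n → A) (S : Subset n) →
    (∀ j → P (g j) → j Subset.∈ S) → length (List.filter P? (List.tabulate g)) ≤ ∣ S ∣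
  length-filter-tabulate P? g []       P⇒S = z≤n
  length-filter-tabulate P? g (s ∷ S) P⇒S
    with P? (g zero) | length-filter-tabulate P? (g ∘ suc) S (λ j p → drop-there (P⇒S (suc j) p))
  length-filter-tabulate P? g (inside ∷ S)  P⇒S | yes p | rest = s≤s rest
  length-filter-tabulate P? g (outside ∷ S) P⇒S | yes p | rest with () ← P⇒S zero p
  length-filter-tabulate P? g (inside ∷ S)  P⇒S | no _ | rest = m≤n⇒m≤1+n rest
  length-filter-tabulate P? g (outside ∷ S) P⇒S | no _ | rest = rest

  smallest-factor : ∀ {q d} (F : FiniteField q) →
    let open Geometry F d
    in
    (A : Fin d → Subset q) → Fin d → ∃[ i ] ∣ A i ∣ ≤ minCardinality A
  smallest-factor {q} F A i₀ with argmin-sel id q (List.tabulate λ i → ∣ A i ∣)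
  -- The minimum is the default value q, which is an upper bound for every |A_i|, so any index will
  -- do.
  ... | inj₁ e = i₀ , ≤-trans (∣p∣≤n (A i₀)) (≤-reflexive (sym e))
  ... | inj₂ m∈ with i , e ← ∈-tabulate⁻ m∈ = i , ≤-reflexive (sym e)

  fromℕ-*ᵘ : ∀ m n y → ℚ.toℚᵘ ((ℤ.+ m ℚ./ suc n) ℚ.* fromℕ y) ℚᵘ.≃ mkℚᵘ (ℤ.+ m) n ℚᵘ.* mkℚᵘ (ℤ.+ y) 0
  fromℕ-*ᵘ m n y = ℚᵘ.≃-trans (ℚ.toℚᵘ-homo-* (ℤ.+ m ℚ./ suc n) (fromℕ y))
    (ℚᵘ.*-cong (ℚ.toℚᵘ-fromℚᵘ (mkℚᵘ (ℤ.+ m) n)) (ℚ.toℚᵘ-fromℚᵘ (mkℚᵘ (ℤ.+ y) 0)))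

  -- Passing to unnormalised fractions makes the order a comparison of cross products, which clears
  -- both denominators.
  fraction-≤⁻ : ∀ m n y a z .{{_ : NonZero a}} →
    (ℤ.+ m ℚ./ suc n) ℚ.* fromℕ y ℚ.≤ (ℤ.+ 1 ℚ./ a) ℚ.* fromℕ z → m * y * a ≤ suc n * z
  fraction-≤⁻ m n y a@(suc a-1) z h
    with ℚᵘ.≤-trans (ℚᵘ.≤-reflexive (ℚᵘ.≃-sym (fromℕ-*ᵘ m n y))) (ℚᵘ.≤-trans (ℚ.toℚᵘ-mono-≤ h) (ℚᵘ.≤-reflexive (fromℕ-*ᵘ 1 a-1 z)))
  ... | ℚᵘ.*≤* le = ≤-trans (≤-reflexive (lemma₁ m y a)) (≤-trans (ℤ.drop‿+≤+ le′) (≤-reflexive (lemma₂ z n)))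
    where
    lemma₁ : ∀ m y a → m * y * a ≡ m * y * (a * 1)
    lemma₁ = solve-∀
    lemma₂ : ∀ z n → 1 * z * (suc n * 1) ≡ suc n * z
    lemma₂ = solve-∀
    le′ : ℤ.+ (m * y * (a * 1)) ℤ.≤ ℤ.+ (1 * z * (suc n * 1))
    le′ = subst₂ ℤ._≤_
      (trans (cong (ℤ._* ℤ.+ (a * 1)) (sym (ℤ.pos-* m y))) (sym (ℤ.pos-* (m * y) (a * 1))))
      (trans (cong (ℤ._* ℤ.+ (suc n * 1)) (sym (ℤ.pos-* 1 z))) (sym (ℤ.pos-* (1 * z) (suc n * 1)))) le

  fraction-≤⁺ : ∀ m n y z → m * y ≤ z * suc n → (ℤ.+ m ℚ./ suc n) ℚ.* fromℕ y ℚ.≤ fromℕ z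
  fraction-≤⁺ m n y z h = ℚ.toℚᵘ-cancel-≤ (ℚᵘ.≤-trans (ℚᵘ.≤-reflexive (fromℕ-*ᵘ m n y))
    (ℚᵘ.≤-trans (ℚᵘ.*≤* (subst₂ ℤ._≤_ left right (ℤ.+≤+ h))) (ℚᵘ.≤-reflexive (ℚᵘ.≃-sym (ℚ.toℚᵘ-fromℚᵘ (mkℚᵘ (ℤ.+ z) 0))))))
    where
    left : ℤ.+ (m * y) ≡ ℤ.+ m ℤ.* ℤ.+ y ℤ.* ℤ.+ 1
    left = trans (ℤ.pos-* m y) (sym (ℤ.*-identityʳ _))
    right : ℤ.+ (z * suc n) ≡ ℤ.+ z ℤ.* ℤ.+ (suc n * 1)
    right = trans (ℤ.pos-* z (suc n)) (cong (λ k → ℤ.+ z ℤ.* ℤ.+ k) (sym (*-identityʳ (suc n))))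

  simplex-classes : ∀ {d k} → 1 ≤ k → k ≤ d → ∀ m n .{{_ : NonZero m}} {p r} → Prime p → p ≢ 2 → 1 ≤ r →
    (F : FiniteField (p ^ r)) →
    let q = p ^ r
        open Geometry F d
    in
    (A : Fin d → Subset q) .{{_ : NonZero (minCardinality A)}} →
    m * q ^ (k * d) * minCardinality A ≤ n * cardinality (product? A) ^ suc k →
    m * q ^ (suc k C 2) ≤ congruenceClasses (product? A) k * denominator d k m n
  simplex-classes {d} {k} 1≤k k≤d m n {p} {r} pp p≢2 1≤r F A large =
    let i , ∣Aᵢ∣≤min = smallest-factor F A (Fin.fromℕ< 0<d) in
    Classes.classes-bound (sym (suc-pred q)) F (odd-power pp p≢2 r) d
      (members (product? A)) (Unique.filter⁺ (product? A) (vectors-unique (Scalars.elements-unique F) d))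
      i (factor i) (Unique.filter⁺ (member? i) (Scalars.elements-unique F)) (covers i)
      k m n 1≤k k≤d
      (≤-trans (*-monoʳ-≤ (m * q ^ (k * d)) (≤-trans (factor-size i) ∣Aᵢ∣≤min)) large)
    where
    open Geometry F d
    open FiniteField F using (index; elements; elements-complete; enumeration)
    q = p ^ r
    0<d : 0 < d
    0<d = ≤-trans 1≤k k≤d
    1<q : 1 < q
    1<q = 1<prime-power pp r 1≤r
    instance
      d≢0 : NonZero d
      d≢0 = >-nonZero 0<d
      q≢0 : NonZero q
      q≢0 = >-nonZero (<-trans z<s 1<q)
      pred-q≢0 : NonZero (pred q)
      pred-q≢0 = >-nonZero (<-≤-trans z<s (pred-mono-≤ 1<q))
      -- An empty product would make the right side of `large` zero, while its left side is
      -- positive.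
      E≢0 : NonZero (cardinality (product? A))
      E≢0 = ≢-nonZero λ empty → ≢-nonZero⁻¹ (m * q ^ (k * d) * minCardinality A)
        {{m*n≢0 _ _ {{m*n≢0 m _ {{it}} {{m^n≢0 q (k * d)}}}}}}
        (n≤0⇒n≡0 (≤-trans large (≤-reflexive (trans (cong (λ l → n * l ^ suc k) empty) (*-zeroʳ n)))))
    member? : ∀ i x → Dec (index x Subset.∈ A i)
    member? i x = index x ∈? A i
    factor : ∀ i → List (FiniteField.Carrier F)
    factor i = List.filter (member? i) elements
    factor-size : ∀ i → length (factor i) ≤ ∣ A i ∣
    factor-size i = length-filter-tabulate (member? i) (Inverse.from enumeration) (A i)
      λ j → subst (Subset._∈ A i) (Inverse.strictlyInverseˡ enumeration j)
    covers : ∀ i u → u ∈ members (product? A) → lookup u i ∈ factor i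
    covers i u u∈ = ∈-filter⁺ (member? i) (elements-complete (lookup u i))
      (proj₂ (∈-filter⁻ (product? A) {xs = points} u∈) i)

open import Data.Fin using (Fin)
open import Data.Fin.Subset using (Subset)
open import Data.Integer using (+_)
open import Data.Nat using (ℕ; suc; _^_; NonZero) renaming (_≤_ to _≤ℕ_; _*_ to _*ℕ_)
open import Data.Nat.Combinatorics using (_C_)
open import Data.Nat.Primality using (Prime)
open import Data.Nat.Properties using (≤-trans; *-monoʳ-≤; n≤1+n)
open import Data.Product using (∃-syntax; _×_; _,_)
open import Data.Rational using (ℚ; mkℚ; Positive; _≤_; _*_; _/_)
open import Data.Rational.Properties using (fromℚᵘ-toℚᵘ; normalize-pos)
open import Relation.Binary.PropositionalEquality using (_≢_; subst; sym)

theorem1p2 :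
  (d k : ℕ) → 1 ≤ℕ k → k ≤ℕ d →
  (K : ℚ) → Positive K →
  ∃[ c ] (Positive c ×
    ((p r : ℕ) → Prime p → p ≢ 2 → 1 ≤ℕ r →
     (F : FiniteField (p ^ r)) →
     let q = p ^ r
         open Geometry F d
     in
     (A : Fin d → Subset q) →
     .{{_ : NonZero (minCardinality A)}} →
     K * fromℕ (q ^ (k *ℕ d)) ≤
       (+ 1 / minCardinality A) * fromℕ (cardinality (product? A) ^ suc k) →
     c * fromℕ (q ^ (suc k C 2)) ≤
       fromℕ (congruenceClasses (product? A) k)))
theorem1p2 d k 1≤k k≤d K@(mkℚ (+ suc m) n coprime) _ =
  -- `B` depends only on d, k and K. Taking `suc B` makes the denominator visibly nonzero and only
  -- makes the constant smaller.
  + suc m / suc B , normalize-pos (suc m) (suc B) , λ p r pp p≢2 1≤r F A large →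
    let open Geometry F d
        q = p ^ r
        classes = congruenceClasses (product? A) k
        tuples = cardinality (product? A) ^ suc k
    in
    fraction-≤⁺ (suc m) B (q ^ (suc k C 2)) classes (≤-trans
      (simplex-classes 1≤k k≤d (suc m) (suc n) pp p≢2 1≤r F A
        (fraction-≤⁻ (suc m) n (q ^ (k *ℕ d)) (minCardinality A) tuples
          -- Rewrites K, given in lowest terms, as the quotient of its numerator and denominator.
          (subst (λ κ → κ * fromℕ (q ^ (k *ℕ d)) ≤ (+ 1 / minCardinality A) * fromℕ tuples) (sym (fromℚᵘ-toℚᵘ K)) large)))
      (*-monoʳ-≤ classes (n≤1+n B)))
  where
  open SimplexCounting using (denominator; fraction-≤⁺; fraction-≤⁻; simplex-classes)
  B = denominator d k (suc m) (suc n)
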